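{- Let $p>3$ be a prime and let $\omega_6=(1+i\sqrt{3})/2$ (a root of $x^2-x+1$). Then \begin{align*} \pounds_2(1+\omega_6^{\pm 1})&\equiv -\frac{q_p(3)^2}{16}\left(3\pm i\sqrt{3}\left(\frac{p}{3}\right)\right)+\frac{1}{36}\left(3\left(\frac{p}{3}\right)\mp i\sqrt{3}\right)B_{p-2}(1/3) \pmod{p},\\ \pounds_2\bigl((1+\omega_6^{\pm 1})/3\bigr)&\equiv -\frac{q_p(3)^2}{8}+\frac{1}{36}\left(\left(\frac{p}{3}\right)\pm i\sqrt{3}\right)B_{p-2}(1/3) \pmod{p}. \end{align*}
   Context: For a prime $p$ and a positive integer $d$, the finite polylogarithm is $\pounds_d(x)=\sum_{k=1}^{p-1} x^k/k^d$. $q_p(a)=(a^{p-1}-1)/p$ is the Fermat quotient. $B_n(x)$ denotes the $n$-th Bernoulli polynomial and $\left(\frac{\cdot}{\cdot}\right)$ the Legendre symbol. Congruences modulo $p$ are taken in the ring of elements of $\mathbb{Q}(\sqrt{ -3})$ that are integral at all primes above $p$: $a\equiv b\pmod p$ means $(a-b)/p$ is such an element. -}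

module Defs where

open import Data.Nat as ℕ using (ℕ; zero; suc)
open import Data.Nat.Combinatorics using (_C_)
open import Data.Nat.Divisibility using (_∣_)
open import Data.Integer as ℤ using (ℤ; +_)
open import Data.Rational as ℚ using (ℚ; 0ℚ; 1ℚ; _/_; ≢-nonZero)
open import Data.Rational.Properties using (_≟_)
open import Data.List using (List; []; _∷_; upTo; _++_)
open import Data.Bool using (Bool; true; false; if_then_else_)
open import Data.Bool.ListAction using (any)
open import Data.Sign using (Sign)
open import Relation.Nullary using (¬_; yes; no)
open import Relation.Nullary.Decidable using (⌊_⌋)
open import Data.Product using (_×_; _,_)
open import Data.Empty using (⊥)

_^ℚ_ : ℚ → ℕ → ℚ
x ^ℚ zero  = 1ℚ
x ^ℚ suc n = x ℚ.* (x ^ℚ n)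

fromℕ : ℕ → ℚ
fromℕ n = + n / 1

sumBelow : ℕ → (ℕ → ℚ) → ℚ
sumBelow zero    f = 0ℚ
sumBelow (suc n) f = sumBelow n f ℚ.+ f n

-- Bernoulli numbers (B₁ = -1/2) by the recursion
--   B₀ = 1,  B_m = -1/(m+1) Σ_{k<m} C(m+1,k) B_k ,
-- and Bernoulli polynomials B_n(x) = Σ_{k=0}^n C(n,k) B_k x^{n-k}.

bernoulliList : ℕ → List ℚ
bernoulliList zero    = 1ℚ ∷ []
bernoulliList (suc m) = bs ++ (Bm ∷ [])
  where
  bs : List ℚ
  bs = bernoulliList m
  idx : List ℚ → ℕ → ℚ
  idx []       _       = 0ℚ
  idx (b ∷ _)  zero    = b
  idx (_ ∷ r)  (suc k) = idx r k
  Bm : ℚ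
  Bm = ℚ.- ((+ 1 / suc (suc m)) ℚ.*
          sumBelow (suc m) (λ k → fromℕ (suc (suc m) C k) ℚ.* idx bs k))

nth : List ℚ → ℕ → ℚ
nth []      _       = 0ℚ
nth (b ∷ _) zero    = b
nth (_ ∷ r) (suc k) = nth r k

bernoulli : ℕ → ℚ
bernoulli n = nth (bernoulliList n) n

bernoulliPoly : ℕ → ℚ → ℚ
bernoulliPoly n x = sumBelow (suc n) (λ k → fromℕ (n C k) ℚ.* bernoulli k ℚ.* (x ^ℚ (n ℕ.∸ k)))

-- Fermat quotient q_p(a) = (a^(p-1) - 1)/p   (p = 0 is a junk value)

fermatQuotient : ℕ → ℕ → ℚ
fermatQuotient zero    a = 0ℚ
fermatQuotient (suc n) a = (+ (a ℕ.^ n) ℤ.- + 1) / suc n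

-- Legendre symbol (a/q): 0 if q ∣ a, 1 if a is a nonzero quadratic
-- residue mod q, -1 otherwise  (q = 0 junk).

legendre : ℕ → ℕ → ℚ
legendre a zero = 0ℚ
legendre a (suc q) with a ℕ.% suc q ℕ.≟ 0
... | yes _ = 0ℚ
... | no  _ = if any (λ x → ⌊ (x ℕ.* x) ℕ.% suc q ℕ.≟ a ℕ.% suc q ⌋) (upTo (suc q))
              then 1ℚ else ℚ.- 1ℚ

-- The field ℚ(√-3): re + im·√-3

record ℚω : Set where
  constructor ⟨_,_⟩
  field
    re : ℚ
    im : ℚ
open ℚω public

infixl 6 _+ω_ _-ω_
infixl 7 _*ω_

_+ω_ : ℚω → ℚω → ℚω
⟨ a , b ⟩ +ω ⟨ c , d ⟩ = ⟨ a ℚ.+ c , b ℚ.+ d ⟩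

-ω_ : ℚω → ℚω
-ω ⟨ a , b ⟩ = ⟨ ℚ.- a , ℚ.- b ⟩

_-ω_ : ℚω → ℚω → ℚω
x -ω y = x +ω (-ω y)

_*ω_ : ℚω → ℚω → ℚω
⟨ a , b ⟩ *ω ⟨ c , d ⟩ = ⟨ a ℚ.* c ℚ.- fromℕ 3 ℚ.* b ℚ.* d , a ℚ.* d ℚ.+ b ℚ.* c ⟩

ι : ℚ → ℚω
ι a = ⟨ a , 0ℚ ⟩

i√3 : ℚω
i√3 = ⟨ 0ℚ , 1ℚ ⟩

_^ω_ : ℚω → ℕ → ℚω
x ^ω zero  = ι 1ℚ
x ^ω suc n = x *ω (x ^ω n)

norm : ℚω → ℚ
norm ⟨ a , b ⟩ = a ℚ.* a ℚ.+ fromℕ 3 ℚ.* b ℚ.* b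

-- multiplicative inverse (0 ↦ 0)
invω : ℚω → ℚω
invω ⟨ a , b ⟩ with norm ⟨ a , b ⟩ ≟ 0ℚ
... | yes _  = ι 0ℚ
... | no  n≢0 = ⟨ a ℚ.* r , ℚ.- b ℚ.* r ⟩
  where r = ℚ.1/_ (norm ⟨ a , b ⟩) {{≢-nonZero n≢0}}

ω₆ : ℚω
ω₆ = ⟨ + 1 / 2 , + 1 / 2 ⟩

ω₆^ : Sign → ℚω
ω₆^ Sign.+ = ω₆
ω₆^ Sign.- = invω ω₆

sgn : Sign → ℚ
sgn Sign.+ = 1ℚ
sgn Sign.- = ℚ.- 1ℚ

£ : ℕ → ℕ → ℚω → ℚω
£ p d x = go (p ℕ.∸ 1)
  where
  go : ℕ → ℚω
  go zero    = ι 0ℚ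
  go (suc k) = go k +ω ι ((+ 1 / suc k) ^ℚ d) *ω (x ^ω suc k)

-- Congruence mod p in the ring of elements of ℚ(√-3) integral at all
-- primes above p, i.e. ℤ_(p)[ω₆].  An element re + im·√-3 equals
-- (re - im) + (2·im)·ω₆, and {1, ω₆} is a ℤ-basis of the ring of
-- integers ℤ[ω₆]; so it is p-integral iff both ω₆-coordinates are in ℤ_(p).

ℚ-pIntegral : ℕ → ℚ → Set
ℚ-pIntegral p r = ¬ (p ∣ ℚ.denominatorℕ r)

pIntegral : ℕ → ℚω → Set
pIntegral p ⟨ a , b ⟩ = ℚ-pIntegral p (a ℚ.- b) × ℚ-pIntegral p (fromℕ 2 ℚ.* b)

-- a ≡ b (mod p)  ⇔  (a - b)/p is p-integral   (p = 0 junk)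
_≡_[mod_] : ℚω → ℚω → ℕ → Set
x ≡ y [mod zero  ] = ⊥
x ≡ y [mod suc n ] = pIntegral (suc n) (ι (+ 1 / suc n) *ω (x -ω y))

{-# OPTIONS --safe #-}
-- Work in R = ℤ₍ₚ₎[√-3] modulo p, with G(x) = Σ_{0<k<p} xᵏ/k², and put y = -ω, c = 1 + ωᵖ.
-- Expanding the product of Σ xⁱ/i with itself by 1/(ij) = (1/i + 1/j)/(i + j) gives Granville's congruence
-- q(y)² ≡ -2(yᵖ G(y) + (1 - yᵖ) G(1 - y)), where q(y) = ((1 + ω)ᵖ - 1 - ωᵖ)/p.  Since (1 + ω)² = 3ω and
-- c² = 3ωᵖ, the quotient satisfies 2c q(y) ≡ 3ωᵖ q_p(3), so G(1 + ω) is expressed by q_p(3)² and G(-ω);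
-- the value at 1/(1 + ω) follows from k ↦ p - k.  As -ω is a cube root of unity, G(-ω) reduces to sums of
-- k^(p-3) along residue classes mod 3, which telescope to B_{p-2}(1/3) because B_{p-2} ≡ 0.
module Submission where

open import Defs
open import Data.Nat using (ℕ; _<_; _∸_)
open import Data.Nat.Primality using (Prime)
open import Data.Integer using (+_)
open import Data.Rational using (_/_) renaming (_*_ to _*ℚ_)
open import Data.Sign using (Sign)
open import Data.Product using (_×_)

open import Level using (Level; _⊔_; 0ℓ)
open import Algebra.Bundles using (CommutativeRing)
open import Algebra.Structures using (IsCommutativeRing)
open import Data.Bool using (if_then_else_)
open import Data.Bool.ListAction using (any)
open import Data.Empty using (⊥-elim)
open import Data.Integer as ℤ using (ℤ; -[1+_])
import Data.Integer.Properties as ℤ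
open import Data.List using (List; []; _∷_; _++_; length; upTo)
import Data.List.Properties as List
open import Data.Maybe using (Maybe; just; nothing)
open import Data.Nat as ℕ using (zero; suc; s≤s; z≤n)
import Data.Nat.Properties as ℕ
import Data.Nat.DivMod as ℕ
open import Data.Nat.Combinatorics using (_C_; nCn≡1; nC1≡n; nCk≡nC[n∸k]; nCk+nC[k+1]≡[n+1]C[k+1]; k>n⇒nCk≡0)
import Data.Nat.Coprimality as Coprimality
open import Data.Nat.Divisibility using (_∣_; divides; ∣-trans; ∣⇒≤; m%n≡0⇒n∣m)
open import Data.Nat.Induction using (<-rec)
open import Data.Nat.Primality using (euclidsLemma; prime⇒irreducible)
open import Data.Product using (_,_; ∃; proj₁; proj₂)
open import Data.Rational as ℚ using (ℚ; 0ℚ; 1ℚ; mkℚ; toℚᵘ)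
import Data.Rational.Properties as ℚ
open import Data.Rational.Unnormalised as ℚᵘ using (mkℚᵘ; *≡*) renaming (_≃_ to _≃ᵘ_)
import Data.Rational.Unnormalised.Properties as ℚᵘ
open import Data.Sign as Sign using ()
open import Data.Sum using (_⊎_; inj₁; inj₂)
open import Relation.Nullary using (¬_; yes; no)
open import Relation.Nullary.Decidable using (⌊_⌋)
open import Relation.Binary.PropositionalEquality as ≡ using (_≡_; _≢_; refl; sym; trans; cong; cong₂; subst)

-- Granville's congruence is obtained with 1/k written as k^(p-2), which is defined and p-periodic
-- for every k: the product can then be summed over the full square 0 <= i, j < p, the indices i + j
-- beyond p wrapping round with a factor x^p. This leaves the nested sum M(y) of y^l/(l k) over 0 <
-- l < k < p, and M is eliminated by the reflection formula G(1 - y) = M(y) + G(y), which comes from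
-- C(p-1, k) = (-1)^k. All of this needs only characteristic p and inverses of 1, ..., p-1. The
-- obstacle is that q(y) and q_p(3) do not exist in characteristic p, being quotients by p. The
-- relation between them is therefore proved from exact identities in a ring where p can be
-- cancelled, and reduced afterwards. Reduction keeps the carrier and coarsens the equality to one
-- that stores its quotient, so that q_p(3) is read off from the congruence 3^(p-1) = 1. For the
-- second formula, (1 + ω)(1 + 1/ω) = 3, so (1 + ω)/3 is the inverse of 1 + 1/ω and its congruence
-- comes from the conjugate root. B_(p-2) is 0 mod p because p - 2 > 1 is odd.

nC0≡1 : ∀ n → n C 0 ≡ 1
nC0≡1 n = ≡.trans (nCk≡nC[n∸k] {0} {n} z≤n) (nCn≡1 n)

[1+n]Cn≡1+n : ∀ n → suc n C n ≡ suc n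
[1+n]Cn≡1+n n = trans (nCk≡nC[n∸k] (ℕ.n≤1+n n)) (trans (cong (suc n C_) (ℕ.m+n∸n≡m 1 n)) (nC1≡n (suc n)))

[k+1]*[n+1]C[k+1]≡[n+1]*nCk : ∀ n k → suc k ℕ.* (suc n C suc k) ≡ suc n ℕ.* (n C k)
[k+1]*[n+1]C[k+1]≡[n+1]*nCk n zero = begin
  1 ℕ.* (suc n C 1)  ≡⟨ ℕ.*-identityˡ _ ⟩
  suc n C 1          ≡⟨ nC1≡n (suc n) ⟩
  suc n              ≡⟨ ℕ.*-identityʳ (suc n) ⟨
  suc n ℕ.* 1        ≡⟨ cong (suc n ℕ.*_) (nC0≡1 n) ⟨
  suc n ℕ.* (n C 0)  ∎
  where open ≡.≡-Reasoning
[k+1]*[n+1]C[k+1]≡[n+1]*nCk zero (suc k) = begin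
  suc (suc k) ℕ.* (1 C suc (suc k))  ≡⟨ cong (suc (suc k) ℕ.*_) (k>n⇒nCk≡0 {1} {suc (suc k)} (s≤s (s≤s z≤n))) ⟩
  suc (suc k) ℕ.* 0                  ≡⟨ ℕ.*-zeroʳ (suc (suc k)) ⟩
  1 ℕ.* 0                            ≡⟨ cong (1 ℕ.*_) (k>n⇒nCk≡0 {0} {suc k} (s≤s z≤n)) ⟨
  1 ℕ.* (0 C suc k)                  ∎
  where open ≡.≡-Reasoning
[k+1]*[n+1]C[k+1]≡[n+1]*nCk (suc n) (suc k) = begin
  suc (suc k) ℕ.* (suc (suc n) C suc (suc k))
    ≡⟨ cong (suc (suc k) ℕ.*_) (nCk+nC[k+1]≡[n+1]C[k+1] (suc n) (suc k)) ⟨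
  suc (suc k) ℕ.* (X ℕ.+ Y)
    ≡⟨ ℕ.*-distribˡ-+ (suc (suc k)) X Y ⟩
  (X ℕ.+ suc k ℕ.* X) ℕ.+ suc (suc k) ℕ.* Y
    ≡⟨ cong₂ (λ a b → (X ℕ.+ a) ℕ.+ b) ([k+1]*[n+1]C[k+1]≡[n+1]*nCk n k) ([k+1]*[n+1]C[k+1]≡[n+1]*nCk n (suc k)) ⟩
  (X ℕ.+ suc n ℕ.* (n C k)) ℕ.+ suc n ℕ.* (n C suc k)
    ≡⟨ ℕ.+-assoc X _ _ ⟩
  X ℕ.+ (suc n ℕ.* (n C k) ℕ.+ suc n ℕ.* (n C suc k))
    ≡⟨ cong (X ℕ.+_) (ℕ.*-distribˡ-+ (suc n) (n C k) (n C suc k)) ⟨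
  X ℕ.+ suc n ℕ.* (n C k ℕ.+ n C suc k)
    ≡⟨ cong (λ z → X ℕ.+ suc n ℕ.* z) (nCk+nC[k+1]≡[n+1]C[k+1] n k) ⟩
  X ℕ.+ suc n ℕ.* X ∎
  where
  open ≡.≡-Reasoning
  X = suc n C suc k
  Y = suc n C suc (suc k)

-- Finite sums, powers, binomial coefficients and roots of unity in a commutative ring.

module RingSums {c ℓ : Level} (R : CommutativeRing c ℓ) where

  open CommutativeRing R public
    renaming (refl to ≈-refl; sym to ≈-sym; trans to ≈-trans; reflexive to ≈-reflexive)
    hiding (zero)
  open import Relation.Binary.Reasoning.Setoid setoid public
  open import Algebra.Properties.Semiring.Exp semiring public
    using (_^_; ^-congˡ; ^-homo-*; ^-assocʳ)
  open import Algebra.Properties.CommutativeSemiring.Exp commutativeSemiring public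
    using (^-distrib-*)
  open import Algebra.Properties.Ring ring using (-‿distribˡ-*; -‿distribʳ-*; -‿involutive; -0#≈0#)
  open import Algebra.Properties.AbelianGroup +-abelianGroup using (⁻¹-∙-comm)
  open import Algebra.Properties.Semiring.Mult.TCOptimised semiring
    using (×-homo-+; ×1-homo-*; 1+×) renaming (_×_ to _⊗_)
  import Algebra.Solver.Ring.AlmostCommutativeRing as ACR
  import Algebra.Solver.Ring as RingSolver

  nat : ℕ → Carrier
  nat n = n ⊗ 1#

  nat-suc : ∀ n → nat (suc n) ≈ 1# + nat n
  nat-suc n = 1+× n 1#

  nat-+ : ∀ a b → nat (a ℕ.+ b) ≈ nat a + nat b
  nat-+ = ×-homo-+ 1#

  nat-* : ∀ a b → nat (a ℕ.* b) ≈ nat a * nat b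
  nat-* = ×1-homo-*

  nat-cong : ∀ {a b} → a ≡ b → nat a ≈ nat b
  nat-cong eq = ≈-reflexive (cong nat eq)

  private
    int : ℤ → Carrier
    int (+ n)    = nat n
    int -[1+ n ] = - nat (suc n)

    int-neg : ∀ n → int (ℤ.- + n) ≈ - nat n
    int-neg zero    = ≈-sym -0#≈0#
    int-neg (suc n) = ≈-refl

    1+a-1+b : ∀ x a b → (x + a) - (x + b) ≈ a - b
    1+a-1+b x a b = begin
      (x + a) - (x + b)     ≈⟨ +-cong (+-comm x a) (≈-sym (⁻¹-∙-comm x b)) ⟩
      (a + x) + (- x - b)   ≈⟨ +-assoc a x _ ⟩
      a + (x + (- x - b))   ≈⟨ +-congˡ (≈-sym (+-assoc x _ _)) ⟩
      a + ((x - x) - b)     ≈⟨ +-congˡ (+-congʳ (-‿inverseʳ x)) ⟩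
      a + (0# - b)          ≈⟨ +-congˡ (+-identityˡ _) ⟩
      a - b ∎

    int-⊖ : ∀ a b → int (a ℤ.⊖ b) ≈ nat a - nat b
    int-⊖ a zero = begin
      int (a ℤ.⊖ 0)  ≡⟨ cong int (ℤ.⊖-≥ {a} {0} z≤n) ⟩
      nat a          ≈⟨ +-identityʳ _ ⟨
      nat a + 0#     ≈⟨ +-congˡ -0#≈0# ⟨
      nat a - nat 0  ∎
    int-⊖ zero (suc b) = ≈-sym (+-identityˡ _)
    int-⊖ (suc a) (suc b) = begin
      int (suc a ℤ.⊖ suc b)        ≡⟨ cong int (ℤ.[1+m]⊖[1+n]≡m⊖n a b) ⟩
      int (a ℤ.⊖ b)                ≈⟨ int-⊖ a b ⟩
      nat a - nat b                ≈⟨ 1+a-1+b 1# _ _ ⟨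
      (1# + nat a) - (1# + nat b)  ≈⟨ +-cong (nat-suc a) (-‿cong (nat-suc b)) ⟨
      nat (suc a) - nat (suc b)    ∎

    int-+ : ∀ a b → int (a ℤ.+ b) ≈ int a + int b
    int-+ (+ a) (+ b) = nat-+ a b
    int-+ (+ a) -[1+ b ] = int-⊖ a (suc b)
    int-+ -[1+ a ] (+ b) = ≈-trans (int-⊖ b (suc a)) (+-comm _ _)
    int-+ -[1+ a ] -[1+ b ] = begin
      - nat (suc (suc (a ℕ.+ b)))      ≡⟨ cong (λ z → - nat (suc z)) (ℕ.+-suc a b) ⟨
      - nat (suc a ℕ.+ suc b)          ≈⟨ -‿cong (nat-+ (suc a) (suc b)) ⟩
      - (nat (suc a) + nat (suc b))    ≈⟨ ⁻¹-∙-comm _ _ ⟨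
      - nat (suc a) - nat (suc b)      ∎

    int-neg‿ : ∀ a → int (ℤ.- a) ≈ - int a
    int-neg‿ (+ n)    = int-neg n
    int-neg‿ -[1+ n ] = ≈-sym (-‿involutive _)

    int-◃- : ∀ n → int (Sign.- ℤ.◃ n) ≈ - nat n
    int-◃- zero    = ≈-sym -0#≈0#
    int-◃- (suc n) = ≈-refl

    int-◃+ : ∀ n → int (Sign.+ ℤ.◃ n) ≈ nat n
    int-◃+ n = ≈-reflexive (cong int (ℤ.+◃n≡+n n))

    int-* : ∀ a b → int (a ℤ.* b) ≈ int a * int b
    int-* (+ a) (+ b) = ≈-trans (int-◃+ (a ℕ.* b)) (nat-* a b)
    int-* (+ a) -[1+ b ] = begin
      int (Sign.- ℤ.◃ (a ℕ.* suc b))  ≈⟨ int-◃- (a ℕ.* suc b) ⟩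
      - nat (a ℕ.* suc b)            ≈⟨ -‿cong (nat-* a (suc b)) ⟩
      - (nat a * nat (suc b))        ≈⟨ -‿distribʳ-* _ _ ⟩
      nat a * - nat (suc b)          ∎
    int-* -[1+ a ] (+ b) = begin
      int (Sign.- ℤ.◃ (suc a ℕ.* b))  ≈⟨ int-◃- (suc a ℕ.* b) ⟩
      - nat (suc a ℕ.* b)            ≈⟨ -‿cong (nat-* (suc a) b) ⟩
      - (nat (suc a) * nat b)        ≈⟨ -‿distribˡ-* _ _ ⟩
      - nat (suc a) * nat b          ∎
    int-* -[1+ a ] -[1+ b ] = begin
      nat (suc a ℕ.* suc b)          ≈⟨ nat-* (suc a) (suc b) ⟩
      nat (suc a) * nat (suc b)      ≈⟨ -‿involutive _ ⟨
      - - (nat (suc a) * nat (suc b))  ≈⟨ -‿cong (-‿distribˡ-* _ _) ⟩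
      - (- nat (suc a) * nat (suc b))  ≈⟨ -‿distribʳ-* _ _ ⟩
      - nat (suc a) * - nat (suc b)  ∎

    -- The solver's coefficients are integers interpreted through `nat`, so `con (+ n)` is
    -- definitionally `nat n`.
    ℤ⟶R : ℤ.+-*-rawRing ACR.-Raw-AlmostCommutative⟶ ACR.fromCommutativeRing R
    ℤ⟶R = record
      { ⟦_⟧ = int ; +-homo = int-+ ; *-homo = int-* ; -‿homo = int-neg‿
      ; 0-homo = ≈-refl ; 1-homo = ≈-refl }

    int-≟ : ∀ a b → Maybe (int a ≈ int b)
    int-≟ a b with a ℤ.≟ b
    ... | yes eq = just (≈-reflexive (cong int eq))
    ... | no  _  = nothing

  module Solver = RingSolver ℤ.+-*-rawRing (ACR.fromCommutativeRing R) ℤ⟶R int-≟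
  open Solver public using (solve; _:=_; _:+_; _:*_; _:-_; :-_; con; _:^_)

  Σ< : ℕ → (ℕ → Carrier) → Carrier
  Σ< zero    f = 0#
  Σ< (suc n) f = Σ< n f + f n

  Σ<-cong< : ∀ n {f g} → (∀ k → k ℕ.< n → f k ≈ g k) → Σ< n f ≈ Σ< n g
  Σ<-cong< zero    f≈g = ≈-refl
  Σ<-cong< (suc n) f≈g = +-cong (Σ<-cong< n (λ k k<n → f≈g k (ℕ.m<n⇒m<1+n k<n))) (f≈g n (ℕ.n<1+n n))

  Σ<-cong : ∀ n {f g} → (∀ k → f k ≈ g k) → Σ< n f ≈ Σ< n g
  Σ<-cong n f≈g = Σ<-cong< n (λ k _ → f≈g k)

  Σ<-zero : ∀ n {f} → (∀ k → k ℕ.< n → f k ≈ 0#) → Σ< n f ≈ 0#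
  Σ<-zero zero    f≈0 = ≈-refl
  Σ<-zero (suc n) f≈0 = ≈-trans (+-cong (Σ<-zero n (λ k k<n → f≈0 k (ℕ.m<n⇒m<1+n k<n))) (f≈0 n (ℕ.n<1+n n))) (+-identityˡ 0#)

  Σ<-+ : ∀ n f g → Σ< n (λ k → f k + g k) ≈ Σ< n f + Σ< n g
  Σ<-+ zero    f g = ≈-sym (+-identityˡ 0#)
  Σ<-+ (suc n) f g = ≈-trans (+-congʳ (Σ<-+ n f g))
    (solve 4 (λ a b x y → (a :+ b) :+ (x :+ y) := (a :+ x) :+ (b :+ y)) ≈-refl _ _ _ _)

  Σ<-*ˡ : ∀ n a f → Σ< n (λ k → a * f k) ≈ a * Σ< n f
  Σ<-*ˡ zero    a f = ≈-sym (zeroʳ a)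
  Σ<-*ˡ (suc n) a f = ≈-trans (+-congʳ (Σ<-*ˡ n a f)) (≈-sym (distribˡ a _ _))

  Σ<-*ʳ : ∀ n f a → Σ< n (λ k → f k * a) ≈ Σ< n f * a
  Σ<-*ʳ n f a = ≈-trans (Σ<-cong n (λ k → *-comm _ _)) (≈-trans (Σ<-*ˡ n a f) (*-comm _ _))

  Σ<-neg : ∀ n f → Σ< n (λ k → - f k) ≈ - Σ< n f
  Σ<-neg zero    f = ≈-sym -0#≈0#
  Σ<-neg (suc n) f = ≈-trans (+-congʳ (Σ<-neg n f)) (⁻¹-∙-comm _ _)

  Σ<-sub : ∀ n f g → Σ< n (λ k → f k - g k) ≈ Σ< n f - Σ< n g
  Σ<-sub n f g = ≈-trans (Σ<-+ n f _) (+-congˡ (Σ<-neg n g))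

  Σ<-head : ∀ n f → Σ< (suc n) f ≈ f 0 + Σ< n (λ k → f (suc k))
  Σ<-head zero    f = +-comm _ _
  Σ<-head (suc n) f = ≈-trans (+-congʳ (Σ<-head n f)) (+-assoc _ _ _)

  Σ<-split : ∀ a b f → Σ< (a ℕ.+ b) f ≈ Σ< a f + Σ< b (λ k → f (a ℕ.+ k))
  Σ<-split zero    b f = ≈-sym (+-identityˡ _)
  Σ<-split (suc a) b f = begin
    Σ< (suc (a ℕ.+ b)) f                             ≈⟨ Σ<-head (a ℕ.+ b) f ⟩
    f 0 + Σ< (a ℕ.+ b) (λ k → f (suc k))             ≈⟨ +-congˡ (Σ<-split a b (λ k → f (suc k))) ⟩
    f 0 + (Σ< a (λ k → f (suc k)) + Σ< b (λ k → f (suc a ℕ.+ k))) ≈⟨ +-assoc _ _ _ ⟨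
    (f 0 + Σ< a (λ k → f (suc k))) + Σ< b (λ k → f (suc a ℕ.+ k)) ≈⟨ +-congʳ (Σ<-head a f) ⟨
    Σ< (suc a) f + Σ< b (λ k → f (suc a ℕ.+ k)) ∎

  Σ<-swap : ∀ a b (f : ℕ → ℕ → Carrier) → Σ< a (λ i → Σ< b (f i)) ≈ Σ< b (λ j → Σ< a (λ i → f i j))
  Σ<-swap zero    b f = ≈-sym (Σ<-zero b (λ _ _ → ≈-refl))
  Σ<-swap (suc a) b f = ≈-trans (+-congʳ (Σ<-swap a b f)) (≈-sym (Σ<-+ b _ _))

  -- The relation `suc (i + j) ≡ n` stands for j = n - 1 - i, so that no truncated subtraction
  -- appears.
  Σ<-reverse : ∀ n {f g} → (∀ i j → suc (i ℕ.+ j) ≡ n → f i ≈ g j) → Σ< n f ≈ Σ< n g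
  Σ<-reverse zero f≈g = ≈-refl
  Σ<-reverse (suc n) {f} {g} f≈g = begin
    Σ< n f + f n                    ≈⟨ +-cong (Σ<-reverse n (λ i j eq → f≈g i (suc j) (cong suc (≡.trans (ℕ.+-suc i j) eq)))) (f≈g n 0 (cong suc (ℕ.+-identityʳ n))) ⟩
    Σ< n (λ k → g (suc k)) + g 0    ≈⟨ +-comm _ _ ⟩
    g 0 + Σ< n (λ k → g (suc k))    ≈⟨ Σ<-head n g ⟨
    Σ< (suc n) g                    ∎

  Σ<-telescope : ∀ n (f : ℕ → Carrier) → Σ< n (λ k → f (suc k) - f k) ≈ f n - f 0
  Σ<-telescope zero    f = ≈-sym (-‿inverseʳ _)
  Σ<-telescope (suc n) f = ≈-trans (+-congʳ (Σ<-telescope n f))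
    (solve 3 (λ a b c → (b :- a) :+ (c :- b) := c :- a) ≈-refl (f 0) (f n) (f (suc n)))

  Σ<-single : ∀ n i f → i ℕ.< n → (∀ k → k ≡.≢ i → f k ≈ 0#) → Σ< n f ≈ f i
  Σ<-single (suc n) i f i<n f≈0 with i ℕ.≟ n
  ... | yes refl = ≈-trans (+-congʳ (Σ<-zero n (λ k k<n → f≈0 k (ℕ.<⇒≢ k<n)))) (+-identityˡ _)
  ... | no  i≢n  = ≈-trans (+-cong (Σ<-single n i f (ℕ.≤∧≢⇒< (ℕ.≤-pred i<n) i≢n) f≈0) (f≈0 n (λ eq → i≢n (≡.sym eq)))) (+-identityʳ _)

  1^n≈1 : ∀ n → 1# ^ n ≈ 1#
  1^n≈1 zero    = ≈-refl
  1^n≈1 (suc n) = ≈-trans (*-identityˡ _) (1^n≈1 n)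

  0^[1+n]≈0 : ∀ n → 0# ^ suc n ≈ 0#
  0^[1+n]≈0 n = zeroˡ _

  -1*-1≈1 : (- 1#) * (- 1#) ≈ 1#
  -1*-1≈1 = solve 0 ((:- con (+ 1)) :* (:- con (+ 1)) := con (+ 1)) ≈-refl

  neg-^ : ∀ x n → (- x) ^ n ≈ (- 1#) ^ n * x ^ n
  neg-^ x n = ≈-trans (^-congˡ n (solve 1 (λ x → :- x := :- con (+ 1) :* x) ≈-refl x)) (^-distrib-* (- 1#) x n)

  -1^odd : ∀ {n} h → n ≡ suc (h ℕ.* 2) → (- 1#) ^ n ≈ - 1#
  -1^odd h refl = begin
    - 1# * (- 1#) ^ (h ℕ.* 2)    ≡⟨ cong (λ n → - 1# * (- 1#) ^ n) (ℕ.*-comm h 2) ⟩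
    - 1# * (- 1#) ^ (2 ℕ.* h)    ≈⟨ *-congˡ (^-assocʳ (- 1#) 2 h) ⟨
    - 1# * ((- 1#) ^ 2) ^ h      ≈⟨ *-congˡ (^-congˡ h (solve 0 ((:- con (+ 1)) :^ 2 := con (+ 1)) ≈-refl)) ⟩
    - 1# * 1# ^ h                ≈⟨ *-congˡ (1^n≈1 h) ⟩
    - 1# * 1#                    ≈⟨ *-identityʳ _ ⟩
    - 1#                         ∎

  abstract

    -- Opaque, so that conversion checking never unfolds `_C_`.
    binom : ℕ → ℕ → Carrier
    binom n k = nat (n C k)

    binom≈nat : ∀ n k → binom n k ≈ nat (n C k)
    binom≈nat n k = ≈-refl

  binom-pascal : ∀ n k → binom (suc n) (suc k) ≈ binom n k + binom n (suc k)
  binom-pascal n k = begin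
    binom (suc n) (suc k)        ≈⟨ binom≈nat (suc n) (suc k) ⟩
    nat (suc n C suc k)          ≡⟨ cong nat (nCk+nC[k+1]≡[n+1]C[k+1] n k) ⟨
    nat (n C k ℕ.+ n C suc k)    ≈⟨ nat-+ (n C k) (n C suc k) ⟩
    nat (n C k) + nat (n C suc k) ≈⟨ +-cong (binom≈nat n k) (binom≈nat n (suc k)) ⟨
    binom n k + binom n (suc k)  ∎

  binom-0 : ∀ n → binom n 0 ≈ 1#
  binom-0 n = ≈-trans (binom≈nat n 0) (nat-cong (nC0≡1 n))

  binom-n : ∀ n → binom n n ≈ 1#
  binom-n n = ≈-trans (binom≈nat n n) (nat-cong (nCn≡1 n))

  binom-[n-1] : ∀ n → binom (suc n) n ≈ nat (suc n)
  binom-[n-1] n = ≈-trans (binom≈nat (suc n) n) (nat-cong ([1+n]Cn≡1+n n))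

  binom-1 : ∀ n → binom n 1 ≈ nat n
  binom-1 n = ≈-trans (binom≈nat n 1) (nat-cong (nC1≡n n))

  binom-> : ∀ n k → n ℕ.< k → binom n k ≈ 0#
  binom-> n k n<k = ≈-trans (binom≈nat n k) (nat-cong (k>n⇒nCk≡0 n<k))

  binom-absorb : ∀ n k → nat (suc k) * binom (suc n) (suc k) ≈ nat (suc n) * binom n k
  binom-absorb n k = begin
    nat (suc k) * binom (suc n) (suc k)    ≈⟨ *-congˡ (binom≈nat (suc n) (suc k)) ⟩
    nat (suc k) * nat (suc n C suc k)      ≈⟨ nat-* (suc k) (suc n C suc k) ⟨
    nat (suc k ℕ.* (suc n C suc k))        ≡⟨ cong nat ([k+1]*[n+1]C[k+1]≡[n+1]*nCk n k) ⟩
    nat (suc n ℕ.* (n C k))                ≈⟨ nat-* (suc n) (n C k) ⟩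
    nat (suc n) * nat (n C k)              ≈⟨ *-congˡ (binom≈nat n k) ⟨
    nat (suc n) * binom n k                ∎

  -- Needed twice, exactly and after reduction mod p, hence over an arbitrary ring; likewise
  -- `CubeRoot`.
  module SixthRoot (ω : Carrier) (ω² : ω * ω ≈ ω - 1#) where

    [-ω]² : - ω * - ω ≈ - 1# - - ω
    [-ω]² = begin
      - ω * - ω      ≈⟨ solve 1 (λ w → :- w :* :- w := w :* w) ≈-refl ω ⟩
      ω * ω          ≈⟨ ω² ⟩
      ω - 1#         ≈⟨ solve 1 (λ w → w :- con (+ 1) := :- con (+ 1) :- :- w) ≈-refl ω ⟩
      - 1# - - ω     ∎

    [1+ω]² : (1# + ω) * (1# + ω) ≈ nat 3 * ω
    [1+ω]² = begin
      (1# + ω) * (1# + ω)            ≈⟨ solve 1 (λ w → (con (+ 1) :+ w) :* (con (+ 1) :+ w) := con (+ 1) :+ con (+ 2) :* w :+ w :* w) ≈-refl ω ⟩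
      1# + nat 2 * ω + ω * ω         ≈⟨ +-congˡ ω² ⟩
      1# + nat 2 * ω + (ω - 1#)      ≈⟨ solve 1 (λ w → con (+ 1) :+ con (+ 2) :* w :+ (w :- con (+ 1)) := con (+ 3) :* w) ≈-refl ω ⟩
      nat 3 * ω                      ∎

  module CubeRoot (y : Carrier) (y² : y * y ≈ - 1# - y) where

    y³≈1 : y ^ 3 ≈ 1#
    y³≈1 = begin
      y ^ 3                ≈⟨ solve 1 (λ y → y :^ 3 := y :* (y :* y)) ≈-refl y ⟩
      y * (y * y)          ≈⟨ *-congˡ y² ⟩
      y * (- 1# - y)       ≈⟨ solve 1 (λ y → y :* (:- con (+ 1) :- y) := :- y :- y :* y) ≈-refl y ⟩
      - y - y * y          ≈⟨ +-congˡ (-‿cong y²) ⟩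
      - y - (- 1# - y)     ≈⟨ solve 1 (λ y → :- y :- (:- con (+ 1) :- y) := con (+ 1)) ≈-refl y ⟩
      1#                   ∎

    y^3a≈1 : ∀ a → y ^ (a ℕ.* 3) ≈ 1#
    y^3a≈1 a = begin
      y ^ (a ℕ.* 3)        ≡⟨ cong (y ^_) (ℕ.*-comm a 3) ⟩
      y ^ (3 ℕ.* a)        ≈⟨ ^-assocʳ y 3 a ⟨
      (y ^ 3) ^ a          ≈⟨ ^-congˡ a y³≈1 ⟩
      1# ^ a               ≈⟨ 1^n≈1 a ⟩
      1#                   ∎

    y^[1+3a] : ∀ {n} a → n ≡ suc (a ℕ.* 3) → y ^ n ≈ y
    y^[1+3a] a refl = ≈-trans (*-congˡ (y^3a≈1 a)) (*-identityʳ y)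

    y^[2+3a] : ∀ {n} a → n ≡ suc (suc (a ℕ.* 3)) → y ^ n ≈ - 1# - y
    y^[2+3a] a refl = ≈-trans (*-congˡ (y^[1+3a] a refl)) y²

-- Umbral calculus.

-- Sequences s are read as linear functionals t^k ↦ s k on polynomials in t;
-- iter x n s is then the functional f ↦ s ((x + t)^n f).
module Umbral {c ℓ : Level} (R : CommutativeRing c ℓ) where

  open RingSums R

  Seq : Set c
  Seq = ℕ → Carrier

  step : Carrier → Seq → Seq
  step x s i = x * s i + s (suc i)

  iter : Carrier → ℕ → Seq → Seq
  iter x zero    s = s
  iter x (suc n) s = iter x n (step x s)

  iter-cong : ∀ {x y} n {s t} → x ≈ y → (∀ i → s i ≈ t i) → ∀ i → iter x n s i ≈ iter y n t i
  iter-cong zero    x≈y s≈t i = s≈t i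
  iter-cong (suc n) x≈y s≈t i = iter-cong n x≈y (λ j → +-cong (*-cong x≈y (s≈t j)) (s≈t (suc j))) i

  iter-linear : ∀ x n a s t i → iter x n (λ j → a * s j + t j) i ≈ a * iter x n s i + iter x n t i
  iter-linear x zero    a s t i = ≈-refl
  iter-linear x (suc n) a s t i = ≈-trans
    (iter-cong n ≈-refl (λ j → solve 6 (λ x a s t s' t' → x :* (a :* s :+ t) :+ (a :* s' :+ t') := a :* (x :* s :+ s') :+ (x :* t :+ t')) ≈-refl x a (s j) (t j) (s (suc j)) (t (suc j))) i)
    (iter-linear x n a (step x s) (step x t) i)

  iter-step : ∀ x y n s i → iter x n (step y s) i ≈ step y (iter x n s) i
  iter-step x y zero    s i = ≈-refl
  iter-step x y (suc n) s i = ≈-trans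
    (iter-cong n ≈-refl (λ j → solve 5 (λ x y a b c → x :* (y :* a :+ b) :+ (y :* b :+ c) := y :* (x :* a :+ b) :+ (x :* b :+ c)) ≈-refl x y (s j) (s (suc j)) (s (suc (suc j)))) i)
    (iter-step x y n (step x s) i)

  iter-expand : ∀ x n s → iter x n s 0 ≈ Σ< (suc n) (λ k → binom n k * (x ^ (n ℕ.∸ k) * s k))
  iter-expand x zero s = begin
    s 0                                ≈⟨ solve 1 (λ a → a := con (+ 0) :+ con (+ 1) :* (con (+ 1) :* a)) ≈-refl (s 0) ⟩
    0# + 1# * (1# * s 0)               ≈⟨ +-congˡ (*-congʳ (binom-0 0)) ⟨
    0# + binom 0 0 * (1# * s 0)        ∎
  iter-expand x (suc n) s = begin
    iter x n (step x s) 0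
      ≈⟨ iter-expand x n (step x s) ⟩
    Σ< (suc n) (λ k → binom n k * (x ^ (n ℕ.∸ k) * (x * s k + s (suc k))))
      ≈⟨ Σ<-cong< (suc n) (λ k k<1+n → split k (ℕ.≤-pred k<1+n)) ⟩
    Σ< (suc n) (λ k → binom n k * (x ^ (suc n ℕ.∸ k) * s k) + binom n k * (x ^ (n ℕ.∸ k) * s (suc k)))
      ≈⟨ Σ<-+ (suc n) _ _ ⟩
    Σ< (suc n) f + g
      ≈⟨ +-congʳ (+-identityʳ _) ⟨
    (Σ< (suc n) f + 0#) + g
      ≈⟨ +-congʳ (+-congˡ (≈-trans (*-congʳ (binom-> n (suc n) (ℕ.n<1+n n))) (zeroˡ _))) ⟨
    Σ< (suc (suc n)) f + g
      ≈⟨ +-congʳ (Σ<-head (suc n) f) ⟩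
    (f 0 + Σ< (suc n) (λ k → binom n (suc k) * (x ^ (n ℕ.∸ k) * s (suc k)))) + g
      ≈⟨ solve 3 (λ a b c → (a :+ b) :+ c := a :+ (c :+ b)) ≈-refl _ _ _ ⟩
    f 0 + (g + Σ< (suc n) (λ k → binom n (suc k) * (x ^ (n ℕ.∸ k) * s (suc k))))
      ≈⟨ +-cong (*-congʳ (≈-trans (binom-0 (suc n)) (≈-sym (binom-0 n)))) (Σ<-+ (suc n) _ _) ⟨
    binom (suc n) 0 * (x ^ suc n * s 0) + Σ< (suc n) (λ k → binom n k * (x ^ (n ℕ.∸ k) * s (suc k)) + binom n (suc k) * (x ^ (n ℕ.∸ k) * s (suc k)))
      ≈⟨ +-congˡ (Σ<-cong (suc n) (λ k → ≈-trans (*-congʳ (binom-pascal n k)) (distribʳ _ _ _))) ⟨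
    binom (suc n) 0 * (x ^ suc n * s 0) + Σ< (suc n) (λ k → binom (suc n) (suc k) * (x ^ (n ℕ.∸ k) * s (suc k)))
      ≈⟨ Σ<-head (suc n) (λ k → binom (suc n) k * (x ^ (suc n ℕ.∸ k) * s k)) ⟨
    Σ< (suc (suc n)) (λ k → binom (suc n) k * (x ^ (suc n ℕ.∸ k) * s k)) ∎
    where
    f : ℕ → Carrier
    f k = binom n k * (x ^ (suc n ℕ.∸ k) * s k)
    g : Carrier
    g = Σ< (suc n) (λ k → binom n k * (x ^ (n ℕ.∸ k) * s (suc k)))
    split : ∀ k → k ℕ.≤ n → binom n k * (x ^ (n ℕ.∸ k) * (x * s k + s (suc k))) ≈ f k + binom n k * (x ^ (n ℕ.∸ k) * s (suc k))
    split k k≤n = ≈-trans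
      (solve 5 (λ b p x s t → b :* (p :* (x :* s :+ t)) := b :* ((x :* p) :* s) :+ b :* (p :* t)) ≈-refl (binom n k) (x ^ (n ℕ.∸ k)) x (s k) (s (suc k)))
      (+-congʳ (*-congˡ (*-congʳ (≈-reflexive (cong (x ^_) (≡.sym (ℕ.+-∸-assoc 1 k≤n)))))))

  -- For s = `y ^_` the functional is evaluation at y.
  iter-power : ∀ x y n i → iter x n (y ^_) i ≈ (x + y) ^ n * y ^ i
  iter-power x y zero    i = ≈-sym (*-identityˡ _)
  iter-power x y (suc n) i = begin
    iter x n (step x (y ^_)) i   ≈⟨ iter-step x x n (y ^_) i ⟩
    step x (iter x n (y ^_)) i   ≈⟨ +-cong (*-congˡ (iter-power x y n i)) (iter-power x y n (suc i)) ⟩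
    x * ((x + y) ^ n * y ^ i) + (x + y) ^ n * (y * y ^ i)
      ≈⟨ solve 4 (λ x y p q → x :* (p :* q) :+ p :* (y :* q) := ((x :+ y) :* p) :* q) ≈-refl x y _ _ ⟩
    (x + y) ^ suc n * y ^ i      ∎

  binomial-1+ : ∀ y n → (1# + y) ^ n ≈ Σ< (suc n) (λ k → binom n k * y ^ k)
  binomial-1+ y n = begin
    (1# + y) ^ n             ≈⟨ *-identityʳ _ ⟨
    (1# + y) ^ n * y ^ 0     ≈⟨ iter-power 1# y n 0 ⟨
    iter 1# n (y ^_) 0       ≈⟨ iter-expand 1# n (y ^_) ⟩
    Σ< (suc n) (λ k → binom n k * (1# ^ (n ℕ.∸ k) * y ^ k))
      ≈⟨ Σ<-cong (suc n) (λ k → *-congˡ (≈-trans (*-congʳ (1^n≈1 (n ℕ.∸ k))) (*-identityˡ _))) ⟩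
    Σ< (suc n) (λ k → binom n k * y ^ k) ∎

  -- The sequence j ↦ b((1 + t)^j) is the translated functional f(t) ↦ b(f(1 + t)); applied to (x +
  -- t)^n t^i it gives b((x + 1 + t)^n (1 + t)^i).
  iter-shift : ∀ x n b i → iter x n (λ j → iter 1# j b 0) i ≈ iter (x + 1#) n (iter 1# i b) 0
  iter-shift x zero    b i = ≈-refl
  iter-shift x (suc n) b i = begin
    iter x n (step x a) i         ≈⟨ iter-step x x n a i ⟩
    x * iter x n a i + iter x n a (suc i)
      ≈⟨ +-cong (*-congˡ (iter-shift x n b i)) (iter-shift x n b (suc i)) ⟩
    x * iter (x + 1#) n (iter 1# i b) 0 + iter (x + 1#) n (iter 1# i (step 1# b)) 0
      ≈⟨ +-congˡ (iter-cong n ≈-refl (iter-step 1# 1# i b) 0) ⟩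
    x * iter (x + 1#) n (iter 1# i b) 0 + iter (x + 1#) n (step 1# (iter 1# i b)) 0
      ≈⟨ iter-linear (x + 1#) n x (iter 1# i b) (step 1# (iter 1# i b)) 0 ⟨
    iter (x + 1#) n (λ j → x * iter 1# i b j + step 1# (iter 1# i b) j) 0
      ≈⟨ iter-cong n ≈-refl (λ j → solve 3 (λ x s t → x :* s :+ (con (+ 1) :* s :+ t) := (x :+ con (+ 1)) :* s :+ t) ≈-refl x (iter 1# i b j) (iter 1# i b (suc j))) 0 ⟩
    iter (x + 1#) n (step (x + 1#) (iter 1# i b)) 0 ∎
    where
    a : Seq
    a j = iter 1# j b 0

  -- The functional f ↦ f'(0).
  δ₁ : Seq
  δ₁ 1 = 1#
  δ₁ _ = 0#

  δ₁-≢ : ∀ k → k ≢ 1 → δ₁ k ≈ 0#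
  δ₁-≢ zero          _   = ≈-refl
  δ₁-≢ (suc zero)    k≢1 = ⊥-elim (k≢1 refl)
  δ₁-≢ (suc (suc k)) _   = ≈-refl

  iter-δ₁ : ∀ x n → iter x (suc n) δ₁ 0 ≈ nat (suc n) * x ^ n
  iter-δ₁ x n = begin
    iter x (suc n) δ₁ 0      ≈⟨ iter-expand x (suc n) δ₁ ⟩
    Σ< (suc (suc n)) (λ k → binom (suc n) k * (x ^ (suc n ℕ.∸ k) * δ₁ k))
      ≈⟨ Σ<-single (suc (suc n)) 1 _ (s≤s (s≤s z≤n)) (λ k k≢1 → ≈-trans (*-congˡ (≈-trans (*-congˡ (δ₁-≢ k k≢1)) (zeroʳ _))) (zeroʳ _)) ⟩
    binom (suc n) 1 * (x ^ n * 1#)   ≈⟨ *-cong (binom-1 (suc n)) (*-identityʳ _) ⟩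
    nat (suc n) * x ^ n      ∎

  iter-cong≤ : ∀ x n {s t} → (∀ k → k ℕ.≤ n → s k ≈ t k) → iter x n s 0 ≈ iter x n t 0
  iter-cong≤ x n {s} {t} s≈t = begin
    iter x n s 0   ≈⟨ iter-expand x n s ⟩
    Σ< (suc n) _   ≈⟨ Σ<-cong< (suc n) (λ k k<1+n → *-congˡ (*-congˡ (s≈t k (ℕ.≤-pred k<1+n)))) ⟩
    Σ< (suc n) _   ≈⟨ iter-expand x n t ⟨
    iter x n t 0   ∎

  iter-+ : ∀ x n s t i → iter x n (λ j → s j + t j) i ≈ iter x n s i + iter x n t i
  iter-+ x n s t i = begin
    iter x n (λ j → s j + t j) i          ≈⟨ iter-cong n ≈-refl (λ j → +-congʳ (*-identityˡ _)) i ⟨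
    iter x n (λ j → 1# * s j + t j) i     ≈⟨ iter-linear x n 1# s t i ⟩
    1# * iter x n s i + iter x n t i      ≈⟨ +-congʳ (*-identityˡ _) ⟩
    iter x n s i + iter x n t i           ∎

  -- The functional f(t) ↦ s(f(-t)).
  alternate : Seq → Seq
  alternate s i = (- 1#) ^ i * s i

  -- (x - t)^n = (-1)^n (-x + t)^n.
  iter-alternate : ∀ x n s i → iter x n (alternate s) i ≈ (- 1#) ^ n * alternate (iter (- x) n s) i
  iter-alternate x zero    s i = ≈-sym (*-identityˡ _)
  iter-alternate x (suc n) s i = begin
    iter x n (step x (alternate s)) i                ≈⟨ iter-step x x n (alternate s) i ⟩
    step x (iter x n (alternate s)) i
      ≈⟨ +-cong (*-congˡ (iter-alternate x n s i)) (iter-alternate x n s (suc i)) ⟩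
    x * ((- 1#) ^ n * ((- 1#) ^ i * r i)) + (- 1#) ^ n * (- 1# * (- 1#) ^ i * r (suc i))
      ≈⟨ solve 5 (λ x p q a b → x :* (p :* (q :* a)) :+ p :* (:- con (+ 1) :* q :* b) := (:- con (+ 1) :* p) :* (q :* (:- x :* a :+ b))) ≈-refl x _ _ _ _ ⟩
    (- 1#) ^ suc n * ((- 1#) ^ i * step (- x) r i)
      ≈⟨ *-congˡ (*-congˡ (iter-step (- x) (- x) n s i)) ⟨
    (- 1#) ^ suc n * alternate (iter (- x) (suc n) s) i ∎
    where
    r : Seq
    r = iter (- x) n s

  -- `iter x n b 0` is the Bernoulli polynomial B_n(x), and `b-rec` says B_n(1) = B_n + [n = 1]. The
  -- bound m, later p - 1, is there because B_(p-1) is not p-integral: `b m` occurs on both sides of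
  -- the last equation and cancels, so only lower values are constrained.
  module Bernoulli (b : Seq) (m : ℕ) (b-rec : ∀ n → n ℕ.≤ m → iter 1# n b 0 ≈ b n + δ₁ n) where

    -- Translation by 1 turns b into f ↦ b(f(1 + t)), which by the recursion is b plus the
    -- derivative at 0.
    bernoulli-difference : ∀ n x → suc n ℕ.≤ m →
      iter (x + 1#) (suc n) b 0 ≈ iter x (suc n) b 0 + nat (suc n) * x ^ n
    bernoulli-difference n x n<m = begin
      iter (x + 1#) (suc n) b 0                      ≈⟨ iter-shift x (suc n) b 0 ⟨
      iter x (suc n) (λ j → iter 1# j b 0) 0         ≈⟨ iter-cong≤ x (suc n) (λ k k≤n → b-rec k (ℕ.≤-trans k≤n n<m)) ⟩
      iter x (suc n) (λ j → b j + δ₁ j) 0            ≈⟨ iter-+ x (suc n) b δ₁ 0 ⟩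
      iter x (suc n) b 0 + iter x (suc n) δ₁ 0       ≈⟨ +-congˡ (iter-δ₁ x n) ⟩
      iter x (suc n) b 0 + nat (suc n) * x ^ n       ∎

    iter-0 : ∀ n → iter 0# n b 0 ≈ b n
    iter-0 n = ≈-trans (go n b 0) (≈-reflexive (cong b (ℕ.+-identityʳ n)))
      where
      go : ∀ n s i → iter 0# n s i ≈ s (n ℕ.+ i)
      go zero    s i = ≈-refl
      go (suc n) s i = ≈-trans (go n (step 0# s) i) (≈-trans (+-congʳ (zeroˡ _)) (+-identityˡ _))

    -- The functional f ↦ b(f(-t)) - f'(0). By the symmetry B_n(1) = (-1)^n B_n it should be b
    -- again; this is proved by showing that it obeys the recursion of b, with the difference
    -- equation at x = -1 as input.
    reflected : Seq
    reflected k = alternate b k + (- 1#) * δ₁ k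

    -1^n*-1^n : ∀ n → (- 1#) ^ n * (- 1#) ^ n ≈ 1#
    -1^n*-1^n n = ≈-trans (≈-sym (^-distrib-* (- 1#) (- 1#) n)) (≈-trans (^-congˡ n -1*-1≈1) (1^n≈1 n))

    iter-neg-1 : ∀ n → n ℕ.≤ m → (- 1#) ^ n * iter (- 1#) n b 0 ≈ (- 1#) ^ n * b n + iter 1# n δ₁ 0
    iter-neg-1 zero n≤m = ≈-sym (+-identityʳ _)
    iter-neg-1 (suc n) n≤m = begin
      s * iter (- 1#) (suc n) b 0
        ≈⟨ solve 4 (λ q a p N → (:- con (+ 1) :* q) :* a := (:- con (+ 1) :* q) :* (a :+ N :* q) :+ (q :* q) :* N) ≈-refl q _ 1# (nat (suc n)) ⟩
      s * (iter (- 1#) (suc n) b 0 + nat (suc n) * q) + (q * q) * nat (suc n)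
        ≈⟨ +-cong (*-congˡ (≈-sym (bernoulli-difference n (- 1#) n≤m))) (*-congʳ (-1^n*-1^n n)) ⟩
      s * iter (- 1# + 1#) (suc n) b 0 + 1# * nat (suc n)
        ≈⟨ +-congʳ (*-congˡ (≈-trans (iter-cong (suc n) (-‿inverseˡ 1#) (λ _ → ≈-refl) 0) (iter-0 (suc n)))) ⟩
      s * b (suc n) + 1# * nat (suc n)
        ≈⟨ +-congˡ (≈-trans (*-comm _ _) (*-congˡ (≈-sym (1^n≈1 n)))) ⟩
      s * b (suc n) + nat (suc n) * 1# ^ n
        ≈⟨ +-congˡ (iter-δ₁ 1# n) ⟨
      s * b (suc n) + iter 1# (suc n) δ₁ 0 ∎
      where
      q s : Carrier
      q = (- 1#) ^ n
      s = (- 1#) ^ suc n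

    reflected-rec : ∀ n → n ℕ.≤ m → iter 1# n reflected 0 ≈ reflected n + δ₁ n
    reflected-rec n n≤m = begin
      iter 1# n (λ k → alternate b k + (- 1#) * δ₁ k) 0
        ≈⟨ iter-cong n ≈-refl (λ k → +-comm _ _) 0 ⟩
      iter 1# n (λ k → (- 1#) * δ₁ k + alternate b k) 0
        ≈⟨ iter-linear 1# n (- 1#) δ₁ (alternate b) 0 ⟩
      (- 1#) * iter 1# n δ₁ 0 + iter 1# n (alternate b) 0
        ≈⟨ +-congˡ (iter-alternate 1# n b 0) ⟩
      (- 1#) * iter 1# n δ₁ 0 + (- 1#) ^ n * (1# * iter (- 1#) n b 0)
        ≈⟨ +-congˡ (≈-trans (*-congˡ (*-identityˡ _)) (iter-neg-1 n n≤m)) ⟩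
      (- 1#) * iter 1# n δ₁ 0 + (alternate b n + iter 1# n δ₁ 0)
        ≈⟨ solve 3 (λ d a e → :- con (+ 1) :* d :+ (a :+ d) := (a :+ :- con (+ 1) :* e) :+ e) ≈-refl (iter 1# n δ₁ 0) (alternate b n) (δ₁ n) ⟩
      reflected n + δ₁ n ∎

    module _ (inv : ∀ j → j ℕ.< m → ∃ λ v → nat (suc j) * v ≈ 1#) where

      -- The difference d of two solutions satisfies the homogeneous recursion. At n = k + 1 the top
      -- term cancels and the terms below k vanish by induction, which leaves (k + 1) d_k = 0 with k
      -- + 1 a unit.
      recursion-unique : ∀ {s t} → (∀ n → n ℕ.≤ m → iter 1# n s 0 ≈ s n + δ₁ n) → (∀ n → n ℕ.≤ m → iter 1# n t 0 ≈ t n + δ₁ n) →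
        ∀ k → k ℕ.< m → s k ≈ t k
      recursion-unique {s} {t} s-rec t-rec = <-rec _ λ k ih k<m → difference-zero k k<m (λ j j<k → minus-zero (ih j<k (ℕ.<-trans j<k k<m)))
        where
        d : Seq
        d k = (- 1#) * t k + s k
        minus-zero : ∀ {a b} → a ≈ b → - 1# * b + a ≈ 0#
        minus-zero {a} {b} a≈b = ≈-trans (+-congˡ a≈b) (solve 1 (λ b → :- con (+ 1) :* b :+ b := con (+ 0)) ≈-refl b)
        d-rec : ∀ n → n ℕ.≤ m → iter 1# n d 0 ≈ d n
        d-rec n n≤m = begin
          iter 1# n d 0                               ≈⟨ iter-linear 1# n (- 1#) t s 0 ⟩
          (- 1#) * iter 1# n t 0 + iter 1# n s 0      ≈⟨ +-cong (*-congˡ (t-rec n n≤m)) (s-rec n n≤m) ⟩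
          (- 1#) * (t n + δ₁ n) + (s n + δ₁ n)        ≈⟨ solve 3 (λ a b e → :- con (+ 1) :* (a :+ e) :+ (b :+ e) := :- con (+ 1) :* a :+ b) ≈-refl (t n) (s n) (δ₁ n) ⟩
          d n                                         ∎
        difference-zero : ∀ k → k ℕ.< m → (∀ j → j ℕ.< k → d j ≈ 0#) → s k ≈ t k
        difference-zero k k<m d≈0 = begin
          s k                          ≈⟨ solve 2 (λ s t → s := t :+ (:- con (+ 1) :* t :+ s)) ≈-refl (s k) (t k) ⟩
          t k + d k                    ≈⟨ +-congˡ (*-identityˡ _) ⟨
          t k + 1# * d k               ≈⟨ +-congˡ (*-congʳ (proj₂ (inv k k<m))) ⟨
          t k + (nat (suc k) * v) * d k  ≈⟨ solve 4 (λ t n v d → t :+ (n :* v) :* d := t :+ v :* (n :* d)) ≈-refl _ _ _ _ ⟩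
          t k + v * (nat (suc k) * d k)  ≈⟨ +-congˡ (*-congˡ [k+1]d≈0) ⟩
          t k + v * 0#                 ≈⟨ solve 2 (λ t v → t :+ v :* con (+ 0) := t) ≈-refl _ _ ⟩
          t k                          ∎
          where
          v : Carrier
          v = proj₁ (inv k k<m)
          F : ℕ → Carrier
          F j = binom (suc k) j * (1# ^ (suc k ℕ.∸ j) * d j)
          F-last : F (suc k) ≈ d (suc k)
          F-last = ≈-trans (*-cong (binom-n (suc k)) (*-congʳ (1^n≈1 (k ℕ.∸ k)))) (solve 1 (λ a → con (+ 1) :* (con (+ 1) :* a) := a) ≈-refl _)
          [k+1]d≈0 : nat (suc k) * d k ≈ 0#
          [k+1]d≈0 = begin
            nat (suc k) * d k          ≈⟨ *-cong (binom-[n-1] k) (≈-trans (*-congʳ (1^n≈1 (suc k ℕ.∸ k))) (*-identityˡ _)) ⟨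
            F k                        ≈⟨ +-identityˡ _ ⟨
            0# + F k                   ≈⟨ +-congʳ (Σ<-zero k (λ j j<k → ≈-trans (*-congˡ (≈-trans (*-congˡ (d≈0 j j<k)) (zeroʳ _))) (zeroʳ _))) ⟨
            Σ< k F + F k               ≈⟨ solve 2 (λ a b → a := (a :+ b) :- b) ≈-refl _ (d (suc k)) ⟩
            (Σ< k F + F k + d (suc k)) - d (suc k)    ≈⟨ +-congʳ (+-congˡ F-last) ⟨
            (Σ< (suc (suc k)) F) - d (suc k)     ≈⟨ +-congʳ (iter-expand 1# (suc k) d) ⟨
            iter 1# (suc k) d 0 - d (suc k)      ≈⟨ +-congʳ (d-rec (suc k) k<m) ⟩
            d (suc k) - d (suc k)                ≈⟨ -‿inverseʳ _ ⟩
            0#                                   ∎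

      -- For odd k > 1 the equality of b with `reflected` reads b k = - b k.
      bernoulli-odd : ∀ k → 1 ℕ.< k → k ℕ.< m → (- 1#) ^ k ≈ - 1# → b k + b k ≈ 0#
      bernoulli-odd k 1<k k<m odd = begin
        b k + b k                       ≈⟨ +-congʳ (recursion-unique reflected-rec b-rec k k<m) ⟨
        ((- 1#) ^ k * b k + - 1# * δ₁ k) + b k  ≈⟨ +-congʳ (+-cong (*-congʳ odd) (*-congˡ (δ₁-≢ k (λ eq → ℕ.<⇒≢ 1<k (≡.sym eq))))) ⟩
        (- 1# * b k + - 1# * 0#) + b k  ≈⟨ solve 1 (λ b → (:- con (+ 1) :* b :+ :- con (+ 1) :* con (+ 0)) :+ b := con (+ 0)) ≈-refl (b k) ⟩
        0#                              ∎

-- Arithmetic in characteristic p.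

module ModP {c ℓ : Level} (R : CommutativeRing c ℓ) (d : ℕ) where

  open RingSums R
  open Umbral R

  -- Writing p as d + 4 builds in p > 3 and makes p - 3, p - 2 and p - 1 the terms `suc d`,
  -- `suc (suc d)` and `m`.
  m p : ℕ
  m = suc (suc (suc d))
  p = suc m

  -- Primality of p enters only as the invertibility of 1, ..., p - 1.
  module Char (char : nat p ≈ 0#) (inv : ∀ j → j ℕ.< m → ∃ λ v → nat (suc j) * v ≈ 1#) where

    cancel : ∀ {a b} j → j ℕ.< m → nat (suc j) * a ≈ nat (suc j) * b → a ≈ b
    cancel {a} {b} j j<m eq = begin
      a                       ≈⟨ *-identityˡ a ⟨
      1# * a                  ≈⟨ *-congʳ (proj₂ (inv j j<m)) ⟨
      (nat (suc j) * v) * a   ≈⟨ solve 3 (λ n v a → (n :* v) :* a := v :* (n :* a)) ≈-refl _ _ _ ⟩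
      v * (nat (suc j) * a)   ≈⟨ *-congˡ eq ⟩
      v * (nat (suc j) * b)   ≈⟨ solve 3 (λ n v a → (n :* v) :* a := v :* (n :* a)) ≈-refl _ _ _ ⟨
      (nat (suc j) * v) * b   ≈⟨ *-congʳ (proj₂ (inv j j<m)) ⟩
      1# * b                  ≈⟨ *-identityˡ b ⟩
      b                       ∎
      where
      v : Carrier
      v = proj₁ (inv j j<m)

    2-cancel : ∀ {a b} → a + a ≈ b + b → a ≈ b
    2-cancel {a} {b} eq = cancel 1 (s≤s (s≤s z≤n)) (≈-trans (twice a) (≈-trans eq (≈-sym (twice b))))
      where
      twice : ∀ a → nat 2 * a ≈ a + a
      twice a = solve 1 (λ a → con (+ 2) :* a := a :+ a) ≈-refl a

    3-cancel : ∀ {a b} → nat 3 * a ≈ nat 3 * b → a ≈ b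
    3-cancel = cancel 2 (s≤s (s≤s (s≤s z≤n)))

    binom-p : ∀ j → j ℕ.< m → binom p (suc j) ≈ 0#
    binom-p j j<m = cancel j j<m (begin
      nat (suc j) * binom p (suc j)  ≈⟨ binom-absorb m j ⟩
      nat p * binom m j              ≈⟨ *-congʳ char ⟩
      0# * binom m j                 ≈⟨ zeroˡ _ ⟩
      0#                             ≈⟨ zeroʳ _ ⟨
      nat (suc j) * 0#               ∎)

    -- By Pascal's rule consecutive entries of row p - 1 add up to an inner entry of row p, which is
    -- 0.
    binom-m : ∀ k → k ℕ.≤ m → binom m k ≈ (- 1#) ^ k
    binom-m zero    _   = binom-0 m
    binom-m (suc k) k<m = begin
      binom m (suc k)                       ≈⟨ solve 2 (λ a b → b := (a :+ b) :- a) ≈-refl (binom m k) _ ⟩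
      (binom m k + binom m (suc k)) - binom m k  ≈⟨ +-congʳ (binom-pascal m k) ⟨
      binom p (suc k) - binom m k           ≈⟨ +-cong (binom-p k k<m) (-‿cong (binom-m k (ℕ.<⇒≤ k<m))) ⟩
      0# - (- 1#) ^ k                       ≈⟨ solve 1 (λ a → con (+ 0) :- a := :- con (+ 1) :* a) ≈-refl _ ⟩
      (- 1#) ^ suc k                        ∎

    -- Comparison with C(p-1, p-1) = 1 gives the sign without a parity argument.
    -1^m≈1 : (- 1#) ^ m ≈ 1#
    -1^m≈1 = ≈-trans (≈-sym (binom-m m ℕ.≤-refl)) (binom-n m)

    freshman : ∀ x → (1# + x) ^ p ≈ 1# + x ^ p
    freshman x = begin
      (1# + x) ^ p             ≈⟨ binomial-1+ x p ⟩
      Σ< (suc p) f             ≈⟨ Σ<-head p f ⟩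
      f 0 + (Σ< m (λ k → f (suc k)) + f p)
        ≈⟨ +-cong (*-congʳ (binom-0 p)) (+-cong (Σ<-zero m (λ k k<m → ≈-trans (*-congʳ (binom-p k k<m)) (zeroˡ _))) (*-congʳ (binom-n p))) ⟩
      1# * 1# + (0# + 1# * x ^ p)  ≈⟨ solve 1 (λ a → con (+ 1) :* con (+ 1) :+ (con (+ 0) :+ con (+ 1) :* a) := con (+ 1) :+ a) ≈-refl _ ⟩
      1# + x ^ p               ∎
      where
      f : ℕ → Carrier
      f k = binom p k * x ^ k

    fermat : ∀ n → nat n ^ p ≈ nat n
    fermat zero    = zeroˡ _
    fermat (suc n) = begin
      nat (suc n) ^ p     ≈⟨ ^-congˡ p (nat-suc n) ⟩
      (1# + nat n) ^ p    ≈⟨ freshman (nat n) ⟩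
      1# + nat n ^ p      ≈⟨ +-congˡ (fermat n) ⟩
      1# + nat n          ≈⟨ nat-suc n ⟨
      nat (suc n)         ∎

    -- By Fermat n^(p-2) is 1/n, or 0 when p divides n.
    u : ℕ → Carrier
    u n = nat n ^ suc (suc d)

    u-0 : u 0 ≈ 0#
    u-0 = zeroˡ _

    u-inverse : ∀ j → j ℕ.< m → nat (suc j) * u (suc j) ≈ 1#
    u-inverse j j<m = cancel j j<m (≈-trans (fermat (suc j)) (≈-sym (*-identityʳ _)))

    u-unique : ∀ j v → j ℕ.< m → nat (suc j) * v ≈ 1# → v ≈ u (suc j)
    u-unique j v j<m eq = cancel j j<m (≈-trans eq (≈-sym (u-inverse j j<m)))

    u² : ∀ n → u n * u n ≈ nat n ^ suc d
    u² n = begin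
      u n * u n                   ≈⟨ solve 2 (λ N a → (N :* (N :* a)) :* (N :* (N :* a)) := (N :* (N :* (N :* (N :* a)))) :* a) ≈-refl (nat n) (nat n ^ d) ⟩
      nat n ^ p * nat n ^ d       ≈⟨ *-congʳ (fermat n) ⟩
      nat n ^ suc d               ∎

    -- By Fermat this is the indicator of p dividing n.
    δ : ℕ → Carrier
    δ n = 1# - nat n * u n

    δ-nat : ∀ n → δ n * nat n ≈ 0#
    δ-nat n = begin
      δ n * nat n                ≈⟨ solve 2 (λ N a → (con (+ 1) :- N :* a) :* N := N :- N :* (N :* a)) ≈-refl (nat n) (u n) ⟩
      nat n - nat n ^ p          ≈⟨ +-congˡ (-‿cong (fermat n)) ⟩
      nat n - nat n              ≈⟨ -‿inverseʳ _ ⟩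
      0#                         ∎

    δ-0 : δ 0 ≈ 1#
    δ-0 = solve 1 (λ a → con (+ 1) :- con (+ 0) :* a := con (+ 1)) ≈-refl (u 0)

    δ-suc : ∀ j → j ℕ.< m → δ (suc j) ≈ 0#
    δ-suc j j<m = ≈-trans (+-congˡ (-‿cong (u-inverse j j<m))) (-‿inverseʳ _)

    nat-periodic : ∀ n → nat (p ℕ.+ n) ≈ nat n
    nat-periodic n = ≈-trans (nat-+ p n) (≈-trans (+-congʳ char) (+-identityˡ _))

    u-periodic : ∀ n → u (p ℕ.+ n) ≈ u n
    u-periodic n = ^-congˡ (suc (suc d)) (nat-periodic n)

    δ-periodic : ∀ n → δ (p ℕ.+ n) ≈ δ n
    δ-periodic n = +-congˡ (-‿cong (*-cong (nat-periodic n) (u-periodic n)))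

    -- With z a value of `δ`, a congruence between integers that holds only when p divides some
    -- index passes to the powers that define `u`.
    *-cong-^ : ∀ z a b n → z * a ≈ z * b → z * a ^ n ≈ z * b ^ n
    *-cong-^ z a b zero    eq = ≈-refl
    *-cong-^ z a b (suc n) eq = begin
      z * (a * a ^ n)   ≈⟨ solve 3 (λ z a p → z :* (a :* p) := a :* (z :* p)) ≈-refl z a _ ⟩
      a * (z * a ^ n)   ≈⟨ *-congˡ (*-cong-^ z a b n eq) ⟩
      a * (z * b ^ n)   ≈⟨ solve 3 (λ z a p → a :* (z :* p) := (z :* a) :* p) ≈-refl z a _ ⟩
      (z * a) * b ^ n   ≈⟨ *-congʳ eq ⟩
      (z * b) * b ^ n   ≈⟨ *-assoc _ _ _ ⟩
      z * (b * b ^ n)   ∎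

    -u : ∀ x → (- x) ^ suc (suc d) ≈ - (x ^ suc (suc d))
    -u x = begin
      (- x) ^ suc (suc d)                       ≈⟨ neg-^ x (suc (suc d)) ⟩
      (- 1#) ^ suc (suc d) * x ^ suc (suc d)    ≈⟨ solve 2 (λ s a → s :* a := :- ((:- con (+ 1) :* s) :* a)) ≈-refl _ _ ⟩
      - ((- 1#) ^ m * x ^ suc (suc d))          ≈⟨ -‿cong (*-congʳ -1^m≈1) ⟩
      - (1# * x ^ suc (suc d))                  ≈⟨ -‿cong (*-identityˡ _) ⟩
      - (x ^ suc (suc d))                       ∎

    u-reflect : ∀ i j → i ℕ.+ j ≡ p → u i ≈ - u j
    u-reflect i j eq = ≈-trans (^-congˡ (suc (suc d)) i≈-j) (-u (nat j))
      where
      i≈-j : nat i ≈ - nat j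
      i≈-j = begin
        nat i                     ≈⟨ solve 2 (λ a b → a := (a :+ b) :- b) ≈-refl (nat i) (nat j) ⟩
        (nat i + nat j) - nat j   ≈⟨ +-congʳ (nat-+ i j) ⟨
        nat (i ℕ.+ j) - nat j     ≈⟨ +-congʳ (nat-cong eq) ⟩
        nat p - nat j             ≈⟨ +-congʳ char ⟩
        0# - nat j                ≈⟨ +-identityˡ _ ⟩
        - nat j                   ∎

    u²-reflect : ∀ i j → i ℕ.+ j ≡ p → u i * u i ≈ u j * u j
    u²-reflect i j eq = ≈-trans (*-cong (u-reflect i j eq) (u-reflect i j eq))
      (solve 1 (λ a → (:- a) :* (:- a) := a :* a) ≈-refl (u j))

    δ-u-shift : ∀ i j → δ i * u (i ℕ.+ j) ≈ δ i * u j
    δ-u-shift i j = *-cong-^ (δ i) _ _ (suc (suc d)) (begin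
      δ i * nat (i ℕ.+ j)             ≈⟨ *-congˡ (nat-+ i j) ⟩
      δ i * (nat i + nat j)           ≈⟨ distribˡ _ _ _ ⟩
      δ i * nat i + δ i * nat j       ≈⟨ +-congʳ (δ-nat i) ⟩
      0# + δ i * nat j                ≈⟨ +-identityˡ _ ⟩
      δ i * nat j                     ∎)

    δ-u-opposite : ∀ i j → δ (i ℕ.+ j) * u j ≈ δ (i ℕ.+ j) * - u i
    δ-u-opposite i j = ≈-trans (*-cong-^ z (nat j) (- nat i) (suc (suc d)) eq) (*-congˡ (-u (nat i)))
      where
      z : Carrier
      z = δ (i ℕ.+ j)
      eq : z * nat j ≈ z * - nat i
      eq = begin
        z * nat j                          ≈⟨ solve 3 (λ z a b → z :* b := z :* (a :+ b) :+ z :* (:- a)) ≈-refl z (nat i) (nat j) ⟩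
        z * (nat i + nat j) + z * - nat i  ≈⟨ +-congʳ (*-congˡ (nat-+ i j)) ⟨
        z * nat (i ℕ.+ j) + z * - nat i    ≈⟨ +-congʳ (δ-nat (i ℕ.+ j)) ⟩
        0# + z * - nat i                   ≈⟨ +-identityˡ _ ⟩
        z * - nat i                        ∎

    -- 1/(ij) = (1/i + 1/j)/(i + j), corrected where a denominator vanishes.
    partial-fractions : ∀ i j → u i * u j ≈
      u (i ℕ.+ j) * u i + u (i ℕ.+ j) * u j - δ i * (u j * u j) - δ j * (u i * u i) - u i * u i * δ (i ℕ.+ j)
    partial-fractions i j = begin
      u i * u j
        ≈⟨ solve 6 (λ a b A B s N → a :* b := s :* (b :* (A :* a) :+ a :* (B :* b)) :+ a :* b :* (con (+ 1) :- (A :+ B) :* s)) ≈-refl (u i) (u j) (nat i) (nat j) s 1# ⟩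
      s * (u j * (nat i * u i) + u i * (nat j * u j)) + u i * u j * (1# - (nat i + nat j) * s)
        ≈⟨ +-congˡ (*-congˡ (+-congˡ (-‿cong (*-congʳ (nat-+ i j))))) ⟨
      s * (u j * (nat i * u i) + u i * (nat j * u j)) + u i * u j * δ (i ℕ.+ j)
        ≈⟨ solve 6 (λ a b P Q s D → s :* (b :* P :+ a :* Q) :+ a :* b :* D
             := s :* a :+ s :* b :- b :* ((con (+ 1) :- P) :* s) :- a :* ((con (+ 1) :- Q) :* s) :+ a :* (D :* b))
             ≈-refl (u i) (u j) (nat i * u i) (nat j * u j) s (δ (i ℕ.+ j)) ⟩
      s * u i + s * u j - u j * (δ i * s) - u i * (δ j * s) + u i * (δ (i ℕ.+ j) * u j)
        ≈⟨ +-cong (+-cong (+-congˡ (-‿cong (*-congˡ (δ-u-shift i j)))) (-‿cong (*-congˡ (≈-trans (*-congˡ (≈-reflexive (cong u (ℕ.+-comm i j)))) (δ-u-shift j i))))) (*-congˡ (δ-u-opposite i j)) ⟩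
      s * u i + s * u j - u j * (δ i * u j) - u i * (δ j * u i) + u i * (δ (i ℕ.+ j) * - u i)
        ≈⟨ solve 6 (λ a b s di dj D → s :* a :+ s :* b :- b :* (di :* b) :- a :* (dj :* a) :+ a :* (D :* (:- a))
             := s :* a :+ s :* b :- di :* (b :* b) :- dj :* (a :* a) :- a :* a :* D) ≈-refl (u i) (u j) s (δ i) (δ j) (δ (i ℕ.+ j)) ⟩
      s * u i + s * u j - δ i * (u j * u j) - δ j * (u i * u i) - u i * u i * δ (i ℕ.+ j) ∎
      where
      s : Carrier
      s = u (i ℕ.+ j)

    -- Truncated polylogarithms and the square of the truncated logarithm.

    L : Carrier → ℕ → Carrier
    L x n = Σ< n (λ k → u k * x ^ k)

    G : Carrier → Carrier
    G x = Σ< p (λ k → u k * u k * x ^ k)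

    -- The depth-two sum of x^l/(l k) over 0 < l < k < p. It arises when the square of the logarithm
    -- is expanded, and `G-1-` expresses it through `G`.
    M : Carrier → Carrier
    M x = Σ< p (λ k → u k * L x k)

    H : ℕ → Carrier
    H n = Σ< n u

    -- A window that starts at i instead of 0 loses the first i terms and regains them at its far
    -- end, multiplied by X.
    window : ∀ X (f : ℕ → Carrier) → (∀ n → f (p ℕ.+ n) ≈ X * f n) → ∀ i →
      Σ< p (λ j → f (i ℕ.+ j)) ≈ Σ< p f + (X - 1#) * Σ< i f
    window X f per i = begin
      Σ< p (λ j → f (i ℕ.+ j))
        ≈⟨ solve 2 (λ a b → a := (b :+ a) :- b) ≈-refl _ (Σ< i f) ⟩
      (Σ< i f + Σ< p (λ j → f (i ℕ.+ j))) - Σ< i f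
        ≈⟨ +-congʳ (Σ<-split i p f) ⟨
      Σ< (i ℕ.+ p) f - Σ< i f
        ≈⟨ +-congʳ (≈-reflexive (cong (λ n → Σ< n f) (ℕ.+-comm i p))) ⟩
      Σ< (p ℕ.+ i) f - Σ< i f
        ≈⟨ +-congʳ (Σ<-split p i f) ⟩
      (Σ< p f + Σ< i (λ j → f (p ℕ.+ j))) - Σ< i f
        ≈⟨ +-congʳ (+-congˡ (≈-trans (Σ<-cong i per) (Σ<-*ˡ i X f))) ⟩
      (Σ< p f + X * Σ< i f) - Σ< i f
        ≈⟨ solve 3 (λ a X b → (a :+ X :* b) :- b := a :+ (X :- con (+ 1)) :* b) ≈-refl _ X _ ⟩
      Σ< p f + (X - 1#) * Σ< i f ∎

    Σδ : ∀ x i → Σ< (suc i) (λ k → δ k * x ^ k) ≈ 1# + Σ< i (λ k → δ (suc k) * x ^ suc k)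
    Σδ x i = ≈-trans (Σ<-head i _) (+-congʳ (≈-trans (*-identityʳ _) δ-0))

    Σδ≈1 : ∀ x i → i ℕ.≤ m → Σ< (suc i) (λ k → δ k * x ^ k) ≈ 1#
    Σδ≈1 x i i≤m = ≈-trans (Σδ x i) (≈-trans (+-congˡ (Σ<-zero i (λ k k<i → ≈-trans (*-congʳ (δ-suc k (ℕ.<-≤-trans k<i i≤m))) (zeroˡ _)))) (+-identityʳ _))

    ΣΣ-product : ∀ a b (f g : ℕ → Carrier) → Σ< a (λ i → Σ< b (λ j → f i * g j)) ≈ Σ< a f * Σ< b g
    ΣΣ-product a b f g = ≈-trans (Σ<-cong a (λ i → Σ<-*ˡ b (f i) g)) (Σ<-*ʳ a f (Σ< b g))

    pow-periodic : ∀ x n → x ^ (p ℕ.+ n) ≈ x ^ p * x ^ n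
    pow-periodic x n = ^-homo-* x p n

    -- `partial-fractions` is summed with weight x^(i+j) over the square. Each of the two main terms
    -- leaves (x^p - 1) M(x), because the complete sum over j comes with the factor H p = 0. The
    -- terms with `δ i` and `δ j` leave G(x) each, and `δ (i + j)` selects i + j = p and leaves x^p
    -- G(1).
    L-square : ∀ x → H p ≈ 0# →
      L x p * L x p ≈ (x ^ p - 1#) * M x + (x ^ p - 1#) * M x - G x - G x - x ^ p * G 1#
    L-square x H≈0 = begin
      L x p * L x p
        ≈⟨ ΣΣ-product p p _ _ ⟨
      Σ< p (λ i → Σ< p (λ j → (u i * x ^ i) * (u j * x ^ j)))
        ≈⟨ Σ<-cong p (λ i → Σ<-cong p (λ j → term i j)) ⟩
      Σ< p (λ i → Σ< p (λ j → A i j + B i j - C₁ i j - C₂ i j - D i j))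
        ≈⟨ Σ<-cong p (λ i → ≈-trans (Σ<-sub p _ _) (+-congʳ (≈-trans (Σ<-sub p _ _) (+-congʳ (≈-trans (Σ<-sub p _ _) (+-congʳ (Σ<-+ p _ _))))))) ⟩
      Σ< p (λ i → Σ< p (A i) + Σ< p (B i) - Σ< p (C₁ i) - Σ< p (C₂ i) - Σ< p (D i))
        ≈⟨ ≈-trans (Σ<-sub p _ _) (+-congʳ (≈-trans (Σ<-sub p _ _) (+-congʳ (≈-trans (Σ<-sub p _ _) (+-congʳ (Σ<-+ p _ _)))))) ⟩
      Σ< p (λ i → Σ< p (A i)) + Σ< p (λ i → Σ< p (B i)) - Σ< p (λ i → Σ< p (C₁ i)) - Σ< p (λ i → Σ< p (C₂ i)) - Σ< p (λ i → Σ< p (D i))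
        ≈⟨ +-cong (+-cong (+-cong (+-cong ΣA ΣB) (-‿cong ΣC₁)) (-‿cong ΣC₂)) (-‿cong ΣD) ⟩
      (X - 1#) * M x + (X - 1#) * M x - G x - G x - X * G 1# ∎
      where
      X : Carrier
      X = x ^ p
      A B C₁ C₂ D : ℕ → ℕ → Carrier
      A i j = u i * (u (i ℕ.+ j) * x ^ (i ℕ.+ j))
      B i j = A j i
      C₁ i j = (δ i * x ^ i) * (u j * u j * x ^ j)
      C₂ i j = (u i * u i * x ^ i) * (δ j * x ^ j)
      D i j = (u i * u i) * (δ (i ℕ.+ j) * x ^ (i ℕ.+ j))
      term : ∀ i j → (u i * x ^ i) * (u j * x ^ j) ≈ A i j + B i j - C₁ i j - C₂ i j - D i j
      term i j = begin
        (u i * x ^ i) * (u j * x ^ j)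
          ≈⟨ solve 4 (λ a b P Q → (a :* P) :* (b :* Q) := (a :* b) :* (P :* Q)) ≈-refl (u i) (u j) (x ^ i) (x ^ j) ⟩
        (u i * u j) * (x ^ i * x ^ j)
          ≈⟨ *-congʳ (partial-fractions i j) ⟩
        (s * u i + s * u j - δ i * (u j * u j) - δ j * (u i * u i) - u i * u i * z) * (x ^ i * x ^ j)
          ≈⟨ solve 8 (λ s a b di dj z P Q → (s :* a :+ s :* b :- di :* (b :* b) :- dj :* (a :* a) :- a :* a :* z) :* (P :* Q)
               := a :* (s :* (P :* Q)) :+ b :* (s :* (P :* Q)) :- (di :* P) :* (b :* b :* Q) :- (a :* a :* P) :* (dj :* Q) :- (a :* a) :* (z :* (P :* Q)))
               ≈-refl s (u i) (u j) (δ i) (δ j) z (x ^ i) (x ^ j) ⟩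
        u i * (s * (x ^ i * x ^ j)) + u j * (s * (x ^ i * x ^ j)) - C₁ i j - C₂ i j - (u i * u i) * (z * (x ^ i * x ^ j))
          ≈⟨ +-cong (+-congʳ (+-congʳ (+-cong (*-congˡ (*-congˡ (^-homo-* x i j)))
               (*-congˡ (*-cong (≈-reflexive (cong u (ℕ.+-comm j i))) (≈-trans (≈-reflexive (cong (x ^_) (ℕ.+-comm j i))) (^-homo-* x i j)))))))
               (-‿cong (*-congˡ (*-congˡ (^-homo-* x i j)))) ⟨
        A i j + B i j - C₁ i j - C₂ i j - D i j ∎
        where
        s z : Carrier
        s = u (i ℕ.+ j)
        z = δ (i ℕ.+ j)
      ΣA : Σ< p (λ i → Σ< p (A i)) ≈ (X - 1#) * M x
      ΣA = begin
        Σ< p (λ i → Σ< p (A i))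
          ≈⟨ Σ<-cong p (λ i → ≈-trans (Σ<-*ˡ p (u i) _) (*-congˡ (window X (λ n → u n * x ^ n) (λ n → ≈-trans (*-cong (u-periodic n) (pow-periodic x n)) (solve 3 (λ a X b → a :* (X :* b) := X :* (a :* b)) ≈-refl (u n) X (x ^ n))) i))) ⟩
        Σ< p (λ i → u i * (L x p + (X - 1#) * L x i))
          ≈⟨ Σ<-cong p (λ i → solve 4 (λ a l X k → a :* (l :+ (X :- con (+ 1)) :* k) := a :* l :+ (X :- con (+ 1)) :* (a :* k)) ≈-refl (u i) (L x p) X (L x i)) ⟩
        Σ< p (λ i → u i * L x p + (X - 1#) * (u i * L x i))
          ≈⟨ Σ<-+ p _ _ ⟩
        Σ< p (λ i → u i * L x p) + Σ< p (λ i → (X - 1#) * (u i * L x i))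
          ≈⟨ +-cong (Σ<-*ʳ p u (L x p)) (Σ<-*ˡ p (X - 1#) _) ⟩
        H p * L x p + (X - 1#) * M x
          ≈⟨ +-congʳ (≈-trans (*-congʳ H≈0) (zeroˡ _)) ⟩
        0# + (X - 1#) * M x
          ≈⟨ +-identityˡ _ ⟩
        (X - 1#) * M x ∎
      ΣB : Σ< p (λ i → Σ< p (B i)) ≈ (X - 1#) * M x
      ΣB = ≈-trans (Σ<-swap p p B) ΣA
      ΣC₁ : Σ< p (λ i → Σ< p (C₁ i)) ≈ G x
      ΣC₁ = ≈-trans (ΣΣ-product p p _ _) (≈-trans (*-congʳ (Σδ≈1 x m ℕ.≤-refl)) (*-identityˡ _))
      ΣC₂ : Σ< p (λ i → Σ< p (C₂ i)) ≈ G x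
      ΣC₂ = ≈-trans (ΣΣ-product p p _ _) (≈-trans (*-congˡ (Σδ≈1 x m ℕ.≤-refl)) (*-identityʳ _))
      Dᵢ : ∀ i → i ℕ.< p → Σ< p (D i) ≈ X * (u i * u i * 1# ^ i)
      Dᵢ i i<p = ≈-trans (Σ<-*ˡ p (u i * u i) _) (≈-trans (*-congˡ (window X (λ n → δ n * x ^ n) (λ n → ≈-trans (*-cong (δ-periodic n) (pow-periodic x n)) (solve 3 (λ a X b → a :* (X :* b) := X :* (a :* b)) ≈-refl (δ n) X (x ^ n))) i))
        (≈-trans (*-congˡ (+-congʳ (Σδ≈1 x m ℕ.≤-refl))) (≈-trans (last i i<p) (*-congˡ (≈-trans (≈-sym (*-identityʳ _)) (*-congˡ (≈-sym (1^n≈1 i))))))))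
        where
        last : ∀ i → i ℕ.< p → u i * u i * (1# + (X - 1#) * Σ< i (λ k → δ k * x ^ k)) ≈ X * (u i * u i)
        -- For i = 0 the index divisible by p is j = 0, with weight 1 instead of X; since `u 0` is 0
        -- the discrepancy disappears.
        last zero    _ = ≈-trans (*-congʳ (≈-trans (*-congʳ u-0) (zeroˡ _))) (≈-trans (zeroˡ _) (≈-sym (≈-trans (*-congˡ (≈-trans (*-congʳ u-0) (zeroˡ _))) (zeroʳ _))))
        last (suc i) i<p = ≈-trans (*-congˡ (+-congˡ (*-congˡ (Σδ≈1 x i (ℕ.<⇒≤ (ℕ.≤-pred i<p))))))
          (solve 2 (λ a X → a :* (con (+ 1) :+ (X :- con (+ 1)) :* con (+ 1)) := X :* a) ≈-refl _ X)
      ΣD : Σ< p (λ i → Σ< p (D i)) ≈ X * G 1#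
      ΣD = ≈-trans (Σ<-cong< p Dᵢ) (Σ<-*ˡ p X _)

    Σ<-extend : ∀ n k f → (∀ i → n ℕ.≤ i → f i ≈ 0#) → Σ< (n ℕ.+ k) f ≈ Σ< n f
    Σ<-extend n k f f≈0 = ≈-trans (Σ<-split n k f) (≈-trans (+-congˡ (Σ<-zero k (λ i _ → f≈0 (n ℕ.+ i) (ℕ.m≤m+n n i)))) (+-identityʳ _))

    L-suc : ∀ x n → L x (suc n) ≈ Σ< n (λ k → u (suc k) * x ^ suc k)
    L-suc x n = ≈-trans (Σ<-head n _) (≈-trans (+-congʳ (≈-trans (*-congʳ u-0) (zeroˡ _))) (+-identityˡ _))

    H-suc : ∀ n → H (suc n) ≈ Σ< n (λ k → u (suc k))
    H-suc n = ≈-trans (Σ<-head n _) (≈-trans (+-congʳ u-0) (+-identityˡ _))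

    G-suc : ∀ x → G x ≈ Σ< m (λ j → u (suc j) * u (suc j) * x ^ suc j)
    G-suc x = ≈-trans (Σ<-head m _) (≈-trans (+-congʳ (≈-trans (*-congʳ (≈-trans (*-congʳ u-0) (zeroˡ _))) (zeroˡ _))) (+-identityˡ _))

    M+G : ∀ x → Σ< m (λ k → u (suc k) * L x (suc (suc k))) ≈ M x + G x
    M+G x = begin
      Σ< m (λ k → u (suc k) * L x (suc (suc k)))
        ≈⟨ Σ<-cong m (λ k → solve 3 (λ a l X → a :* (l :+ a :* X) := a :* l :+ a :* a :* X) ≈-refl (u (suc k)) (L x (suc k)) (x ^ suc k)) ⟩
      Σ< m (λ k → u (suc k) * L x (suc k) + u (suc k) * u (suc k) * x ^ suc k)
        ≈⟨ Σ<-+ m _ _ ⟩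
      Σ< m (λ k → u (suc k) * L x (suc k)) + Σ< m (λ k → u (suc k) * u (suc k) * x ^ suc k)
        ≈⟨ +-cong (≈-sym (≈-trans (Σ<-head m _) (≈-trans (+-congʳ (zeroʳ _)) (+-identityˡ _)))) (≈-sym (G-suc x)) ⟩
      M x + G x ∎

    G-cong : ∀ {x y} → x ≈ y → G x ≈ G y
    G-cong x≈y = Σ<-cong p (λ k → *-congˡ (^-congˡ k x≈y))

    L-cong : ∀ n {x y} → x ≈ y → L x n ≈ L y n
    L-cong n x≈y = Σ<-cong n (λ k → *-congˡ (^-congˡ k x≈y))

    M-cong : ∀ {x y} → x ≈ y → M x ≈ M y
    M-cong x≈y = Σ<-cong p (λ k → *-congˡ (L-cong k x≈y))

    -- The binomial transform and the reflection x ↦ 1 - x.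

    module Transform (w : Carrier) where

      -- The polynomial with coefficients a, its terms weighted by row n of Pascal's triangle. The
      -- range m does not depend on n because the row vanishes beyond n; at n = p - 1 the weights
      -- become signs.
      E : (ℕ → Carrier) → ℕ → Carrier
      E a n = Σ< m (λ j → binom n (suc j) * (a j * w ^ suc j))

      -- Pascal's rule splits off C(n, j)/(j+1), which equals C(n+1, j+1)/(n+1). Thus dividing the
      -- coefficients by j + 1 amounts to summing the transforms over n with weights 1/n.
      E-step : ∀ a n → n ℕ.< m → E (λ j → u (suc j) * a j) (suc n) ≈ E (λ j → u (suc j) * a j) n + u (suc n) * E a (suc n)
      E-step a n n<m = begin
        E (λ j → u (suc j) * a j) (suc n)
          ≈⟨ Σ<-cong< m (λ j j<m → term j j<m) ⟩
        Σ< m (λ j → binom n (suc j) * (u (suc j) * a j * w ^ suc j) + u (suc n) * (binom (suc n) (suc j) * (a j * w ^ suc j)))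
          ≈⟨ Σ<-+ m _ _ ⟩
        E (λ j → u (suc j) * a j) n + Σ< m (λ j → u (suc n) * (binom (suc n) (suc j) * (a j * w ^ suc j)))
          ≈⟨ +-congˡ (Σ<-*ˡ m (u (suc n)) _) ⟩
        E (λ j → u (suc j) * a j) n + u (suc n) * E a (suc n) ∎
        where
        absorb : ∀ j → j ℕ.< m → u (suc j) * binom n j ≈ u (suc n) * binom (suc n) (suc j)
        absorb j j<m = begin
          u (suc j) * binom n j
            ≈⟨ *-identityˡ _ ⟨
          1# * (u (suc j) * binom n j)
            ≈⟨ *-congʳ (u-inverse n n<m) ⟨
          (nat (suc n) * u (suc n)) * (u (suc j) * binom n j)
            ≈⟨ solve 4 (λ N v w b → (N :* v) :* (w :* b) := v :* w :* (N :* b)) ≈-refl _ _ _ _ ⟩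
          u (suc n) * u (suc j) * (nat (suc n) * binom n j)
            ≈⟨ *-congˡ (binom-absorb n j) ⟨
          u (suc n) * u (suc j) * (nat (suc j) * binom (suc n) (suc j))
            ≈⟨ solve 4 (λ N v w b → v :* w :* (N :* b) := (N :* w) :* (v :* b)) ≈-refl _ _ _ _ ⟩
          (nat (suc j) * u (suc j)) * (u (suc n) * binom (suc n) (suc j))
            ≈⟨ *-congʳ (u-inverse j j<m) ⟩
          1# * (u (suc n) * binom (suc n) (suc j))
            ≈⟨ *-identityˡ _ ⟩
          u (suc n) * binom (suc n) (suc j) ∎
        term : ∀ j → j ℕ.< m → binom (suc n) (suc j) * (u (suc j) * a j * w ^ suc j) ≈
          binom n (suc j) * (u (suc j) * a j * w ^ suc j) + u (suc n) * (binom (suc n) (suc j) * (a j * w ^ suc j))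
        term j j<m = begin
          binom (suc n) (suc j) * (u (suc j) * a j * w ^ suc j)
            ≈⟨ *-congʳ (binom-pascal n j) ⟩
          (binom n j + binom n (suc j)) * (u (suc j) * a j * w ^ suc j)
            ≈⟨ solve 5 (λ b b' v a W → (b :+ b') :* (v :* a :* W) := b' :* (v :* a :* W) :+ (v :* b) :* (a :* W)) ≈-refl _ _ _ _ _ ⟩
          binom n (suc j) * (u (suc j) * a j * w ^ suc j) + (u (suc j) * binom n j) * (a j * w ^ suc j)
            ≈⟨ +-congˡ (≈-trans (*-congʳ (absorb j j<m)) (*-assoc _ _ _)) ⟩
          binom n (suc j) * (u (suc j) * a j * w ^ suc j) + u (suc n) * (binom (suc n) (suc j) * (a j * w ^ suc j)) ∎

      E-sum : ∀ a n → n ℕ.≤ m → E (λ j → u (suc j) * a j) n ≈ Σ< n (λ k → u (suc k) * E a (suc k))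
      E-sum a zero    _   = Σ<-zero m (λ j _ → ≈-trans (*-congʳ (binom-> 0 (suc j) (s≤s z≤n))) (zeroˡ _))
      E-sum a (suc n) n<m = ≈-trans (E-step a n n<m) (+-congʳ (E-sum a n (ℕ.<⇒≤ n<m)))

      y : Carrier
      y = 1# + w

      E-1 : ∀ n → n ℕ.≤ m → E (λ _ → 1#) n ≈ y ^ n - 1#
      E-1 n n≤m = begin
        E (λ _ → 1#) n
          ≈⟨ Σ<-cong m (λ j → *-congˡ (*-identityˡ _)) ⟩
        Σ< m (λ j → f (suc j))
          ≈⟨ solve 1 (λ a → a := (con (+ 1) :+ a) :- con (+ 1)) ≈-refl _ ⟩
        (1# + Σ< m (λ j → f (suc j))) - 1#
          ≈⟨ +-congʳ (+-congʳ (≈-trans (*-identityʳ _) (binom-0 n))) ⟨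
        (f 0 + Σ< m (λ j → f (suc j))) - 1#
          ≈⟨ +-congʳ (Σ<-head m f) ⟨
        Σ< (suc m) f - 1#
          ≡⟨ cong (λ k → Σ< (suc k) f - 1#) (≡.sym (ℕ.m+[n∸m]≡n n≤m)) ⟩
        Σ< (suc n ℕ.+ (m ℕ.∸ n)) f - 1#
          ≈⟨ +-congʳ (Σ<-extend (suc n) (m ℕ.∸ n) f (λ i n<i → ≈-trans (*-congʳ (binom-> n i n<i)) (zeroˡ _))) ⟩
        Σ< (suc n) f - 1#
          ≈⟨ +-congʳ (binomial-1+ w n) ⟨
        y ^ n - 1# ∎
        where
        f : ℕ → Carrier
        f k = binom n k * w ^ k

      E-u : ∀ n → n ℕ.≤ m → E (λ j → u (suc j) * 1#) n ≈ L y (suc n) - H (suc n)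
      E-u n n≤m = begin
        E (λ j → u (suc j) * 1#) n                  ≈⟨ E-sum (λ _ → 1#) n n≤m ⟩
        Σ< n (λ k → u (suc k) * E (λ _ → 1#) (suc k))
          ≈⟨ Σ<-cong< n (λ k k<n → ≈-trans (*-congˡ (E-1 (suc k) (ℕ.≤-trans k<n n≤m))) (solve 2 (λ a b → a :* (b :- con (+ 1)) := a :* b :- a) ≈-refl _ _)) ⟩
        Σ< n (λ k → u (suc k) * y ^ suc k - u (suc k))
          ≈⟨ Σ<-sub n _ _ ⟩
        Σ< n (λ k → u (suc k) * y ^ suc k) - Σ< n (λ k → u (suc k))
          ≈⟨ +-cong (L-suc y n) (-‿cong (H-suc n)) ⟨
        L y (suc n) - H (suc n) ∎

      E-u² : E (λ j → u (suc j) * (u (suc j) * 1#)) m ≈ Σ< m (λ k → u (suc k) * L y (suc (suc k))) - Σ< m (λ k → u (suc k) * H (suc (suc k)))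
      E-u² = begin
        E (λ j → u (suc j) * (u (suc j) * 1#)) m    ≈⟨ E-sum (λ j → u (suc j) * 1#) m ℕ.≤-refl ⟩
        Σ< m (λ k → u (suc k) * E (λ j → u (suc j) * 1#) (suc k))
          ≈⟨ Σ<-cong< m (λ k k<m → ≈-trans (*-congˡ (E-u (suc k) k<m)) (solve 3 (λ a b c → a :* (b :- c) := a :* b :- a :* c) ≈-refl _ _ _)) ⟩
        Σ< m (λ k → u (suc k) * L y (suc (suc k)) - u (suc k) * H (suc (suc k)))
          ≈⟨ Σ<-sub m _ _ ⟩
        Σ< m (λ k → u (suc k) * L y (suc (suc k))) - Σ< m (λ k → u (suc k) * H (suc (suc k))) ∎

      E-m : ∀ a → E a m ≈ Σ< m (λ j → a j * (- w) ^ suc j)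
      E-m a = Σ<-cong< m (λ j j<m → ≈-trans (*-congʳ (binom-m (suc j) j<m))
        (≈-trans (solve 3 (λ s a W → s :* (a :* W) := a :* (s :* W)) ≈-refl _ _ _) (*-congˡ (≈-sym (neg-^ w (suc j))))))

      -- The coefficients 1/(j+1)^2 are reached by two divisions from the transform (1 + w)^n - 1 of
      -- the constant 1, which produces nested sums in y = 1 + w. At n = p - 1 the weights
      -- (-1)^(j+1) turn the same transform into G(-w).
      G-reflect : G (- w) ≈ (M y + G y) - Σ< m (λ k → u (suc k) * H (suc (suc k)))
      G-reflect = begin
        G (- w)                                     ≈⟨ G-suc (- w) ⟩
        Σ< m (λ j → u (suc j) * u (suc j) * (- w) ^ suc j)  ≈⟨ Σ<-cong m (λ j → *-congʳ (*-congˡ (≈-sym (*-identityʳ _)))) ⟩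
        Σ< m (λ j → u (suc j) * (u (suc j) * 1#) * (- w) ^ suc j)  ≈⟨ E-m _ ⟨
        E (λ j → u (suc j) * (u (suc j) * 1#)) m    ≈⟨ E-u² ⟩
        Σ< m (λ k → u (suc k) * L y (suc (suc k))) - Σ< m (λ k → u (suc k) * H (suc (suc k)))  ≈⟨ +-congʳ (M+G y) ⟩
        (M y + G y) - Σ< m (λ k → u (suc k) * H (suc (suc k))) ∎

    private
      module T₋₁ = Transform (- 1#)

      L-0 : ∀ n → L 0# n ≈ 0#
      L-0 zero    = ≈-refl
      L-0 (suc n) = ≈-trans (+-cong (L-0 n) (last n)) (+-identityˡ _)
        where
        last : ∀ n → u n * 0# ^ n ≈ 0#
        last zero    = ≈-trans (*-congʳ u-0) (zeroˡ _)
        last (suc n) = ≈-trans (*-congˡ (0^[1+n]≈0 n)) (zeroʳ _)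

      1-1≈0 : 1# + - 1# ≈ 0#
      1-1≈0 = -‿inverseʳ 1#

      neg-neg-1 : - - 1# ≈ 1#
      neg-neg-1 = solve 0 (:- (:- con (+ 1)) := con (+ 1)) ≈-refl

    -- For w = -1 and n = p - 1 the transform of 1/(j+1) is H p by the signs, and L 0 - H p = - H p
    -- by `E-u`.
    H≈0 : H p ≈ 0#
    H≈0 = 2-cancel (begin
      H p + H p                                      ≈⟨ +-congˡ (H-suc m) ⟩
      H p + Σ< m (λ k → u (suc k))                   ≈⟨ +-congˡ (Σ<-cong m (λ k → ≈-trans (*-cong (*-identityʳ _) (≈-trans (^-congˡ (suc k) neg-neg-1) (1^n≈1 (suc k)))) (*-identityʳ _))) ⟨
      H p + Σ< m (λ j → u (suc j) * 1# * (- - 1#) ^ suc j)  ≈⟨ +-congˡ (T₋₁.E-m _) ⟨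
      H p + T₋₁.E (λ j → u (suc j) * 1#) m           ≈⟨ +-congˡ (T₋₁.E-u m ℕ.≤-refl) ⟩
      H p + (L T₋₁.y p - H p)                        ≈⟨ +-congˡ (+-congʳ (≈-trans (L-cong p 1-1≈0) (L-0 p))) ⟩
      H p + (0# - H p)                               ≈⟨ solve 1 (λ a → a :+ (con (+ 0) :- a) := con (+ 0) :+ con (+ 0)) ≈-refl (H p) ⟩
      0# + 0#                                        ∎)

    -- At x = 1, where L = H p = 0 and x^p = 1, `L-square` reads 0 = -3 G(1).
    G1≈0 : G 1# ≈ 0#
    G1≈0 = 3-cancel (begin
      nat 3 * G 1#
        ≈⟨ solve 3 (λ g l mm → con (+ 3) :* g := (con (+ 1) :- con (+ 1)) :* mm :+ (con (+ 1) :- con (+ 1)) :* mm :- (((con (+ 1) :- con (+ 1)) :* mm :+ (con (+ 1) :- con (+ 1)) :* mm) :- g :- g :- con (+ 1) :* g)) ≈-refl (G 1#) 1# (M 1#) ⟩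
      (1# - 1#) * M 1# + (1# - 1#) * M 1# - ((1# - 1#) * M 1# + (1# - 1#) * M 1# - G 1# - G 1# - 1# * G 1#)
        ≈⟨ +-congˡ (-‿cong (+-cong (+-congʳ (+-congʳ (+-cong 1^p 1^p))) (-‿cong (*-congʳ (1^n≈1 p))))) ⟨
      (1# - 1#) * M 1# + (1# - 1#) * M 1# - ((1# ^ p - 1#) * M 1# + (1# ^ p - 1#) * M 1# - G 1# - G 1# - 1# ^ p * G 1#)
        ≈⟨ +-congˡ (-‿cong (L-square 1# H≈0)) ⟨
      (1# - 1#) * M 1# + (1# - 1#) * M 1# - L 1# p * L 1# p
        ≈⟨ +-congˡ (-‿cong (*-congʳ L1≈0)) ⟩
      (1# - 1#) * M 1# + (1# - 1#) * M 1# - 0# * L 1# p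
        ≈⟨ solve 2 (λ mm l → (con (+ 1) :- con (+ 1)) :* mm :+ (con (+ 1) :- con (+ 1)) :* mm :- con (+ 0) :* l := con (+ 3) :* con (+ 0)) ≈-refl (M 1#) (L 1# p) ⟩
      nat 3 * 0# ∎)
      where
      1^p : (1# ^ p - 1#) * M 1# ≈ (1# - 1#) * M 1#
      1^p = *-congʳ (+-congʳ (1^n≈1 p))
      L1≈0 : L 1# p ≈ 0#
      L1≈0 = ≈-trans (Σ<-cong p (λ k → ≈-trans (*-congˡ (1^n≈1 k)) (*-identityʳ _))) H≈0

    -- The constant K in `G-reflect` does not depend on y, and y = 0 gives K = - G(1) = 0.
    G-1- : ∀ y → G (1# - y) ≈ M y + G y
    G-1- y = begin
      G (1# - y)                   ≈⟨ G-cong (solve 1 (λ y → con (+ 1) :- y := :- (y :- con (+ 1))) ≈-refl y) ⟩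
      G (- (y - 1#))               ≈⟨ T.G-reflect ⟩
      (M T.y + G T.y) - K          ≈⟨ +-cong (+-cong (M-cong y≈) (G-cong y≈)) (-‿cong K≈0) ⟩
      (M y + G y) - 0#             ≈⟨ solve 1 (λ a → a :- con (+ 0) := a) ≈-refl _ ⟩
      M y + G y                    ∎
      where
      module T = Transform (y - 1#)
      K : Carrier
      K = Σ< m (λ k → u (suc k) * H (suc (suc k)))
      y≈ : 1# + (y - 1#) ≈ y
      y≈ = solve 1 (λ y → con (+ 1) :+ (y :- con (+ 1)) := y) ≈-refl y
      M0+G0 : M (1# + - 1#) + G (1# + - 1#) ≈ 0#
      M0+G0 = ≈-trans (≈-sym (M+G (1# + - 1#))) (Σ<-zero m (λ k _ → ≈-trans (*-congˡ (≈-trans (L-cong (suc (suc k)) 1-1≈0) (L-0 (suc (suc k))))) (zeroʳ _)))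
      K≈0 : K ≈ 0#
      K≈0 = begin
        K                                          ≈⟨ solve 2 (λ a k → k := a :- (a :- k)) ≈-refl (M (1# + - 1#) + G (1# + - 1#)) K ⟩
        (M (1# + - 1#) + G (1# + - 1#)) - ((M (1# + - 1#) + G (1# + - 1#)) - K)  ≈⟨ +-cong M0+G0 (-‿cong (≈-sym T₋₁.G-reflect)) ⟩
        0# - G (- - 1#)                            ≈⟨ +-congˡ (-‿cong (≈-trans (G-cong neg-neg-1) G1≈0)) ⟩
        0# - 0#                                    ≈⟨ -‿inverseʳ _ ⟩
        0#                                         ∎

    -- Granville's congruence for the square of the Fermat quotient, in terms of L = -q.
    L²-functional : ∀ y → L y p * L y p ≈ - (nat 2 * (y ^ p * G y + (1# - y ^ p) * G (1# - y)))
    L²-functional y = begin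
      L y p * L y p
        ≈⟨ L-square y H≈0 ⟩
      (X - 1#) * M y + (X - 1#) * M y - G y - G y - X * G 1#
        ≈⟨ +-congˡ (-‿cong (≈-trans (*-congˡ G1≈0) (zeroʳ _))) ⟩
      (X - 1#) * M y + (X - 1#) * M y - G y - G y - 0#
        ≈⟨ solve 3 (λ X mm g → (X :- con (+ 1)) :* mm :+ (X :- con (+ 1)) :* mm :- g :- g :- con (+ 0) := :- (con (+ 2) :* (X :* g :+ (con (+ 1) :- X) :* (mm :+ g)))) ≈-refl X (M y) (G y) ⟩
      - (nat 2 * (X * G y + (1# - X) * (M y + G y)))
        ≈⟨ -‿cong (*-congˡ (+-congˡ (*-congˡ (G-1- y)))) ⟨
      - (nat 2 * (X * G y + (1# - X) * G (1# - y))) ∎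
      where
      X : Carrier
      X = y ^ p

    G-inverse : ∀ a z → z * a ≈ 1# → a ^ p * G z ≈ G a
    G-inverse a z za≈1 = begin
      a ^ p * G z                                                   ≈⟨ *-congˡ (G-suc z) ⟩
      a ^ p * Σ< m (λ j → u (suc j) * u (suc j) * z ^ suc j)        ≈⟨ Σ<-*ˡ m (a ^ p) _ ⟨
      Σ< m (λ j → a ^ p * (u (suc j) * u (suc j) * z ^ suc j))      ≈⟨ Σ<-reverse m term ⟩
      Σ< m (λ j → u (suc j) * u (suc j) * a ^ suc j)                ≈⟨ G-suc a ⟨
      G a                                                           ∎
      where
      term : ∀ i j → suc (i ℕ.+ j) ≡ m → a ^ p * (u (suc i) * u (suc i) * z ^ suc i) ≈ u (suc j) * u (suc j) * a ^ suc j
      term i j eq = begin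
        a ^ p * (u (suc i) * u (suc i) * z ^ suc i)
          ≈⟨ *-cong (≈-trans (≈-reflexive (cong (a ^_) (≡.sym i+j≡p))) (^-homo-* a (suc i) (suc j))) (*-congʳ (u²-reflect (suc i) (suc j) i+j≡p)) ⟩
        (a ^ suc i * a ^ suc j) * (u (suc j) * u (suc j) * z ^ suc i)
          ≈⟨ solve 4 (λ A B v Z → (A :* B) :* (v :* Z) := (Z :* A) :* (v :* B)) ≈-refl _ _ _ _ ⟩
        (z ^ suc i * a ^ suc i) * (u (suc j) * u (suc j) * a ^ suc j)
          ≈⟨ *-congʳ (≈-trans (≈-sym (^-distrib-* z a (suc i))) (≈-trans (^-congˡ (suc i) za≈1) (1^n≈1 (suc i)))) ⟩
        1# * (u (suc j) * u (suc j) * a ^ suc j)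
          ≈⟨ *-identityˡ _ ⟩
        u (suc j) * u (suc j) * a ^ suc j ∎
        where
        i+j≡p : suc i ℕ.+ suc j ≡ p
        i+j≡p = cong suc (≡.trans (ℕ.+-suc i j) eq)

    -- Sums along residue classes mod 3 and B_(p-2)(1/3).

    Σ<-3* : ∀ a f → Σ< (a ℕ.* 3) f ≈ Σ< a (λ t → f (t ℕ.* 3)) + Σ< a (λ t → f (1 ℕ.+ t ℕ.* 3)) + Σ< a (λ t → f (2 ℕ.+ t ℕ.* 3))
    Σ<-3* zero    f = solve 0 (con (+ 0) := con (+ 0) :+ con (+ 0) :+ con (+ 0)) ≈-refl
    Σ<-3* (suc a) f = ≈-trans (+-congʳ (+-congʳ (+-congʳ (Σ<-3* a f))))
      (solve 6 (λ A B C x y z → A :+ B :+ C :+ x :+ y :+ z := (A :+ x) :+ (B :+ y) :+ (C :+ z)) ≈-refl _ _ _ _ _ _)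

    v : ℕ → Carrier
    v n = u n * u n

    v-0 : v 0 ≈ 0#
    v-0 = ≈-trans (*-congʳ u-0) (zeroˡ _)

    S : ℕ → ℕ → Carrier
    S r n = Σ< n (λ t → v (r ℕ.+ t ℕ.* 3))

    S-weighted : ∀ y r n → y ^ 3 ≈ 1# → Σ< n (λ t → v (r ℕ.+ t ℕ.* 3) * y ^ (r ℕ.+ t ℕ.* 3)) ≈ S r n * y ^ r
    S-weighted y r n y³≈1 = ≈-trans (Σ<-cong n (λ t → *-congˡ (power t))) (Σ<-*ʳ n _ (y ^ r))
      where
      power : ∀ t → y ^ (r ℕ.+ t ℕ.* 3) ≈ y ^ r
      power t = begin
        y ^ (r ℕ.+ t ℕ.* 3)      ≈⟨ ^-homo-* y r (t ℕ.* 3) ⟩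
        y ^ r * y ^ (t ℕ.* 3)    ≈⟨ *-congˡ (≈-reflexive (cong (y ^_) (ℕ.*-comm t 3))) ⟩
        y ^ r * y ^ (3 ℕ.* t)    ≈⟨ *-congˡ (^-assocʳ y 3 t) ⟨
        y ^ r * (y ^ 3) ^ t      ≈⟨ *-congˡ (≈-trans (^-congˡ t y³≈1) (1^n≈1 t)) ⟩
        y ^ r * 1#               ≈⟨ *-identityʳ _ ⟩
        y ^ r                    ∎

    G-sections₁ : ∀ a y → p ≡ suc (a ℕ.* 3) → y ^ 3 ≈ 1# → G y ≈ S 0 (suc a) * y ^ 0 + S 1 a * y ^ 1 + S 2 a * y ^ 2
    G-sections₁ a y eq y³≈1 = begin
      G y                              ≡⟨ cong (λ n → Σ< n f) eq ⟩
      Σ< (a ℕ.* 3) f + f (a ℕ.* 3)     ≈⟨ +-congʳ (Σ<-3* a f) ⟩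
      Σ< a (λ t → f (t ℕ.* 3)) + Σ< a (λ t → f (1 ℕ.+ t ℕ.* 3)) + Σ< a (λ t → f (2 ℕ.+ t ℕ.* 3)) + f (a ℕ.* 3)
        ≈⟨ solve 4 (λ A B C x → A :+ B :+ C :+ x := (A :+ x) :+ B :+ C) ≈-refl _ _ _ _ ⟩
      Σ< (suc a) (λ t → f (t ℕ.* 3)) + Σ< a (λ t → f (1 ℕ.+ t ℕ.* 3)) + Σ< a (λ t → f (2 ℕ.+ t ℕ.* 3))
        ≈⟨ +-cong (+-cong (S-weighted y 0 (suc a) y³≈1) (S-weighted y 1 a y³≈1)) (S-weighted y 2 a y³≈1) ⟩
      S 0 (suc a) * y ^ 0 + S 1 a * y ^ 1 + S 2 a * y ^ 2 ∎
      where
      f : ℕ → Carrier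
      f k = v k * y ^ k

    G-sections₂ : ∀ a y → p ≡ suc (suc (a ℕ.* 3)) → y ^ 3 ≈ 1# → G y ≈ S 0 (suc a) * y ^ 0 + S 1 (suc a) * y ^ 1 + S 2 a * y ^ 2
    G-sections₂ a y eq y³≈1 = begin
      G y                              ≡⟨ cong (λ n → Σ< n f) eq ⟩
      Σ< (a ℕ.* 3) f + f (a ℕ.* 3) + f (1 ℕ.+ a ℕ.* 3)     ≈⟨ +-congʳ (+-congʳ (Σ<-3* a f)) ⟩
      Σ< a (λ t → f (t ℕ.* 3)) + Σ< a (λ t → f (1 ℕ.+ t ℕ.* 3)) + Σ< a (λ t → f (2 ℕ.+ t ℕ.* 3)) + f (a ℕ.* 3) + f (1 ℕ.+ a ℕ.* 3)
        ≈⟨ solve 5 (λ A B C x y → A :+ B :+ C :+ x :+ y := (A :+ x) :+ (B :+ y) :+ C) ≈-refl _ _ _ _ _ ⟩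
      Σ< (suc a) (λ t → f (t ℕ.* 3)) + Σ< (suc a) (λ t → f (1 ℕ.+ t ℕ.* 3)) + Σ< a (λ t → f (2 ℕ.+ t ℕ.* 3))
        ≈⟨ +-cong (+-cong (S-weighted y 0 (suc a) y³≈1) (S-weighted y 1 (suc a) y³≈1)) (S-weighted y 2 a y³≈1) ⟩
      S 0 (suc a) * y ^ 0 + S 1 (suc a) * y ^ 1 + S 2 a * y ^ 2 ∎
      where
      f : ℕ → Carrier
      f k = v k * y ^ k

    -- k ↦ p - k exchanges the positive multiples of 3 below p with the class of p, and 1/k^2 is
    -- even. The extra index on the left is the term `v 0` = 0.
    S-reflect : ∀ r a → p ≡ r ℕ.+ a ℕ.* 3 → S 0 (suc a) ≈ S r a
    S-reflect r a eq = begin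
      S 0 (suc a)                              ≈⟨ Σ<-head a _ ⟩
      v 0 + Σ< a (λ t → v (suc t ℕ.* 3))       ≈⟨ ≈-trans (+-congʳ v-0) (+-identityˡ _) ⟩
      Σ< a (λ t → v (suc t ℕ.* 3))             ≈⟨ Σ<-reverse a (λ i j e → u²-reflect (suc i ℕ.* 3) (r ℕ.+ j ℕ.* 3) (index i j e)) ⟩
      S r a                                    ∎
      where
      index : ∀ i j → suc (i ℕ.+ j) ≡ a → suc i ℕ.* 3 ℕ.+ (r ℕ.+ j ℕ.* 3) ≡ p
      index i j refl = ≡.trans (≡.sym (ℕ.+-assoc (suc i ℕ.* 3) r (j ℕ.* 3)))
        (≡.trans (cong (ℕ._+ j ℕ.* 3) (ℕ.+-comm (suc i ℕ.* 3) r))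
        (≡.trans (ℕ.+-assoc r (suc i ℕ.* 3) (j ℕ.* 3))
        (≡.trans (cong (r ℕ.+_) (≡.sym (ℕ.*-distribʳ-+ 3 (suc i) j))) (≡.sym eq))))

    nat-3* : ∀ n → nat (n ℕ.* 3) ≈ nat 3 * nat n
    nat-3* n = ≈-trans (nat-* n 3) (*-comm _ _)

    9*3^[p-3] : nat 9 * nat 3 ^ suc d ≈ 1#
    9*3^[p-3] = 3-cancel (begin
      nat 3 * (nat 9 * nat 3 ^ suc d)   ≈⟨ solve 1 (λ a → con (+ 3) :* (con (+ 9) :* a) := con (+ 3) :* (con (+ 3) :* (con (+ 3) :* a))) ≈-refl _ ⟩
      nat 3 ^ p                         ≈⟨ fermat 3 ⟩
      nat 3                             ≈⟨ *-identityʳ _ ⟨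
      nat 3 * 1#                        ∎)

    module WithBernoulli (b : ℕ → Carrier) (b-rec : ∀ n → n ℕ.≤ m → iter 1# n b 0 ≈ b n + δ₁ n) where
      open Bernoulli b m b-rec

      B : Carrier → Carrier
      B x = iter x (suc (suc d)) b 0

      B-cong : ∀ {x y} → x ≈ y → B x ≈ B y
      B-cong x≈y = iter-cong (suc (suc d)) x≈y (λ _ → ≈-refl) 0

      -1^[p-2] : (- 1#) ^ suc (suc d) ≈ - 1#
      -1^[p-2] = begin
        (- 1#) ^ suc (suc d)      ≈⟨ solve 1 (λ a → a := :- (:- con (+ 1) :* a)) ≈-refl _ ⟩
        - ((- 1#) ^ m)            ≈⟨ -‿cong -1^m≈1 ⟩
        - 1#                      ∎

      -- The index p - 2 is odd, and greater than 1 because p > 3.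
      B0≈0 : B 0# ≈ 0#
      B0≈0 = 2-cancel (≈-trans (+-cong (iter-0 _) (iter-0 _))
        (≈-trans (bernoulli-odd inv (suc (suc d)) (s≤s (s≤s z≤n)) ℕ.≤-refl -1^[p-2]) (≈-sym (+-identityʳ 0#))))

      nat-[p-2] : nat (suc (suc d)) ≈ - nat 2
      nat-[p-2] = begin
        nat (suc (suc d))              ≈⟨ solve 1 (λ a → a := (con (+ 2) :+ a) :- con (+ 2)) ≈-refl _ ⟩
        (nat 2 + nat (suc (suc d))) - nat 2   ≈⟨ +-congʳ (≈-trans (≈-sym (nat-+ 2 (suc (suc d)))) char) ⟩
        0# - nat 2                     ≈⟨ +-identityˡ _ ⟩
        - nat 2                        ∎

      B-difference : ∀ x → B (x + 1#) - B x ≈ - nat 2 * x ^ suc d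
      B-difference x = begin
        B (x + 1#) - B x                             ≈⟨ +-congʳ (bernoulli-difference (suc d) x (ℕ.n≤1+n _)) ⟩
        (B x + nat (suc (suc d)) * x ^ suc d) - B x  ≈⟨ solve 2 (λ a b → (a :+ b) :- a := b) ≈-refl _ _ ⟩
        nat (suc (suc d)) * x ^ suc d                ≈⟨ *-congʳ nat-[p-2] ⟩
        - nat 2 * x ^ suc d                          ∎

      -- With r = 3x, 1/(r + 3t)^2 = 3^(p-3) (x + t)^(p-3), and the last power is a difference of
      -- B_(p-2) up to the factor p - 2 = -2. The constant 18 is 2 times 9, where 9 is the inverse
      -- of 3^(p-3).
      S-telescope : ∀ r n x → nat r ≈ nat 3 * x → nat 18 * S r n ≈ B x - B (x + nat n)
      S-telescope r n x r≈3x = begin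
        nat 18 * S r n                    ≈⟨ *-congˡ (Σ<-cong n term) ⟩
        nat 18 * Σ< n (λ t → nat 3 ^ suc d * (x + nat t) ^ suc d)  ≈⟨ *-congˡ (Σ<-*ˡ n _ _) ⟩
        nat 18 * (nat 3 ^ suc d * Σ< n (λ t → (x + nat t) ^ suc d))
          ≈⟨ solve 2 (λ a s → con (+ 18) :* (a :* s) := (con (+ 9) :* a) :* (:- (:- con (+ 2) :* s))) ≈-refl _ _ ⟩
        (nat 9 * nat 3 ^ suc d) * - (- nat 2 * Σ< n (λ t → (x + nat t) ^ suc d))
          ≈⟨ *-cong 9*3^[p-3] (-‿cong (≈-sym (Σ<-*ˡ n _ _))) ⟩
        1# * - Σ< n (λ t → - nat 2 * (x + nat t) ^ suc d)
          ≈⟨ ≈-trans (*-identityˡ _) (-‿cong (Σ<-cong n difference)) ⟩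
        - Σ< n (λ t → B (x + nat (suc t)) - B (x + nat t))
          ≈⟨ -‿cong (Σ<-telescope n (λ t → B (x + nat t))) ⟩
        - (B (x + nat n) - B (x + 0#))
          ≈⟨ -‿cong (+-congˡ (-‿cong (B-cong (+-identityʳ x)))) ⟩
        - (B (x + nat n) - B x)
          ≈⟨ solve 2 (λ a b → :- (a :- b) := b :- a) ≈-refl _ _ ⟩
        B x - B (x + nat n) ∎
        where
        term : ∀ t → v (r ℕ.+ t ℕ.* 3) ≈ nat 3 ^ suc d * (x + nat t) ^ suc d
        term t = begin
          v (r ℕ.+ t ℕ.* 3)                       ≈⟨ u² (r ℕ.+ t ℕ.* 3) ⟩
          nat (r ℕ.+ t ℕ.* 3) ^ suc d             ≈⟨ ^-congˡ (suc d) (≈-trans (nat-+ r (t ℕ.* 3)) (≈-trans (+-cong r≈3x (nat-3* t)) (≈-sym (distribˡ _ _ _)))) ⟩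
          (nat 3 * (x + nat t)) ^ suc d           ≈⟨ ^-distrib-* _ _ (suc d) ⟩
          nat 3 ^ suc d * (x + nat t) ^ suc d     ∎
        difference : ∀ t → - nat 2 * (x + nat t) ^ suc d ≈ B (x + nat (suc t)) - B (x + nat t)
        difference t = ≈-trans (≈-sym (B-difference (x + nat t)))
          (+-congʳ (B-cong (≈-trans (+-assoc _ _ _) (+-congˡ (≈-trans (+-comm _ _) (≈-sym (nat-suc t)))))))

      module _ (t : Carrier) (3t≈1 : nat 3 * t ≈ 1#) where

        -- S₀ = S₁ by reflection and S₂ = -2 S₁ because G(1) = 0, so G(y) = S₁ (1 + y - 2y^2) = 3 S₁
        -- (1 + y). The telescoped sum runs from 1/3 to 1/3 + a = p/3 = 0, where B_(p-2) vanishes.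
        G-root₁ : ∀ a y → p ≡ suc (a ℕ.* 3) → y * y ≈ - 1# - y → nat 6 * G y ≈ (1# + y) * B t
        G-root₁ a y eq y² = 3-cancel (begin
          nat 3 * (nat 6 * G y)
            ≈⟨ *-congˡ (*-congˡ (G-sections₁ a y eq (CubeRoot.y³≈1 y y²))) ⟩
          nat 3 * (nat 6 * (S₀ * 1# + S₁ * y ^ 1 + S₂ * y ^ 2))
            ≈⟨ solve 4 (λ a b c y → con (+ 3) :* (con (+ 6) :* (a :* con (+ 1) :+ b :* y :^ 1 :+ c :* y :^ 2)) := con (+ 18) :* (a :+ b :* y :+ c :* (y :* y))) ≈-refl S₀ S₁ S₂ y ⟩
          nat 18 * (S₀ + S₁ * y + S₂ * (y * y))
            ≈⟨ *-congˡ (+-cong (+-congʳ S₀≈S₁) (*-cong S₂≈ y²)) ⟩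
          nat 18 * (S₁ + S₁ * y + (- (S₁ + S₁)) * (- 1# - y))
            ≈⟨ solve 2 (λ s y → con (+ 18) :* (s :+ s :* y :+ (:- (s :+ s)) :* (:- con (+ 1) :- y)) := con (+ 3) :* ((con (+ 1) :+ y) :* (con (+ 18) :* s))) ≈-refl S₁ y ⟩
          nat 3 * ((1# + y) * (nat 18 * S₁))
            ≈⟨ *-congˡ (*-congˡ (S-telescope 1 a t (≈-sym 3t≈1))) ⟩
          nat 3 * ((1# + y) * (B t - B (t + nat a)))
            ≈⟨ *-congˡ (*-congˡ (+-congˡ (-‿cong (≈-trans (B-cong t+a≈0) B0≈0)))) ⟩
          nat 3 * ((1# + y) * (B t - 0#))
            ≈⟨ solve 2 (λ b y → con (+ 3) :* ((con (+ 1) :+ y) :* (b :- con (+ 0))) := con (+ 3) :* ((con (+ 1) :+ y) :* b)) ≈-refl _ _ ⟩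
          nat 3 * ((1# + y) * B t) ∎)
          where
          S₀ S₁ S₂ : Carrier
          S₀ = S 0 (suc a)
          S₁ = S 1 a
          S₂ = S 2 a
          S₀≈S₁ : S₀ ≈ S₁
          S₀≈S₁ = S-reflect 1 a eq
          S₂≈ : S₂ ≈ - (S₁ + S₁)
          S₂≈ = begin
            S₂                                         ≈⟨ solve 2 (λ s₁ s₂ → s₂ := (s₁ :* con (+ 1) :+ s₁ :* con (+ 1) :^ 1 :+ s₂ :* con (+ 1) :^ 2) :- (s₁ :+ s₁)) ≈-refl S₁ S₂ ⟩
            (S₁ * 1# + S₁ * 1# ^ 1 + S₂ * 1# ^ 2) - (S₁ + S₁)  ≈⟨ +-congʳ (+-congʳ (+-congʳ (*-congʳ S₀≈S₁))) ⟨
            (S₀ * 1# + S₁ * 1# ^ 1 + S₂ * 1# ^ 2) - (S₁ + S₁)  ≈⟨ +-congʳ (G-sections₁ a 1# eq (1^n≈1 3)) ⟨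
            G 1# - (S₁ + S₁)                           ≈⟨ +-congʳ G1≈0 ⟩
            0# - (S₁ + S₁)                             ≈⟨ +-identityˡ _ ⟩
            - (S₁ + S₁)                                ∎
          t+a≈0 : t + nat a ≈ 0#
          t+a≈0 = 3-cancel (begin
            nat 3 * (t + nat a)          ≈⟨ distribˡ _ _ _ ⟩
            nat 3 * t + nat 3 * nat a    ≈⟨ +-cong 3t≈1 (≈-sym (nat-3* a)) ⟩
            1# + nat (a ℕ.* 3)           ≈⟨ nat-suc (a ℕ.* 3) ⟨
            nat (suc (a ℕ.* 3))          ≈⟨ nat-cong (≡.sym eq) ⟩
            nat p                        ≈⟨ char ⟩
            0#                           ≈⟨ zeroʳ _ ⟨
            nat 3 * 0#                   ∎)

        -- Now reflection pairs class 0 with class 2, so S₁ = -2 S₀ and G(y) = S₀ (1 - 2y + y^2) =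
        -- -3 y S₀. The telescoped sum runs from 0, where B_(p-2) vanishes, to a + 1 = (p + 1)/3 =
        -- 1/3.
        G-root₂ : ∀ a y → p ≡ suc (suc (a ℕ.* 3)) → y * y ≈ - 1# - y → nat 6 * G y ≈ y * B t
        G-root₂ a y eq y² = 3-cancel (begin
          nat 3 * (nat 6 * G y)
            ≈⟨ *-congˡ (*-congˡ (G-sections₂ a y eq (CubeRoot.y³≈1 y y²))) ⟩
          nat 3 * (nat 6 * (S₀ * 1# + S₁ * y ^ 1 + S₂ * y ^ 2))
            ≈⟨ solve 4 (λ a b c y → con (+ 3) :* (con (+ 6) :* (a :* con (+ 1) :+ b :* y :^ 1 :+ c :* y :^ 2)) := con (+ 18) :* (a :+ b :* y :+ c :* (y :* y))) ≈-refl S₀ S₁ S₂ y ⟩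
          nat 18 * (S₀ + S₁ * y + S₂ * (y * y))
            ≈⟨ *-congˡ (+-cong (+-congˡ (*-congʳ S₁≈)) (*-cong (≈-sym S₀≈S₂) y²)) ⟩
          nat 18 * (S₀ + (- (S₀ + S₀)) * y + S₀ * (- 1# - y))
            ≈⟨ solve 2 (λ s y → con (+ 18) :* (s :+ (:- (s :+ s)) :* y :+ s :* (:- con (+ 1) :- y)) := con (+ 3) :* (y :* (:- (con (+ 18) :* s)))) ≈-refl S₀ y ⟩
          nat 3 * (y * - (nat 18 * S₀))
            ≈⟨ *-congˡ (*-congˡ (-‿cong (S-telescope 0 (suc a) 0# (≈-sym (zeroʳ _))))) ⟩
          nat 3 * (y * - (B 0# - B (0# + nat (suc a))))
            ≈⟨ *-congˡ (*-congˡ (-‿cong (+-cong B0≈0 (-‿cong (B-cong (≈-trans (+-identityˡ _) 1+a≈t)))))) ⟩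
          nat 3 * (y * - (0# - B t))
            ≈⟨ solve 2 (λ b y → con (+ 3) :* (y :* (:- (con (+ 0) :- b))) := con (+ 3) :* (y :* b)) ≈-refl _ _ ⟩
          nat 3 * (y * B t) ∎)
          where
          S₀ S₁ S₂ : Carrier
          S₀ = S 0 (suc a)
          S₁ = S 1 (suc a)
          S₂ = S 2 a
          S₀≈S₂ : S₀ ≈ S₂
          S₀≈S₂ = S-reflect 2 a eq
          S₁≈ : S₁ ≈ - (S₀ + S₀)
          S₁≈ = begin
            S₁                                         ≈⟨ solve 2 (λ s₀ s₁ → s₁ := (s₀ :* con (+ 1) :+ s₁ :* con (+ 1) :^ 1 :+ s₀ :* con (+ 1) :^ 2) :- (s₀ :+ s₀)) ≈-refl S₀ S₁ ⟩
            (S₀ * 1# + S₁ * 1# ^ 1 + S₀ * 1# ^ 2) - (S₀ + S₀)  ≈⟨ +-congʳ (+-congˡ (*-congʳ S₀≈S₂)) ⟩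
            (S₀ * 1# + S₁ * 1# ^ 1 + S₂ * 1# ^ 2) - (S₀ + S₀)  ≈⟨ +-congʳ (G-sections₂ a 1# eq (1^n≈1 3)) ⟨
            G 1# - (S₀ + S₀)                           ≈⟨ +-congʳ G1≈0 ⟩
            0# - (S₀ + S₀)                             ≈⟨ +-identityˡ _ ⟩
            - (S₀ + S₀)                                ∎
          1+a≈t : nat (suc a) ≈ t
          1+a≈t = 3-cancel (begin
            nat 3 * nat (suc a)          ≈⟨ nat-3* (suc a) ⟨
            nat (suc (suc (suc (a ℕ.* 3))))  ≈⟨ nat-suc (suc (suc (a ℕ.* 3))) ⟩
            1# + nat (suc (suc (a ℕ.* 3)))  ≈⟨ +-congˡ (≈-trans (nat-cong (≡.sym eq)) char) ⟩
            1# + 0#                      ≈⟨ +-identityʳ _ ⟩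
            1#                           ≈⟨ 3t≈1 ⟨
            nat 3 * t                    ∎)

        -- Evaluation at 1 + ω and at its inverse.

        module Root (ω : Carrier) (ω² : ω * ω ≈ ω - 1#) where

          open SixthRoot ω ω² using ([1+ω]²) renaming ([-ω]² to y²)

          y I : Carrier
          y = - ω
          I = nat 2 * ω - 1#

          I² : I * I ≈ - nat 3
          I² = begin
            I * I                                  ≈⟨ solve 1 (λ w → (con (+ 2) :* w :- con (+ 1)) :* (con (+ 2) :* w :- con (+ 1)) := con (+ 4) :* (w :* w) :- con (+ 4) :* w :+ con (+ 1)) ≈-refl ω ⟩
            nat 4 * (ω * ω) - nat 4 * ω + 1#       ≈⟨ +-congʳ (+-congʳ (*-congˡ ω²)) ⟩
            nat 4 * (ω - 1#) - nat 4 * ω + 1#      ≈⟨ solve 1 (λ w → con (+ 4) :* (w :- con (+ 1)) :- con (+ 4) :* w :+ con (+ 1) := :- con (+ 3)) ≈-refl ω ⟩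
            - nat 3                                ∎

          ωᵖ c' : Carrier
          ωᵖ = ω ^ p
          c' = 1# + ωᵖ

          yᵖ : y ^ p ≈ - ωᵖ
          yᵖ = begin
            y ^ p                  ≈⟨ neg-^ ω p ⟩
            (- 1#) ^ p * ωᵖ        ≈⟨ *-congʳ (*-congˡ -1^m≈1) ⟩
            (- 1# * 1#) * ωᵖ       ≈⟨ solve 1 (λ w → (:- con (+ 1) :* con (+ 1)) :* w := :- w) ≈-refl ωᵖ ⟩
            - ωᵖ                   ∎

          -- The inverse of ω is 1 - ω.
          ωᵖ-unit : (1# - ω) ^ p * ωᵖ ≈ 1#
          ωᵖ-unit = begin
            (1# - ω) ^ p * ω ^ p   ≈⟨ ^-distrib-* (1# - ω) ω p ⟨
            ((1# - ω) * ω) ^ p     ≈⟨ ^-congˡ p (begin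
              (1# - ω) * ω           ≈⟨ solve 1 (λ w → (con (+ 1) :- w) :* w := w :- w :* w) ≈-refl ω ⟩
              ω - ω * ω              ≈⟨ +-congˡ (-‿cong ω²) ⟩
              ω - (ω - 1#)           ≈⟨ solve 1 (λ w → w :- (w :- con (+ 1)) := con (+ 1)) ≈-refl ω ⟩
              1#                     ∎) ⟩
            1# ^ p                 ≈⟨ 1^n≈1 p ⟩
            1#                     ∎

          ωᵖ-cancel : ∀ {a b} → ωᵖ * a ≈ ωᵖ * b → a ≈ b
          ωᵖ-cancel {a} {b} eq = begin
            a                              ≈⟨ *-identityˡ a ⟨
            1# * a                         ≈⟨ *-congʳ ωᵖ-unit ⟨
            ((1# - ω) ^ p * ωᵖ) * a        ≈⟨ *-assoc _ _ _ ⟩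
            (1# - ω) ^ p * (ωᵖ * a)        ≈⟨ *-congˡ eq ⟩
            (1# - ω) ^ p * (ωᵖ * b)        ≈⟨ *-assoc _ _ _ ⟨
            ((1# - ω) ^ p * ωᵖ) * b        ≈⟨ *-congʳ ωᵖ-unit ⟩
            1# * b                         ≈⟨ *-identityˡ b ⟩
            b                              ∎

          -- Frobenius applied to (1 + ω)^2 = 3ω. As 3ω^p is a unit, this also makes c' cancellable.
          c'² : c' * c' ≈ nat 3 * ωᵖ
          c'² = begin
            c' * c'                        ≈⟨ *-cong (freshman ω) (freshman ω) ⟨
            (1# + ω) ^ p * (1# + ω) ^ p    ≈⟨ ^-distrib-* (1# + ω) (1# + ω) p ⟨
            ((1# + ω) * (1# + ω)) ^ p      ≈⟨ ^-congˡ p [1+ω]² ⟩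
            (nat 3 * ω) ^ p                ≈⟨ ^-distrib-* (nat 3) ω p ⟩
            nat 3 ^ p * ωᵖ                 ≈⟨ *-congʳ (fermat 3) ⟩
            nat 3 * ωᵖ                     ∎

          c'-cancel : ∀ {a b} → c' * a ≈ c' * b → a ≈ b
          c'-cancel {a} {b} eq = ωᵖ-cancel (3-cancel (begin
            nat 3 * (ωᵖ * a)    ≈⟨ *-assoc _ _ _ ⟨
            (nat 3 * ωᵖ) * a    ≈⟨ *-congʳ c'² ⟨
            (c' * c') * a       ≈⟨ *-assoc _ _ _ ⟩
            c' * (c' * a)       ≈⟨ *-congˡ eq ⟩
            c' * (c' * b)       ≈⟨ *-assoc _ _ _ ⟨
            (c' * c') * b       ≈⟨ *-congʳ c'² ⟩
            (nat 3 * ωᵖ) * b    ≈⟨ *-assoc _ _ _ ⟩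
            nat 3 * (ωᵖ * b)    ∎))

          -- As quotients by p, q and q₃ cannot be defined in characteristic p, so they enter
          -- through two relations, which `Lifted` supplies.
          module _ (q q₃ : Carrier) (q≈-L : q ≈ - L y p) (2cq : nat 2 * (c' * q) ≈ nat 3 * (ωᵖ * q₃)) where

            -- Squaring `2cq` gives 4 c'^2 q^2 = 9 ω^(2p) q₃^2, and c'^2 = 3 ω^p cancels.
            4q² : nat 4 * (q * q) ≈ nat 3 * (ωᵖ * (q₃ * q₃))
            4q² = ωᵖ-cancel (3-cancel (begin
              nat 3 * (ωᵖ * (nat 4 * (q * q)))      ≈⟨ solve 2 (λ w q → con (+ 3) :* (w :* (con (+ 4) :* (q :* q))) := (con (+ 3) :* w) :* (con (+ 4) :* (q :* q))) ≈-refl ωᵖ q ⟩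
              (nat 3 * ωᵖ) * (nat 4 * (q * q))      ≈⟨ *-congʳ c'² ⟨
              (c' * c') * (nat 4 * (q * q))         ≈⟨ solve 2 (λ c q → (c :* c) :* (con (+ 4) :* (q :* q)) := (con (+ 2) :* (c :* q)) :* (con (+ 2) :* (c :* q))) ≈-refl c' q ⟩
              (nat 2 * (c' * q)) * (nat 2 * (c' * q))  ≈⟨ *-cong 2cq 2cq ⟩
              (nat 3 * (ωᵖ * q₃)) * (nat 3 * (ωᵖ * q₃))  ≈⟨ solve 2 (λ w q → (con (+ 3) :* (w :* q)) :* (con (+ 3) :* (w :* q)) := con (+ 3) :* (w :* (con (+ 3) :* (w :* (q :* q))))) ≈-refl ωᵖ q₃ ⟩
              nat 3 * (ωᵖ * (nat 3 * (ωᵖ * (q₃ * q₃))))  ∎))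

            q²≈ : q * q ≈ nat 2 * (ωᵖ * G y - c' * G (1# + ω))
            q²≈ = begin
              q * q                       ≈⟨ *-cong q≈-L q≈-L ⟩
              - L y p * - L y p           ≈⟨ solve 1 (λ l → :- l :* :- l := l :* l) ≈-refl (L y p) ⟩
              L y p * L y p               ≈⟨ L²-functional y ⟩
              - (nat 2 * (y ^ p * G y + (1# - y ^ p) * G (1# - y)))
                ≈⟨ -‿cong (*-congˡ (+-cong (*-congʳ yᵖ) (*-cong (+-congˡ (-‿cong yᵖ)) (G-cong (solve 1 (λ w → con (+ 1) :- :- w := con (+ 1) :+ w) ≈-refl ω))))) ⟩
              - (nat 2 * (- ωᵖ * G y + (1# - - ωᵖ) * G (1# + ω)))
                ≈⟨ solve 3 (λ w g g' → :- (con (+ 2) :* (:- w :* g :+ (con (+ 1) :- :- w) :* g')) := con (+ 2) :* (w :* g :- (con (+ 1) :+ w) :* g')) ≈-refl ωᵖ (G y) (G (1# + ω)) ⟩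
              nat 2 * (ωᵖ * G y - c' * G (1# + ω)) ∎

            -- `q²≈` and `4q²` express c' G(1 + ω) through G(y) and q₃^2. The surplus factor 3 in 24
            -- = 3 * 4 * 2 makes the right side a multiple of 3 ω^p = c'^2, so that one c' can be
            -- cancelled.
            24G : nat 24 * G (1# + ω) ≈ c' * (nat 8 * G y - nat 3 * (q₃ * q₃))
            24G = c'-cancel (begin
              c' * (nat 24 * g)
                ≈⟨ solve 4 (λ c g w h → c :* (con (+ 24) :* g) := con (+ 24) :* (w :* h) :- con (+ 3) :* (con (+ 4) :* (con (+ 2) :* (w :* h :- c :* g)))) ≈-refl c' g ωᵖ (G y) ⟩
              nat 24 * (ωᵖ * G y) - nat 3 * (nat 4 * (nat 2 * (ωᵖ * G y - c' * g)))
                ≈⟨ +-congˡ (-‿cong (*-congˡ (≈-trans (*-congˡ (≈-sym q²≈)) 4q²))) ⟩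
              nat 24 * (ωᵖ * G y) - nat 3 * (nat 3 * (ωᵖ * (q₃ * q₃)))
                ≈⟨ solve 3 (λ w h r → con (+ 24) :* (w :* h) :- con (+ 3) :* (con (+ 3) :* (w :* (r :* r))) := (con (+ 3) :* w) :* (con (+ 8) :* h :- con (+ 3) :* (r :* r))) ≈-refl ωᵖ (G y) q₃ ⟩
              (nat 3 * ωᵖ) * (nat 8 * G y - nat 3 * (q₃ * q₃))
                ≈⟨ *-congʳ c'² ⟨
              (c' * c') * (nat 8 * G y - nat 3 * (q₃ * q₃))
                ≈⟨ *-assoc _ _ _ ⟩
              c' * (c' * (nat 8 * G y - nat 3 * (q₃ * q₃))) ∎)
              where
              g : Carrier
              g = G (1# + ω)

            -- The factor (1 + ω)^p of `G-inverse` is c', and it cancels the c' of `24G`.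
            24G-inverse : ∀ z → z * (1# + ω) ≈ 1# → nat 24 * G z ≈ nat 8 * G y - nat 3 * (q₃ * q₃)
            24G-inverse z za≈1 = c'-cancel (begin
              c' * (nat 24 * G z)             ≈⟨ solve 2 (λ c g → c :* (con (+ 24) :* g) := con (+ 24) :* (c :* g)) ≈-refl _ _ ⟩
              nat 24 * (c' * G z)             ≈⟨ *-congˡ (*-congʳ (freshman ω)) ⟨
              nat 24 * ((1# + ω) ^ p * G z)   ≈⟨ *-congˡ (G-inverse (1# + ω) z za≈1) ⟩
              nat 24 * G (1# + ω)             ≈⟨ 24G ⟩
              c' * (nat 8 * G y - nat 3 * (q₃ * q₃)) ∎)

            -- Λ is the Legendre symbol (p/3), p ≡ Λ mod 3.
            module _ (Λ : Carrier) (Λ² : Λ * Λ ≈ 1#) (12G : nat 12 * G y ≈ (Λ - I) * B t) (2c : nat 2 * c' ≈ nat 3 + Λ * I)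
                     (s₈ s₁₆ s₃₆ : Carrier) (8s : nat 8 * s₈ ≈ 1#) (16s : nat 16 * s₁₆ ≈ 1#) (36s : nat 36 * s₃₆ ≈ 1#) where

              private
                unit : (nat 16 * s₁₆) * (nat 36 * s₃₆) ≈ 1#
                unit = ≈-trans (*-cong 16s 36s) (*-identityˡ 1#)

              -- 144 is the least common multiple of 16 and 36; since 16 * 36 = 4 * 144, its inverse
              -- is 4 s₁₆ s₃₆.
              144-cancel : ∀ {a b} → nat 144 * a ≈ nat 144 * b → a ≈ b
              144-cancel {a} {b} eq = begin
                a                                          ≈⟨ *-identityˡ a ⟨
                1# * a                                     ≈⟨ *-congʳ unit ⟨
                (nat 16 * s₁₆) * (nat 36 * s₃₆) * a         ≈⟨ shuffle a ⟩
                nat 4 * (s₁₆ * s₃₆) * (nat 144 * a)         ≈⟨ *-congˡ eq ⟩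
                nat 4 * (s₁₆ * s₃₆) * (nat 144 * b)         ≈⟨ shuffle b ⟨
                (nat 16 * s₁₆) * (nat 36 * s₃₆) * b         ≈⟨ *-congʳ unit ⟩
                1# * b                                     ≈⟨ *-identityˡ b ⟩
                b                                          ∎
                where
                shuffle : ∀ a → (nat 16 * s₁₆) * (nat 36 * s₃₆) * a ≈ nat 4 * (s₁₆ * s₃₆) * (nat 144 * a)
                shuffle a = solve 3 (λ x y a → (con (+ 16) :* x) :* (con (+ 36) :* y) :* a := con (+ 4) :* (x :* y) :* (con (+ 144) :* a)) ≈-refl s₁₆ s₃₆ a

              G-1+ω : G (1# + ω) ≈ - (q₃ * q₃ * s₁₆ * (nat 3 + I * Λ)) + s₃₆ * (nat 3 * Λ - I) * B t
              G-1+ω = 144-cancel (begin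
                nat 144 * G (1# + ω)
                  ≈⟨ solve 1 (λ g → con (+ 144) :* g := con (+ 6) :* (con (+ 24) :* g)) ≈-refl _ ⟩
                nat 6 * (nat 24 * G (1# + ω))
                  ≈⟨ *-congˡ 24G ⟩
                nat 6 * (c' * (nat 8 * G y - nat 3 * (q₃ * q₃)))
                  ≈⟨ solve 3 (λ c g r → con (+ 6) :* (c :* (con (+ 8) :* g :- con (+ 3) :* (r :* r))) := (con (+ 2) :* c) :* (con (+ 2) :* (con (+ 12) :* g) :- con (+ 9) :* (r :* r))) ≈-refl c' (G y) q₃ ⟩
                (nat 2 * c') * (nat 2 * (nat 12 * G y) - nat 9 * (q₃ * q₃))
                  ≈⟨ *-cong 2c (+-congʳ (*-congˡ 12G)) ⟩
                (nat 3 + Λ * I) * (nat 2 * ((Λ - I) * B t) - nat 9 * (q₃ * q₃))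
                  -- By Λ^2 = 1 and I^2 = -3 the product (3 + ΛI)(Λ - I) equals 2(3Λ - I); it is
                  -- expanded here so that the two relations apply.
                  ≈⟨ solve 4 (λ l i b r → (con (+ 3) :+ l :* i) :* (con (+ 2) :* ((l :- i) :* b) :- con (+ 9) :* (r :* r))
                       := :- (con (+ 9) :* (r :* r) :* (con (+ 3) :+ i :* l)) :+ con (+ 2) :* (con (+ 3) :* l :- con (+ 3) :* i :+ (l :* l) :* i :- l :* (i :* i)) :* b) ≈-refl Λ I (B t) q₃ ⟩
                - (nat 9 * (q₃ * q₃) * (nat 3 + I * Λ)) + nat 2 * (nat 3 * Λ - nat 3 * I + (Λ * Λ) * I - Λ * (I * I)) * B t
                  ≈⟨ +-congˡ (*-congʳ (*-congˡ (+-cong (+-congˡ (*-congʳ Λ²)) (-‿cong (*-congˡ I²))))) ⟩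
                - (nat 9 * (q₃ * q₃) * (nat 3 + I * Λ)) + nat 2 * (nat 3 * Λ - nat 3 * I + 1# * I - Λ * - nat 3) * B t
                  -- A factor 1 is inserted into each term, to become 16 s₁₆ and 36 s₃₆; both 9 * 16
                  -- and 4 * 36 are 144.
                  ≈⟨ solve 4 (λ l i b r → :- (con (+ 9) :* (r :* r) :* (con (+ 3) :+ i :* l)) :+ con (+ 2) :* (con (+ 3) :* l :- con (+ 3) :* i :+ con (+ 1) :* i :- l :* :- con (+ 3)) :* b
                       := :- (con (+ 9) :* (r :* r) :* con (+ 1) :* (con (+ 3) :+ i :* l)) :+ con (+ 4) :* con (+ 1) :* (con (+ 3) :* l :- i) :* b) ≈-refl Λ I (B t) q₃ ⟩
                - (nat 9 * (q₃ * q₃) * 1# * (nat 3 + I * Λ)) + nat 4 * 1# * (nat 3 * Λ - I) * B t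
                  ≈⟨ +-cong (-‿cong (*-congʳ (*-congˡ (≈-sym 16s)))) (*-congʳ (*-congʳ (*-congˡ (≈-sym 36s)))) ⟩
                - (nat 9 * (q₃ * q₃) * (nat 16 * s₁₆) * (nat 3 + I * Λ)) + nat 4 * (nat 36 * s₃₆) * (nat 3 * Λ - I) * B t
                  ≈⟨ solve 6 (λ l i b r s s' → :- (con (+ 9) :* (r :* r) :* (con (+ 16) :* s) :* (con (+ 3) :+ i :* l)) :+ con (+ 4) :* (con (+ 36) :* s') :* (con (+ 3) :* l :- i) :* b
                       := con (+ 144) :* (:- (r :* r :* s :* (con (+ 3) :+ i :* l)) :+ s' :* (con (+ 3) :* l :- i) :* b)) ≈-refl Λ I (B t) q₃ s₁₆ s₃₆ ⟩
                nat 144 * (- (q₃ * q₃ * s₁₆ * (nat 3 + I * Λ)) + s₃₆ * (nat 3 * Λ - I) * B t) ∎)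

              G-1/[1+ω] : ∀ z → z * (1# + ω) ≈ 1# → G z ≈ - (q₃ * q₃ * s₈) + s₃₆ * (Λ - I) * B t
              G-1/[1+ω] z za≈1 = 144-cancel (begin
                nat 144 * G z
                  ≈⟨ solve 1 (λ g → con (+ 144) :* g := con (+ 6) :* (con (+ 24) :* g)) ≈-refl _ ⟩
                nat 6 * (nat 24 * G z)
                  ≈⟨ *-congˡ (24G-inverse z za≈1) ⟩
                nat 6 * (nat 8 * G y - nat 3 * (q₃ * q₃))
                  ≈⟨ solve 2 (λ g r → con (+ 6) :* (con (+ 8) :* g :- con (+ 3) :* (r :* r)) := :- (con (+ 18) :* (r :* r) :* con (+ 1)) :+ con (+ 4) :* con (+ 1) :* (con (+ 12) :* g)) ≈-refl (G y) q₃ ⟩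
                - (nat 18 * (q₃ * q₃) * 1#) + nat 4 * 1# * (nat 12 * G y)
                  ≈⟨ +-cong (-‿cong (*-congˡ (≈-sym 8s))) (*-cong (*-congˡ (≈-sym 36s)) 12G) ⟩
                - (nat 18 * (q₃ * q₃) * (nat 8 * s₈)) + nat 4 * (nat 36 * s₃₆) * ((Λ - I) * B t)
                  ≈⟨ solve 6 (λ l i b r s s' → :- (con (+ 18) :* (r :* r) :* (con (+ 8) :* s)) :+ con (+ 4) :* (con (+ 36) :* s') :* ((l :- i) :* b)
                       := con (+ 144) :* (:- (r :* r :* s) :+ s' :* (l :- i) :* b)) ≈-refl Λ I (B t) q₃ s₈ s₃₆ ⟩
                nat 144 * (- (q₃ * q₃ * s₈) + s₃₆ * (Λ - I) * B t) ∎)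

          private
            c'≈ : c' ≈ 1# - y ^ p
            c'≈ = ≈-trans (solve 1 (λ w → con (+ 1) :+ w := con (+ 1) :- :- w) ≈-refl ωᵖ) (+-congˡ (-‿cong (≈-sym yᵖ)))

          legendre-1 : ∀ a → p ≡ suc (a ℕ.* 3) → (nat 12 * G y ≈ (1# - I) * B t) × (nat 2 * c' ≈ nat 3 + 1# * I)
          legendre-1 a eq =
            (begin
              nat 12 * G y              ≈⟨ solve 1 (λ g → con (+ 12) :* g := con (+ 2) :* (con (+ 6) :* g)) ≈-refl _ ⟩
              nat 2 * (nat 6 * G y)     ≈⟨ *-congˡ (G-root₁ a y eq y²) ⟩
              nat 2 * ((1# + y) * B t)  ≈⟨ solve 2 (λ w b → con (+ 2) :* ((con (+ 1) :+ :- w) :* b) := (con (+ 1) :- (con (+ 2) :* w :- con (+ 1))) :* b) ≈-refl ω (B t) ⟩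
              (1# - I) * B t            ∎) ,
            (begin
              nat 2 * c'                ≈⟨ *-congˡ (≈-trans c'≈ (+-congˡ (-‿cong (CubeRoot.y^[1+3a] y y² a eq)))) ⟩
              nat 2 * (1# - y)          ≈⟨ solve 1 (λ w → con (+ 2) :* (con (+ 1) :- :- w) := con (+ 3) :+ con (+ 1) :* (con (+ 2) :* w :- con (+ 1))) ≈-refl ω ⟩
              nat 3 + 1# * I            ∎)

          legendre-2 : ∀ a → p ≡ suc (suc (a ℕ.* 3)) → (nat 12 * G y ≈ (- 1# - I) * B t) × (nat 2 * c' ≈ nat 3 + - 1# * I)
          legendre-2 a eq =
            (begin
              nat 12 * G y              ≈⟨ solve 1 (λ g → con (+ 12) :* g := con (+ 2) :* (con (+ 6) :* g)) ≈-refl _ ⟩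
              nat 2 * (nat 6 * G y)     ≈⟨ *-congˡ (G-root₂ a y eq y²) ⟩
              nat 2 * (y * B t)         ≈⟨ solve 2 (λ w b → con (+ 2) :* ((:- w) :* b) := (:- con (+ 1) :- (con (+ 2) :* w :- con (+ 1))) :* b) ≈-refl ω (B t) ⟩
              (- 1# - I) * B t          ∎) ,
            (begin
              nat 2 * c'                ≈⟨ *-congˡ (≈-trans c'≈ (+-congˡ (-‿cong (CubeRoot.y^[2+3a] y y² a eq)))) ⟩
              nat 2 * (1# - (- 1# - y)) ≈⟨ solve 1 (λ w → con (+ 2) :* (con (+ 1) :- (:- con (+ 1) :- :- w)) := con (+ 3) :+ :- con (+ 1) :* (con (+ 2) :* w :- con (+ 1))) ≈-refl ω ⟩
              nat 3 + - 1# * I          ∎)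

-- Reduction modulo an element.

module Quotient {c ℓ : Level} (R : CommutativeRing c ℓ) (π : CommutativeRing.Carrier R) where

  open RingSums R

  infix 4 _≋_
  -- A congruence stores its quotient, which is read off later: once as q_p(3), once as the
  -- p-integral value of (x - y)/p.
  record _≋_ (x y : Carrier) : Set (c ⊔ ℓ) where
    constructor modulo
    field
      quotient   : Carrier
      difference : x ≈ y + π * quotient

  ≈⇒≋ : ∀ {x y} → x ≈ y → x ≋ y
  ≈⇒≋ x≈y = modulo 0# (≈-trans x≈y (solve 2 (λ y π → y := y :+ π :* con (+ 0)) ≈-refl _ π))

  ≋-sym : ∀ {x y} → x ≋ y → y ≋ x
  ≋-sym {x} {y} (modulo z eq) = modulo (- z) (≈-trans (solve 3 (λ y π z → y := (y :+ π :* z) :+ π :* (:- z)) ≈-refl y π z) (+-congʳ (≈-sym eq)))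

  ≋-trans : ∀ {x y z} → x ≋ y → y ≋ z → x ≋ z
  ≋-trans {x} {y} {z} (modulo k x≈) (modulo l y≈) = modulo (l + k) (≈-trans x≈ (≈-trans (+-congʳ y≈)
    (solve 4 (λ z π k l → (z :+ π :* l) :+ π :* k := z :+ π :* (l :+ k)) ≈-refl z π k l)))

  ring/π : CommutativeRing c (c ⊔ ℓ)
  ring/π = record
    { Carrier = Carrier ; _≈_ = _≋_ ; _+_ = _+_ ; _*_ = _*_ ; -_ = -_ ; 0# = 0# ; 1# = 1#
    ; isCommutativeRing = record
      { isRing = record
        { +-isAbelianGroup = record
          { isGroup = record
            { isMonoid = record
              { isSemigroup = record
                { isMagma = record
                  { isEquivalence = record { refl = ≈⇒≋ ≈-refl ; sym = ≋-sym ; trans = ≋-trans }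
                  ; ∙-cong = λ { (modulo k x≈) (modulo l y≈) → modulo (k + l) (≈-trans (+-cong x≈ y≈)
                      (solve 5 (λ x y π k l → (x :+ π :* k) :+ (y :+ π :* l) := (x :+ y) :+ π :* (k :+ l)) ≈-refl _ _ π k l)) }
                  }
                ; assoc = λ x y z → ≈⇒≋ (+-assoc x y z)
                }
              ; identity = (λ x → ≈⇒≋ (+-identityˡ x)) , (λ x → ≈⇒≋ (+-identityʳ x))
              }
            ; inverse = (λ x → ≈⇒≋ (-‿inverseˡ x)) , (λ x → ≈⇒≋ (-‿inverseʳ x))
            ; ⁻¹-cong = λ { (modulo k x≈) → modulo (- k) (≈-trans (-‿cong x≈) (solve 3 (λ x π k → :- (x :+ π :* k) := :- x :+ π :* (:- k)) ≈-refl _ π k)) }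
            }
          ; comm = λ x y → ≈⇒≋ (+-comm x y)
          }
        ; *-cong = λ { {x} {y} {v} {w} (modulo k x≈) (modulo l v≈) → modulo (y * l + k * w + k * (π * l)) (≈-trans (*-cong x≈ v≈)
            (solve 5 (λ y w π k l → (y :+ π :* k) :* (w :+ π :* l) := y :* w :+ π :* (y :* l :+ k :* w :+ k :* (π :* l))) ≈-refl y w π k l)) }
        ; *-assoc = λ x y z → ≈⇒≋ (*-assoc x y z)
        ; *-identity = (λ x → ≈⇒≋ (*-identityˡ x)) , (λ x → ≈⇒≋ (*-identityʳ x))
        ; distrib = (λ x y z → ≈⇒≋ (distribˡ x y z)) , (λ x y z → ≈⇒≋ (distribʳ x y z))
        }
      ; *-comm = λ x y → ≈⇒≋ (*-comm x y)
      }
    }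

  private module Q = RingSums ring/π

  -- The functions over `ring/π` are separate instances of the recursive definitions: they agree
  -- with those over R by computation at literals, but at a variable only by induction.
  nat-≡ : ∀ n → Q.nat n ≡ nat n
  nat-≡ zero          = refl
  nat-≡ (suc zero)    = refl
  nat-≡ (suc (suc n)) = cong (_+ 1#) (nat-≡ (suc n))

  ^-≡ : ∀ x n → x Q.^ n ≡ x ^ n
  ^-≡ x zero    = refl
  ^-≡ x (suc n) = cong (x *_) (^-≡ x n)

  Σ<-≡ : ∀ n f → Q.Σ< n f ≡ Σ< n f
  Σ<-≡ zero    f = refl
  Σ<-≡ (suc n) f = cong (_+ f n) (Σ<-≡ n f)

-- Fermat quotients over a ring in which p can be cancelled.

module Lifted {c ℓ : Level} (R : CommutativeRing c ℓ) (d : ℕ) where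

  open RingSums R

  m p : ℕ
  m = suc (suc (suc d))
  p = suc m

  open Quotient R (nat p)

  private
    module Q = RingSums ring/π
    module U = Umbral ring/π
    module P = ModP ring/π d

  module _ (inv : ℕ → Carrier) (inv-spec : ∀ j → j ℕ.< m → nat (suc j) * inv j ≈ 1#) where

    private
      char : Q.nat p ≋ 0#
      char = modulo 1# (≈-trans (≈-reflexive (nat-≡ p)) (solve 1 (λ a → a := con (+ 0) :+ a :* con (+ 1)) ≈-refl (nat p)))

      binom-≋ : ∀ n k → Q.binom n k ≋ nat (n C k)
      binom-≋ n k = Q.≈-trans (Q.binom≈nat n k) (Q.≈-reflexive (nat-≡ (n C k)))

      inv-≋ : ∀ j → j ℕ.< m → ∃ λ v → Q.nat (suc j) * v ≋ 1#
      inv-≋ j j<m = inv j , ≈⇒≋ (≈-trans (≈-reflexive (cong (_* inv j) (nat-≡ (suc j)))) (inv-spec j j<m))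

      module P′ = P.Char char inv-≋
  
    -- Its stored quotient serves as q_p(3).
    fermat-3 : nat 3 ^ m ≋ 1#
    fermat-3 = Q.≈-trans (Q.≈-reflexive (≡.sym (^-≡ (nat 3) m))) (P′.3-cancel (Q.≈-trans (P′.fermat 3) (Q.≈-sym (Q.*-identityʳ _))))

    polylog₂ : Carrier → Carrier
    polylog₂ x = Σ< m (λ j → (inv j * inv j) * x ^ suc j)

    -- These are exact facts about R, which the reduced ring cannot supply: there p is 0 and (-1)^p
    -- is known only up to a multiple of p.
    module _ (p-cancel : ∀ {a b} → nat p * a ≈ nat p * b → a ≈ b)
             (odd : (- 1#) ^ p ≈ - 1#)
             (Λ : Carrier) (residue : (∃ λ a → p ≡ suc (a ℕ.* 3) × Λ ≡ 1#) ⊎ (∃ λ a → p ≡ suc (suc (a ℕ.* 3)) × Λ ≡ - 1#))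
             (q₃ : Carrier) (3^m : nat 3 ^ m ≈ 1# + nat p * q₃)
             (b : ℕ → Carrier) (b-0 : b 0 ≈ 1#)
             (b-rec : ∀ n → 2 ℕ.≤ n → n ℕ.≤ m → Σ< n (λ k → nat (n C k) * b k) ≈ 0#)
             where

      private
        -- The top term of the expansion is b n. The lower terms sum to 0 for n at least 2 and to b
        -- 0 = 1 for n = 1, which is `δ₁`.
        b-rec-≋ : ∀ n → n ℕ.≤ m → U.iter 1# n b 0 ≋ b n + U.δ₁ n
        b-rec-≋ zero n≤m = ≈⇒≋ (≈-sym (+-identityʳ _))
        b-rec-≋ (suc n) n≤m = ≋-trans (U.iter-expand 1# (suc n) b) (≋-trans (Q.+-cong (≋-trans (Q.Σ<-cong (suc n) term) (≈⇒≋ (lower n n≤m))) (≋-trans (Q.*-congʳ (Q.binom-n (suc n))) (Q.≈-trans (Q.*-identityˡ _) (≋-trans (Q.*-congʳ (Q.1^n≈1 (n ℕ.∸ n))) (Q.*-identityˡ _))))) (Q.+-comm _ _))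
          where
          term : ∀ k → Q.binom (suc n) k * (1# Q.^ (suc n ℕ.∸ k) * b k) ≋ nat (suc n C k) * b k
          term k = Q.*-cong (binom-≋ (suc n) k) (Q.≈-trans (Q.*-congʳ (Q.1^n≈1 (suc n ℕ.∸ k))) (Q.*-identityˡ _))
          lower : ∀ n → suc n ℕ.≤ m → Q.Σ< (suc n) (λ k → nat (suc n C k) * b k) ≈ U.δ₁ (suc n)
          lower zero _ = ≈-trans (+-congˡ (*-congˡ b-0)) (solve 0 (con (+ 0) :+ con (+ 1) :* con (+ 1) := con (+ 1)) ≈-refl)
          lower (suc n) n<m = ≈-trans (≈-reflexive (Σ<-≡ (suc (suc n)) _)) (b-rec (suc (suc n)) (s≤s (s≤s z≤n)) n<m)

        module P‴ = P′.WithBernoulli b b-rec-≋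

      bernoulliSum : Carrier → Carrier
      bernoulliSum x = Σ< m (λ k → nat (suc (suc d) C k) * b k * x ^ (suc (suc d) ℕ.∸ k))

      private
        G≋polylog₂ : ∀ x → P′.G x ≋ polylog₂ x
        G≋polylog₂ x = Q.≈-trans (P′.G-suc x) (Q.≈-trans (Q.Σ<-cong< m (λ j j<m →
          Q.*-cong (Q.*-cong (inv≋u j j<m) (inv≋u j j<m)) (Q.≈-reflexive (^-≡ x (suc j))))) (Q.≈-reflexive (Σ<-≡ m _)))
          where
          inv≋u : ∀ j → j ℕ.< m → P′.u (suc j) ≋ inv j
          inv≋u j j<m = Q.≈-sym (P′.u-unique j (inv j) j<m (proj₂ (inv-≋ j j<m)))

        B≋bernoulliSum : ∀ x → P‴.B x ≋ bernoulliSum x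
        B≋bernoulliSum x = Q.≈-trans (U.iter-expand x (suc (suc d)) b) (Q.≈-trans (Q.Σ<-cong m (λ k →
          Q.≈-trans (Q.*-cong (binom-≋ (suc (suc d)) k) (Q.≈-trans (Q.*-comm _ _) (Q.*-congˡ (Q.≈-reflexive (^-≡ x (suc (suc d) ℕ.∸ k))))))
            (Q.≈-sym (Q.*-assoc _ _ _)))) (Q.≈-reflexive (Σ<-≡ m _)))

      module _ (ω : Carrier) (ω² : ω * ω ≈ ω - 1#) where

        private
          open SixthRoot ω ω² using ([1+ω]²) renaming ([-ω]² to y²)

          -- q is ((1 + ω)^p - 1 - ω^p)/p with the division carried out term by term: C(p, j+1)/p =
          -- C(p-1, j)/(j+1).
          ωᵖ c′ q : Carrier
          ωᵖ = ω ^ p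
          c′ = 1# + ωᵖ
          q = Σ< m (λ j → nat (m C j) * inv j * ω ^ suc j)

          y : Carrier
          y = - ω

          ωᵖ≈-yᵖ : ωᵖ ≈ - (y ^ p)
          ωᵖ≈-yᵖ = begin
            ωᵖ                     ≈⟨ solve 1 (λ w → w := :- (:- con (+ 1) :* w)) ≈-refl ωᵖ ⟩
            - (- 1# * ωᵖ)          ≈⟨ -‿cong (*-congʳ odd) ⟨
            - ((- 1#) ^ p * ωᵖ)    ≈⟨ -‿cong (neg-^ ω p) ⟨
            - (y ^ p)              ∎

          -- As 3 does not divide p, y^p is y or the other root -1 - y of x^2 + x + 1.
          [yᵖ]² : (y ^ p) * (y ^ p) ≈ - 1# - y ^ p
          [yᵖ]² = case residue
            where
            open CubeRoot y y²
            case : _ → (y ^ p) * (y ^ p) ≈ - 1# - y ^ p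
            case (inj₁ (a , eq , _)) = ≈-trans (*-cong yᵖ yᵖ) (≈-trans y² (+-congˡ (-‿cong (≈-sym yᵖ))))
              where yᵖ = y^[1+3a] a eq
            case (inj₂ (a , eq , _)) = begin
              (y ^ p) * (y ^ p)            ≈⟨ *-cong yᵖ yᵖ ⟩
              (- 1# - y) * (- 1# - y)      ≈⟨ solve 1 (λ y → (:- con (+ 1) :- y) :* (:- con (+ 1) :- y) := con (+ 1) :+ con (+ 2) :* y :+ y :* y) ≈-refl y ⟩
              1# + nat 2 * y + y * y       ≈⟨ +-congˡ y² ⟩
              1# + nat 2 * y + (- 1# - y)  ≈⟨ solve 1 (λ y → con (+ 1) :+ con (+ 2) :* y :+ (:- con (+ 1) :- y) := :- con (+ 1) :- (:- con (+ 1) :- y)) ≈-refl y ⟩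
              - 1# - (- 1# - y)            ≈⟨ +-congˡ (-‿cong yᵖ) ⟨
              - 1# - y ^ p                 ∎
              where yᵖ = y^[2+3a] a eq

          -- Frobenius would give this only mod p, which is lost on division by p. The exact form
          -- holds because Y = y^p satisfies Y^2 = -1 - Y, whence (1 - Y)^2 = -3Y.
          c′² : c′ * c′ ≈ nat 3 * ωᵖ
          c′² = begin
            c′ * c′                            ≈⟨ *-cong (+-congˡ ωᵖ≈-yᵖ) (+-congˡ ωᵖ≈-yᵖ) ⟩
            (1# - y ^ p) * (1# - y ^ p)        ≈⟨ solve 1 (λ Y → (con (+ 1) :- Y) :* (con (+ 1) :- Y) := con (+ 1) :- con (+ 2) :* Y :+ Y :* Y) ≈-refl (y ^ p) ⟩
            1# - nat 2 * y ^ p + y ^ p * y ^ p ≈⟨ +-congˡ [yᵖ]² ⟩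
            1# - nat 2 * y ^ p + (- 1# - y ^ p)  ≈⟨ solve 1 (λ Y → con (+ 1) :- con (+ 2) :* Y :+ (:- con (+ 1) :- Y) := con (+ 3) :* (:- Y)) ≈-refl (y ^ p) ⟩
            nat 3 * - (y ^ p)                  ≈⟨ *-congˡ ωᵖ≈-yᵖ ⟨
            nat 3 * ωᵖ                         ∎

          [1+ω]ᵖ : (1# + ω) ^ p ≈ c′ + nat p * q
          [1+ω]ᵖ = begin
            (1# + ω) ^ p             ≈⟨ Umbral.binomial-1+ R ω p ⟩
            Σ< (suc p) f             ≈⟨ Σ<-head p f ⟩
            f 0 + (Σ< m (λ k → f (suc k)) + f p)
              ≈⟨ +-cong (*-congʳ (binom-0 p)) (+-cong (≈-trans (Σ<-cong< m term) (Σ<-*ˡ m (nat p) _)) (*-congʳ (binom-n p))) ⟩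
            1# * 1# + (nat p * q + 1# * ωᵖ)  ≈⟨ solve 2 (λ a w → con (+ 1) :* con (+ 1) :+ (a :+ con (+ 1) :* w) := (con (+ 1) :+ w) :+ a) ≈-refl (nat p * q) ωᵖ ⟩
            c′ + nat p * q           ∎
            where
            f : ℕ → Carrier
            f k = binom p k * ω ^ k
            term : ∀ j → j ℕ.< m → f (suc j) ≈ nat p * (nat (m C j) * inv j * ω ^ suc j)
            term j j<m = begin
              binom p (suc j) * ω ^ suc j
                ≈⟨ *-identityˡ _ ⟨
              1# * (binom p (suc j) * ω ^ suc j)
                ≈⟨ *-congʳ (inv-spec j j<m) ⟨
              (nat (suc j) * inv j) * (binom p (suc j) * ω ^ suc j)
                ≈⟨ solve 4 (λ n v b w → (n :* v) :* (b :* w) := (n :* b) :* (v :* w)) ≈-refl _ _ _ _ ⟩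
              (nat (suc j) * binom p (suc j)) * (inv j * ω ^ suc j)
                ≈⟨ *-congʳ (≈-trans (binom-absorb m j) (*-congˡ (binom≈nat m j))) ⟩
              (nat p * nat (m C j)) * (inv j * ω ^ suc j)
                ≈⟨ solve 4 (λ n b v w → (n :* b) :* (v :* w) := n :* (b :* v :* w)) ≈-refl _ _ _ _ ⟩
              nat p * (nat (m C j) * inv j * ω ^ suc j) ∎

          -- Both (1 + ω)^(2p) = 3^p ω^p and (1 + ω^p)² = 3 ω^p hold exactly, so their difference determines q mod p.
          2c′q : nat 2 * (c′ * q) ≋ nat 3 * (ωᵖ * q₃)
          2c′q = modulo (- (q * q)) (≈-trans (solve 3 (λ c q P → con (+ 2) :* (c :* q) := (con (+ 2) :* (c :* q) :+ P :* (q :* q)) :+ P :* :- (q :* q)) ≈-refl c′ q (nat p))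
            (+-congʳ (p-cancel (begin
              -- The square of c′ + p q leaves p q^2 next to 2 c′ q; this multiple of p is what the
              -- witness -(q * q) removes.
              nat p * (nat 2 * (c′ * q) + nat p * (q * q))
                ≈⟨ solve 3 (λ P c q → P :* (con (+ 2) :* (c :* q) :+ P :* (q :* q)) := (c :+ P :* q) :* (c :+ P :* q) :- c :* c) ≈-refl (nat p) c′ q ⟩
              (c′ + nat p * q) * (c′ + nat p * q) - c′ * c′
                ≈⟨ +-cong (*-cong [1+ω]ᵖ [1+ω]ᵖ) (-‿cong (≈-sym c′²)) ⟨
              (1# + ω) ^ p * (1# + ω) ^ p - nat 3 * ωᵖ
                ≈⟨ +-congʳ (^-distrib-* (1# + ω) (1# + ω) p) ⟨
              ((1# + ω) * (1# + ω)) ^ p - nat 3 * ωᵖ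
                ≈⟨ +-congʳ (≈-trans (^-congˡ p [1+ω]²) (^-distrib-* (nat 3) ω p)) ⟩
              (nat 3 * nat 3 ^ m) * ωᵖ - nat 3 * ωᵖ
                ≈⟨ +-congʳ (*-congʳ (*-congˡ 3^m)) ⟩
              (nat 3 * (1# + nat p * q₃)) * ωᵖ - nat 3 * ωᵖ
                ≈⟨ solve 3 (λ P r w → (con (+ 3) :* (con (+ 1) :+ P :* r)) :* w :- con (+ 3) :* w := P :* (con (+ 3) :* (w :* r))) ≈-refl (nat p) q₃ ωᵖ ⟩
              nat p * (nat 3 * (ωᵖ * q₃)) ∎))))

          -- C(p-1, j) is (-1)^j mod p, and (-1)^j ω^(j+1) = -(-ω)^(j+1).
          q≋-L : q ≋ - P′.L y p
          q≋-L = Q.≈-trans (Q.≈-sym (Q.≈-reflexive (Σ<-≡ m _))) (Q.≈-trans (Q.Σ<-cong< m term) (Q.≈-trans (Q.Σ<-neg m _) (Q.-‿cong (Q.≈-sym (P′.L-suc y m)))))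
            where
            term : ∀ j → j ℕ.< m → nat (m C j) * inv j * ω ^ suc j ≋ - (P′.u (suc j) * y Q.^ suc j)
            term j j<m = Q.≈-trans
              (Q.*-cong (Q.*-cong (Q.≈-trans (Q.≈-sym (binom-≋ m j)) (P′.binom-m j (ℕ.<⇒≤ j<m)))
                (P′.u-unique j (inv j) j<m (proj₂ (inv-≋ j j<m)))) (Q.≈-reflexive (≡.sym (^-≡ ω (suc j)))))
              (Q.≈-trans (≈⇒≋ (solve 3 (λ s v w → s :* v :* w := :- (v :* ((:- con (+ 1) :* s) :* w))) ≈-refl _ _ _))
                (Q.-‿cong (Q.*-congˡ (Q.≈-sym (Q.neg-^ ω (suc j))))))

        module _ (t : Carrier) (3t≈1 : nat 3 * t ≈ 1#)
                 (s₈ s₁₆ s₃₆ : Carrier) (8s : nat 8 * s₈ ≈ 1#) (16s : nat 16 * s₁₆ ≈ 1#) (36s : nat 36 * s₃₆ ≈ 1#)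
                 (I : Carrier) (I≈ : I ≈ nat 2 * ω - 1#) where

          private
            module Rt = P‴.Root t (≈⇒≋ 3t≈1) ω (≈⇒≋ ω²)

            2c′q-≋ : Q.nat 2 * (Rt.c' * q) ≋ Q.nat 3 * (Rt.ωᵖ * q₃)
            2c′q-≋ = subst (λ w → Q.nat 2 * ((1# + w) * q) ≋ Q.nat 3 * (w * q₃)) (≡.sym (^-≡ ω p)) 2c′q

            Λ² : Λ * Λ ≋ 1#
            Λ² = case residue
              where
              case : _ → Λ * Λ ≋ 1#
              case (inj₁ (_ , _ , refl)) = Q.*-identityˡ 1#
              case (inj₂ (_ , _ , refl)) = Q.-1*-1≈1

            12G,2c : (Q.nat 12 * P′.G Rt.y ≋ (Λ - Rt.I) * P‴.B t) × (Q.nat 2 * Rt.c' ≋ Q.nat 3 + Λ * Rt.I)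
            12G,2c = case residue
              where
              case : _ → (Q.nat 12 * P′.G Rt.y ≋ (Λ - Rt.I) * P‴.B t) × (Q.nat 2 * Rt.c' ≋ Q.nat 3 + Λ * Rt.I)
              case (inj₁ (a , eq , refl)) = Rt.legendre-1 a eq
              case (inj₂ (a , eq , refl)) = Rt.legendre-2 a eq

            unit-≋ : ∀ n {x} → nat n * x ≈ 1# → Q.nat n * x ≋ 1#
            unit-≋ n eq = ≈⇒≋ (≈-trans (≈-reflexive (cong (_* _) (nat-≡ n))) eq)

            I≋ : Rt.I ≋ I
            I≋ = ≈⇒≋ (≈-sym I≈)

          polylog₂-1+ω : polylog₂ (1# + ω) ≋ - (q₃ * q₃ * s₁₆ * (nat 3 + I * Λ)) + s₃₆ * (nat 3 * Λ - I) * bernoulliSum t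
          polylog₂-1+ω = Q.≈-trans (Q.≈-sym (G≋polylog₂ (1# + ω))) (Q.≈-trans
            (Rt.G-1+ω q q₃ q≋-L 2c′q-≋ Λ Λ² (proj₁ 12G,2c) (proj₂ 12G,2c) s₈ s₁₆ s₃₆ (unit-≋ 8 8s) (unit-≋ 16 16s) (unit-≋ 36 36s))
            (Q.+-cong (Q.-‿cong (Q.*-congˡ (Q.+-congˡ (Q.*-congʳ I≋)))) (Q.*-cong (Q.*-congˡ (Q.+-congˡ (Q.-‿cong I≋))) (B≋bernoulliSum t))))

          polylog₂-inverse : ∀ z → z * (1# + ω) ≈ 1# → polylog₂ z ≋ - (q₃ * q₃ * s₈) + s₃₆ * (Λ - I) * bernoulliSum t
          polylog₂-inverse z za≈1 = Q.≈-trans (Q.≈-sym (G≋polylog₂ z)) (Q.≈-trans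
            (Rt.G-1/[1+ω] q q₃ q≋-L 2c′q-≋ Λ Λ² (proj₁ 12G,2c) (proj₂ 12G,2c) s₈ s₁₆ s₃₆ (unit-≋ 8 8s) (unit-≋ 16 16s) (unit-≋ 36 36s) z (≈⇒≋ za≈1))
            (Q.+-congˡ (Q.*-cong (Q.*-congˡ (Q.+-congˡ (Q.-‿cong I≋))) (B≋bernoulliSum t))))

-- Fractions with denominator prime to p, and the field ℚ(√-3).

module ℚRing = RingSums ℚ.+-*-commutativeRing
open ℚRing using (solve; _:=_; _:+_; _:*_; _:-_; :-_; con)

toℚᵘ-/ : ∀ z n → toℚᵘ (z / suc n) ≃ᵘ mkℚᵘ z n
toℚᵘ-/ z n = ℚ.toℚᵘ-fromℚᵘ (mkℚᵘ z n)

/1-+ : ∀ a b → (a ℤ.+ b) / 1 ≡ a / 1 ℚ.+ b / 1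
/1-+ a b = ℚ.toℚᵘ-injective (ℚᵘ.≃-trans (toℚᵘ-/ (a ℤ.+ b) 0) (ℚᵘ.≃-trans (*≡* (cong (ℤ._* + 1) (cong₂ ℤ._+_ (sym (ℤ.*-identityʳ a)) (sym (ℤ.*-identityʳ b)))))
  (ℚᵘ.≃-sym (ℚᵘ.≃-trans (ℚ.toℚᵘ-homo-+ (a / 1) (b / 1)) (ℚᵘ.+-cong (toℚᵘ-/ a 0) (toℚᵘ-/ b 0))))))

/1-* : ∀ a b → (a ℤ.* b) / 1 ≡ a / 1 ℚ.* (b / 1)
/1-* a b = ℚ.toℚᵘ-injective (ℚᵘ.≃-trans (toℚᵘ-/ (a ℤ.* b) 0) (ℚᵘ.≃-sym (ℚᵘ.≃-trans (ℚ.toℚᵘ-homo-* (a / 1) (b / 1)) (ℚᵘ.*-cong (toℚᵘ-/ a 0) (toℚᵘ-/ b 0)))))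

/1-neg : ∀ a → (ℤ.- a) / 1 ≡ ℚ.- (a / 1)
/1-neg a = ℚ.toℚᵘ-injective (ℚᵘ.≃-trans (toℚᵘ-/ (ℤ.- a) 0) (ℚᵘ.≃-sym (ℚᵘ.≃-trans (ℚ.toℚᵘ-homo‿- (a / 1)) (ℚᵘ.-‿cong (toℚᵘ-/ a 0)))))

/-*-cancel : ∀ z n → (z / suc n) ℚ.* (+ suc n / 1) ≡ z / 1
/-*-cancel z n = ℚ.toℚᵘ-injective (ℚᵘ.≃-trans (ℚ.toℚᵘ-homo-* (z / suc n) (+ suc n / 1)) (ℚᵘ.≃-trans (ℚᵘ.*-cong (toℚᵘ-/ z n) (toℚᵘ-/ (+ suc n) 0))
  (ℚᵘ.≃-trans (*≡* (trans (ℤ.*-identityʳ _) (cong (z ℤ.*_) (cong (λ k → + suc k) (sym (ℕ.*-identityʳ n)))))) (ℚᵘ.≃-sym (toℚᵘ-/ z 0)))))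

record Integral (p : ℕ) (r : ℚ) : Set where
  constructor fraction
  field
    denominator : ℕ
    numerator   : ℤ
    p∤d         : ¬ p ∣ denominator
    scaled      : r ℚ.* (+ denominator / 1) ≡ numerator / 1

-- The denominator in lowest terms is coprime to the numerator and so divides every other
-- denominator.
Integral⇒ℚ-pIntegral : ∀ {p r} → Integral p r → ℚ-pIntegral p r
Integral⇒ℚ-pIntegral {p} {mkℚ num den-1 cop} (fraction d n p∤d eq) p∣den = p∤d (∣-trans p∣den den∣d)
  where
  r : ℚ
  r = mkℚ num den-1 cop
  num*d≃n : mkℚᵘ (num ℤ.* + d) (den-1 ℕ.* 1) ≃ᵘ mkℚᵘ n 0
  num*d≃n = ℚᵘ.≃-trans (ℚᵘ.≃-sym (ℚᵘ.≃-trans (ℚ.toℚᵘ-homo-* r (+ d / 1)) (ℚᵘ.*-congˡ {mkℚᵘ num den-1} (toℚᵘ-/ (+ d) 0))))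
    (ℚᵘ.≃-trans (ℚᵘ.≃-reflexive (cong toℚᵘ eq)) (toℚᵘ-/ n 0))
  cross : num ℤ.* + d ≡ n ℤ.* + suc den-1
  cross with num*d≃n
  ... | *≡* e = trans (sym (ℤ.*-identityʳ _)) (trans e (cong (λ k → n ℤ.* + suc k) (ℕ.*-identityʳ den-1)))
  abs-cross : ℤ.∣ num ∣ ℕ.* d ≡ ℤ.∣ n ∣ ℕ.* suc den-1
  abs-cross = trans (sym (ℤ.abs-* num (+ d))) (trans (cong ℤ.∣_∣ cross) (ℤ.abs-* n (+ suc den-1)))
  den∣d : suc den-1 ∣ d
  den∣d = Coprimality.coprime-divisor (Coprimality.sym (Coprimality.recompute cop)) (divides ℤ.∣ n ∣ abs-cross)

ℚω-+-assoc : ∀ x y z → (x +ω y) +ω z ≡ x +ω (y +ω z)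
ℚω-+-assoc x y z = cong₂ ⟨_,_⟩ (ℚ.+-assoc (re x) (re y) (re z)) (ℚ.+-assoc (im x) (im y) (im z))

ℚω-ring : CommutativeRing 0ℓ 0ℓ
ℚω-ring = record
  { Carrier = ℚω ; _≈_ = _≡_ ; _+_ = _+ω_ ; _*_ = _*ω_ ; -_ = λ x → -ω x ; 0# = ι 0ℚ ; 1# = ι 1ℚ
  ; isCommutativeRing = record
    { isRing = record
      { +-isAbelianGroup = record
        { isGroup = record
          { isMonoid = record
            { isSemigroup = record
              { isMagma = record { isEquivalence = ≡.isEquivalence ; ∙-cong = cong₂ _+ω_ }
              ; assoc = ℚω-+-assoc
              }
            ; identity = (λ x → cong₂ ⟨_,_⟩ (ℚ.+-identityˡ (re x)) (ℚ.+-identityˡ (im x)))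
                       , (λ x → cong₂ ⟨_,_⟩ (ℚ.+-identityʳ (re x)) (ℚ.+-identityʳ (im x)))
            }
          ; inverse = (λ x → cong₂ ⟨_,_⟩ (ℚ.+-inverseˡ (re x)) (ℚ.+-inverseˡ (im x)))
                    , (λ x → cong₂ ⟨_,_⟩ (ℚ.+-inverseʳ (re x)) (ℚ.+-inverseʳ (im x)))
          ; ⁻¹-cong = cong (λ x → -ω x)
          }
        ; comm = λ x y → cong₂ ⟨_,_⟩ (ℚ.+-comm (re x) (re y)) (ℚ.+-comm (im x) (im y))
        }
      ; *-cong = cong₂ _*ω_
      ; *-assoc = assoc
      ; *-identity = (λ x → trans (*-comm (ι 1ℚ) x) (identityʳ x)) , identityʳ
      ; distrib = distribˡ , (λ x y z → trans (*-comm (y +ω z) x) (trans (distribˡ x y z) (cong₂ _+ω_ (*-comm x y) (*-comm x z))))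
      }
    ; *-comm = *-comm
    }
  }
  where
  -- The ring laws hold with any constant in place of 3, so the solver treats it as a variable.
  t : ℚ
  t = fromℕ 3
  assoc : ∀ x y z → (x *ω y) *ω z ≡ x *ω (y *ω z)
  assoc x y z = cong₂ ⟨_,_⟩
    (solve 7 (λ t a b c d e f → (a :* c :- t :* b :* d) :* e :- t :* (a :* d :+ b :* c) :* f := a :* (c :* e :- t :* d :* f) :- t :* b :* (c :* f :+ d :* e)) refl t (re x) (im x) (re y) (im y) (re z) (im z))
    (solve 7 (λ t a b c d e f → (a :* c :- t :* b :* d) :* f :+ (a :* d :+ b :* c) :* e := a :* (c :* f :+ d :* e) :+ b :* (c :* e :- t :* d :* f)) refl t (re x) (im x) (re y) (im y) (re z) (im z))
  *-comm : ∀ x y → x *ω y ≡ y *ω x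
  *-comm x y = cong₂ ⟨_,_⟩
    (solve 5 (λ t a b c d → a :* c :- t :* b :* d := c :* a :- t :* d :* b) refl t (re x) (im x) (re y) (im y))
    (solve 5 (λ t a b c d → a :* d :+ b :* c := c :* b :+ d :* a) refl t (re x) (im x) (re y) (im y))
  identityʳ : ∀ x → x *ω ι 1ℚ ≡ x
  identityʳ x = cong₂ ⟨_,_⟩
    (solve 3 (λ t a b → a :* con (+ 1) :- t :* b :* con (+ 0) := a) refl t (re x) (im x))
    (solve 3 (λ t a b → a :* con (+ 0) :+ b :* con (+ 1) := b) refl t (re x) (im x))
  distribˡ : ∀ x y z → x *ω (y +ω z) ≡ x *ω y +ω x *ω z
  distribˡ x y z = cong₂ ⟨_,_⟩
    (solve 7 (λ t a b c d e f → a :* (c :+ e) :- t :* b :* (d :+ f) := (a :* c :- t :* b :* d) :+ (a :* e :- t :* b :* f)) refl t (re x) (im x) (re y) (im y) (re z) (im z))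
    (solve 7 (λ t a b c d e f → a :* (d :+ f) :+ b :* (c :+ e) := (a :* d :+ b :* c) :+ (a :* f :+ b :* e)) refl t (re x) (im x) (re y) (im y) (re z) (im z))

ι-* : ∀ a b → ι (a ℚ.* b) ≡ ι a *ω ι b
ι-* a b = cong₂ ⟨_,_⟩
  (solve 3 (λ t a b → a :* b := a :* b :- t :* con (+ 0) :* con (+ 0)) refl (fromℕ 3) a b)
  (solve 2 (λ a b → con (+ 0) := a :* con (+ 0) :+ con (+ 0) :* b) refl a b)

ι-^ : ∀ a n → ι (a ^ℚ n) ≡ ι a ^ω n
ι-^ a zero    = refl
ι-^ a (suc n) = trans (ι-* a (a ^ℚ n)) (cong (ι a *ω_) (ι-^ a n))

-- Unfolding the definitions of the polylogarithm and the Bernoulli numbers.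

partial£ : ℕ → ℚω → ℕ → ℚω
partial£ d x zero    = ι 0ℚ
partial£ d x (suc k) = partial£ d x k +ω ι ((+ 1 / suc k) ^ℚ d) *ω (x ^ω suc k)

-- The local functions of £ and bernoulliList cannot be named; unification fills them in here.
mutual
  £-go : ℕ → ℕ → ℚω → ℕ → ℚω
  £-go = _

  £≡partial£ : ∀ p d x → £ p d x ≡ partial£ d x (p ℕ.∸ 1)
  -- Once p ∸ 1 is abstracted to a variable, the equation that determines `£-go` is a pattern and
  -- unification can solve it.
  £≡partial£ p d x with p ℕ.∸ 1
  ... | n = £-go≡partial£ p d x n

  £-go≡partial£ : ∀ p d x n → £-go p d x n ≡ partial£ d x n
  £-go≡partial£ p d x zero    = refl
  £-go≡partial£ p d x (suc n) = cong (_+ω ι ((+ 1 / suc n) ^ℚ d) *ω (x ^ω suc n)) (£-go≡partial£ p d x n)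

sumBelow-cong : ∀ n {f g : ℕ → ℚ} → (∀ k → k ℕ.< n → f k ≡ g k) → sumBelow n f ≡ sumBelow n g
sumBelow-cong zero    eq = refl
sumBelow-cong (suc n) eq = cong₂ ℚ._+_ (sumBelow-cong n (λ k k<n → eq k (ℕ.m<n⇒m<1+n k<n))) (eq n (ℕ.n<1+n n))

nextBernoulli : ℕ → List ℚ → ℚ
nextBernoulli m bs = ℚ.- ((+ 1 / suc (suc m)) ℚ.* sumBelow (suc m) (λ k → fromℕ (suc (suc m) C k) ℚ.* nth bs k))

mutual
  bernoulliList-idx : ℕ → List ℚ → ℕ → ℚ
  bernoulliList-idx = _

  bernoulliList-suc : ∀ m → bernoulliList (suc m) ≡ bernoulliList m ++ (nextBernoulli m (bernoulliList m) ∷ [])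
  bernoulliList-suc m with bernoulliList m
  ... | bs = cong (λ z → bs ++ ((ℚ.- ((+ 1 / suc (suc m)) ℚ.* z)) ∷ []))
    (sumBelow-cong (suc m) (λ k _ → cong (fromℕ (suc (suc m) C k) ℚ.*_) (idx≡nth m bs k)))

  idx≡nth : ∀ m bs k → bernoulliList-idx m bs k ≡ nth bs k
  idx≡nth m []       k       = refl
  idx≡nth m (b ∷ bs) zero    = refl
  idx≡nth m (b ∷ bs) (suc k) = idx≡nth m bs k

nth-++ : ∀ xs ys k → k ℕ.< length xs → nth (xs ++ ys) k ≡ nth xs k
nth-++ (x ∷ xs) ys zero    _         = refl
nth-++ (x ∷ xs) ys (suc k) (s≤s k<n) = nth-++ xs ys k k<n

nth-last : ∀ xs y → nth (xs ++ (y ∷ [])) (length xs) ≡ y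
nth-last []       y = refl
nth-last (x ∷ xs) y = nth-last xs y

length-bernoulliList : ∀ m → length (bernoulliList m) ≡ suc m
length-bernoulliList zero    = refl
length-bernoulliList (suc m) = trans (cong length (bernoulliList-suc m))
  (trans (List.length-++ (bernoulliList m)) (trans (cong (ℕ._+ 1) (length-bernoulliList m)) (ℕ.+-comm (suc m) 1)))

-- Each list extends the previous one at its end, so an entry keeps its position and value.
nth-bernoulliList : ∀ m k → k ℕ.≤ m → nth (bernoulliList m) k ≡ bernoulli k
nth-bernoulliList m k k≤m with ℕ.m≤n⇒m<n∨m≡n k≤m
... | inj₂ refl = refl
nth-bernoulliList (suc m) k k≤m | inj₁ k<1+m = trans (cong (λ bs → nth bs k) (bernoulliList-suc m))
  (trans (nth-++ (bernoulliList m) _ k (subst (k ℕ.<_) (sym (length-bernoulliList m)) k<1+m)) (nth-bernoulliList m k (ℕ.≤-pred k<1+m)))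

bernoulliTerm : ℕ → ℕ → ℚ
bernoulliTerm n k = fromℕ (n C k) ℚ.* bernoulli k

bernoulli-suc : ∀ m → bernoulli (suc m) ≡ ℚ.- ((+ 1 / suc (suc m)) ℚ.* sumBelow (suc m) (bernoulliTerm (suc (suc m))))
bernoulli-suc m = trans (cong (λ bs → nth bs (suc m)) (bernoulliList-suc m))
  (trans (cong (nth (bernoulliList m ++ _)) (sym (length-bernoulliList m)))
  (trans (nth-last (bernoulliList m) _)
    (cong (λ z → ℚ.- ((+ 1 / suc (suc m)) ℚ.* z)) (sumBelow-cong (suc m) (λ k k<1+m → cong (fromℕ (suc (suc m) C k) ℚ.*_) (nth-bernoulliList m k (ℕ.≤-pred k<1+m)))))))

-- With n = m + 2, the last coefficient C(n, n - 1) = n cancels the 1/n in the definition of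
-- B_(n-1).
bernoulli-recursion : ∀ m → sumBelow (suc (suc m)) (bernoulliTerm (suc (suc m))) ≡ 0ℚ
bernoulli-recursion m = begin
  T ℚ.+ fromℕ (suc (suc m) C suc m) ℚ.* bernoulli (suc m)
    ≡⟨ cong₂ (λ a b → T ℚ.+ fromℕ a ℚ.* b) ([1+n]Cn≡1+n (suc m)) (bernoulli-suc m) ⟩
  T ℚ.+ N ℚ.* ℚ.- (v ℚ.* T)
    ≡⟨ solve 3 (λ T N v → T :+ N :* (:- (v :* T)) := T :- (v :* N) :* T) refl T N v ⟩
  T ℚ.- (v ℚ.* N) ℚ.* T
    ≡⟨ cong (λ z → T ℚ.- z ℚ.* T) (/-*-cancel (+ 1) (suc m)) ⟩
  T ℚ.- 1ℚ ℚ.* T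
    ≡⟨ solve 1 (λ T → T :- con (+ 1) :* T := con (+ 0)) refl T ⟩
  0ℚ ∎
  where
  open ≡.≡-Reasoning
  T N v : ℚ
  T = sumBelow (suc m) (bernoulliTerm (suc (suc m)))
  N = fromℕ (suc (suc m))
  v = + 1 / suc (suc m)

-- The ring ℤ₍ₚ₎[√-3].

module IntegralRationals (p : ℕ) (p-prime : Prime p) (3<p : 3 ℕ.< p) where

  ∤-* : ∀ {a b} → ¬ p ∣ a → ¬ p ∣ b → ¬ p ∣ a ℕ.* b
  ∤-* {a} {b} p∤a p∤b p∣ab with euclidsLemma a b p-prime p∣ab
  ... | inj₁ p∣a = p∤a p∣a
  ... | inj₂ p∣b = p∤b p∣b

  ∤-< : ∀ j → suc j ℕ.< p → ¬ p ∣ suc j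
  ∤-< j j<p p∣j = ℕ.<⇒≱ j<p (∣⇒≤ p∣j)

  p∤1 : ¬ p ∣ 1
  p∤1 = ∤-< 0 (ℕ.≤-trans (s≤s (s≤s z≤n)) 3<p)

  p∤2 : ¬ p ∣ 2
  p∤2 = ∤-< 1 (ℕ.≤-trans (s≤s (s≤s (s≤s z≤n))) 3<p)

  p∤3 : ¬ p ∣ 3
  p∤3 = ∤-< 2 3<p

  integral-/1 : ∀ z → Integral p (z / 1)
  integral-/1 z = fraction 1 z p∤1 (ℚ.*-identityʳ _)

  integral-1/ : ∀ k → ¬ p ∣ suc k → Integral p (+ 1 / suc k)
  integral-1/ k p∤k = fraction (suc k) (+ 1) p∤k (/-*-cancel (+ 1) k)

  integral-+ : ∀ {r s} → Integral p r → Integral p s → Integral p (r ℚ.+ s)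
  integral-+ {r} {s} (fraction d n p∤d rd) (fraction e k p∤e se) = fraction (d ℕ.* e) (n ℤ.* + e ℤ.+ k ℤ.* + d) (∤-* p∤d p∤e) (begin
    (r ℚ.+ s) ℚ.* (+ (d ℕ.* e) / 1)
      ≡⟨ cong ((r ℚ.+ s) ℚ.*_) (trans (cong (_/ 1) (ℤ.pos-* d e)) (/1-* (+ d) (+ e))) ⟩
    (r ℚ.+ s) ℚ.* (D ℚ.* E)
      ≡⟨ solve 4 (λ r s D E → (r :+ s) :* (D :* E) := (r :* D) :* E :+ (s :* E) :* D) refl r s D E ⟩
    (r ℚ.* D) ℚ.* E ℚ.+ (s ℚ.* E) ℚ.* D
      ≡⟨ cong₂ (λ a b → a ℚ.* E ℚ.+ b ℚ.* D) rd se ⟩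
    (n / 1) ℚ.* E ℚ.+ (k / 1) ℚ.* D
      ≡⟨ cong₂ ℚ._+_ (/1-* n (+ e)) (/1-* k (+ d)) ⟨
    (n ℤ.* + e) / 1 ℚ.+ (k ℤ.* + d) / 1
      ≡⟨ /1-+ (n ℤ.* + e) (k ℤ.* + d) ⟨
    (n ℤ.* + e ℤ.+ k ℤ.* + d) / 1 ∎)
    where
    open ≡.≡-Reasoning
    D E : ℚ
    D = + d / 1
    E = + e / 1

  integral-* : ∀ {r s} → Integral p r → Integral p s → Integral p (r ℚ.* s)
  integral-* {r} {s} (fraction d n p∤d rd) (fraction e k p∤e se) = fraction (d ℕ.* e) (n ℤ.* k) (∤-* p∤d p∤e) (begin
    (r ℚ.* s) ℚ.* (+ (d ℕ.* e) / 1)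
      ≡⟨ cong ((r ℚ.* s) ℚ.*_) (trans (cong (_/ 1) (ℤ.pos-* d e)) (/1-* (+ d) (+ e))) ⟩
    (r ℚ.* s) ℚ.* ((+ d / 1) ℚ.* (+ e / 1))
      ≡⟨ solve 4 (λ r s D E → (r :* s) :* (D :* E) := (r :* D) :* (s :* E)) refl r s (+ d / 1) (+ e / 1) ⟩
    (r ℚ.* (+ d / 1)) ℚ.* (s ℚ.* (+ e / 1))
      ≡⟨ cong₂ ℚ._*_ rd se ⟩
    (n / 1) ℚ.* (k / 1)
      ≡⟨ /1-* n k ⟨
    (n ℤ.* k) / 1 ∎)
    where open ≡.≡-Reasoning

  integral-neg : ∀ {r} → Integral p r → Integral p (ℚ.- r)
  integral-neg {r} (fraction d n p∤d rd) = fraction d (ℤ.- n) p∤d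
    (trans (sym (ℚ.neg-distribˡ-* r (+ d / 1))) (trans (cong ℚ.-_ rd) (sym (/1-neg n))))

  integral-sumBelow : ∀ n f → (∀ k → k ℕ.< n → Integral p (f k)) → Integral p (sumBelow n f)
  integral-sumBelow zero    f h = integral-/1 (+ 0)
  integral-sumBelow (suc n) f h = integral-+ (integral-sumBelow n f (λ k k<n → h k (ℕ.m<n⇒m<1+n k<n))) (h n (ℕ.n<1+n n))

  -- The recursion for B_n divides by n + 1, which is prime to p while it stays below p. The bound
  -- is sharp, as B_(p-1) has p in its denominator.
  integral-bernoulli : ∀ n → suc n ℕ.< p → Integral p (bernoulli n)
  integral-bernoulli = <-rec _ go
    where
    go : ∀ n → (∀ {k} → k ℕ.< n → suc k ℕ.< p → Integral p (bernoulli k)) → suc n ℕ.< p → Integral p (bernoulli n)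
    go zero    ih _   = integral-/1 (+ 1)
    go (suc n) ih n<p = subst (Integral p) (sym (bernoulli-suc n)) (integral-neg (integral-* (integral-1/ (suc n) (∤-< (suc n) n<p))
      (integral-sumBelow (suc n) _ (λ k k<n → integral-* (integral-/1 (+ (suc (suc n) C k))) (ih k<n (ℕ.<-trans (s≤s k<n) n<p))))))

  -- Coordinates refer to 1 and √-3 instead of 1 and ω₆; the ring is the same because 2 is a unit at
  -- p.
  record ℤₚ[√-3] : Set where
    constructor element
    field
      value       : ℚω
      integral-re : Integral p (re value)
      integral-im : Integral p (im value)
  open ℤₚ[√-3] public

  infixl 6 _⊕_
  infixl 7 _⊛_

  -- Opaque, so that type checking never unfolds rational arithmetic.
  abstract

    _⊕_ : ℤₚ[√-3] → ℤₚ[√-3] → ℤₚ[√-3]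
    x ⊕ y = element (value x +ω value y) (integral-+ (integral-re x) (integral-re y)) (integral-+ (integral-im x) (integral-im y))

    _⊛_ : ℤₚ[√-3] → ℤₚ[√-3] → ℤₚ[√-3]
    x ⊛ y = element (value x *ω value y)
      (integral-+ (integral-* (integral-re x) (integral-re y)) (integral-neg (integral-* (integral-* (integral-/1 (+ 3)) (integral-im x)) (integral-im y))))
      (integral-+ (integral-* (integral-re x) (integral-im y)) (integral-* (integral-im x) (integral-re y)))

    ⊝_ : ℤₚ[√-3] → ℤₚ[√-3]
    ⊝ x = element (-ω value x) (integral-neg (integral-re x)) (integral-neg (integral-im x))

    value-⊕ : ∀ x y → value (x ⊕ y) ≡ value x +ω value y
    value-⊕ x y = refl

    value-⊛ : ∀ x y → value (x ⊛ y) ≡ value x *ω value y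
    value-⊛ x y = refl

    value-⊝ : ∀ x → value (⊝ x) ≡ -ω value x
    value-⊝ x = refl

  rational : ∀ r → Integral p r → ℤₚ[√-3]
  rational r r-int = element (ι r) r-int (integral-/1 (+ 0))

  0ₚ 1ₚ : ℤₚ[√-3]
  0ₚ = rational 0ℚ (integral-/1 (+ 0))
  1ₚ = rational 1ℚ (integral-/1 (+ 1))

  abstract

    -- Equality compares values only, so integrality evidence never has to be matched.
    isCommutativeRing : IsCommutativeRing (λ x y → value x ≡ value y) _⊕_ _⊛_ ⊝_ 0ₚ 1ₚ
    isCommutativeRing = record
      { isRing = record
        { +-isAbelianGroup = record
          { isGroup = record
            { isMonoid = record
              { isSemigroup = record
                { isMagma = record { isEquivalence = record { refl = refl ; sym = sym ; trans = trans } ; ∙-cong = cong₂ _+ω_ }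
                ; assoc = λ x y z → K.+-assoc (value x) (value y) (value z)
                }
              ; identity = (λ x → K.+-identityˡ (value x)) , (λ x → K.+-identityʳ (value x))
              }
            ; inverse = (λ x → K.-‿inverseˡ (value x)) , (λ x → K.-‿inverseʳ (value x))
            ; ⁻¹-cong = cong (λ x → -ω x)
            }
          ; comm = λ x y → K.+-comm (value x) (value y)
          }
        ; *-cong = cong₂ _*ω_
        ; *-assoc = λ x y z → K.*-assoc (value x) (value y) (value z)
        ; *-identity = (λ x → K.*-identityˡ (value x)) , (λ x → K.*-identityʳ (value x))
        ; distrib = (λ x y z → K.distribˡ (value x) (value y) (value z)) , (λ x y z → K.distribʳ (value x) (value y) (value z))
        }
      ; *-comm = λ x y → K.*-comm (value x) (value y)
      }
      where module K = CommutativeRing ℚω-ring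

  ℤₚ[√-3]-ring : CommutativeRing 0ℓ 0ℓ
  ℤₚ[√-3]-ring = record { isCommutativeRing = isCommutativeRing }

-- Residues of p modulo 2 and 3, and the Legendre symbol.

prime-%≢0 : ∀ {p} k → Prime p → suc (suc k) ℕ.< p → p ℕ.% suc (suc k) ≢ 0
prime-%≢0 {p} k p-prime k<p eq with prime⇒irreducible p-prime (m%n≡0⇒n∣m p (suc (suc k)) eq)
... | inj₂ refl = ℕ.<-irrefl refl k<p

prime-%2 : ∀ {p} → Prime p → 3 ℕ.< p → p ≡ suc (p ℕ./ 2 ℕ.* 2)
prime-%2 {p} p-prime 3<p with p ℕ.% 2 | prime-%≢0 0 p-prime (ℕ.<-trans (s≤s (s≤s (s≤s z≤n))) 3<p) | ℕ.m%n<n p 2 | ℕ.m≡m%n+[m/n]*n p 2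
... | zero        | ≢0 | _ | _  = ⊥-elim (≢0 refl)
... | suc zero    | _  | _ | eq = eq
... | suc (suc _) | _  | s≤s (s≤s ()) | _

prime-%3 : ∀ {p} → Prime p → 3 ℕ.< p → (p ℕ.% 3 ≡ 1 × p ≡ suc (p ℕ./ 3 ℕ.* 3)) ⊎ (p ℕ.% 3 ≡ 2 × p ≡ suc (suc (p ℕ./ 3 ℕ.* 3)))
prime-%3 {p} p-prime 3<p with p ℕ.% 3 | prime-%≢0 1 p-prime 3<p | ℕ.m%n<n p 3 | ℕ.m≡m%n+[m/n]*n p 3
... | zero              | ≢0 | _ | _  = ⊥-elim (≢0 refl)
... | suc zero          | _  | _ | eq = inj₁ (refl , eq)
... | suc (suc zero)    | _  | _ | eq = inj₂ (refl , eq)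
... | suc (suc (suc _)) | _  | s≤s (s≤s (s≤s ())) | _

-- The nonzero branch of `legendre a 3` as a function of the residue, so that it evaluates at the
-- literals 1 and 2.
residueSymbol : ℕ → ℚ
residueSymbol r = if any (λ x → ⌊ (x ℕ.* x) ℕ.% 3 ℕ.≟ r ⌋) (upTo 3) then 1ℚ else ℚ.- 1ℚ

legendre-3 : ∀ a r → a ℕ.% 3 ≡ suc r → legendre a 3 ≡ residueSymbol (suc r)
legendre-3 a r eq with a ℕ.% 3 ℕ.≟ 0
... | yes ≡0 = ⊥-elim (ℕ.0≢1+n (trans (sym ≡0) eq))
... | no  _  = cong residueSymbol eq

-- Specialisation to ℤ₍ₚ₎[√-3] and translation to the stated congruences.

module Main (d : ℕ) (p-prime : Prime (suc (suc (suc (suc d))))) where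

  p m : ℕ
  m = suc (suc (suc d))
  p = suc m

  3<p : 3 ℕ.< p
  3<p = s≤s (s≤s (s≤s (s≤s z≤n)))

  open IntegralRationals p p-prime 3<p
  open RingSums ℤₚ[√-3]-ring hiding (solve; _:=_; _:+_; _:*_; _:-_; :-_; con)
  private
    module K = RingSums ℚω-ring
    module A = Lifted ℤₚ[√-3]-ring d
  open Quotient ℤₚ[√-3]-ring (nat p)

  value-nat : ∀ n → value (nat n) ≡ ι (fromℕ n)
  value-nat zero          = refl
  value-nat (suc zero)    = refl
  value-nat (suc (suc n)) = trans (value-⊕ (nat (suc n)) 1#) (trans (cong (_+ω ι 1ℚ) (value-nat (suc n)))
    (cong ι (trans (sym (/1-+ (+ suc n) (+ 1))) (cong (λ k → + k / 1) (ℕ.+-comm (suc n) 1)))))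

  value-^ : ∀ x n → value (x ^ n) ≡ value x ^ω n
  value-^ x zero    = refl
  value-^ x (suc n) = trans (value-⊛ x (x ^ n)) (cong (value x *ω_) (value-^ x n))

  value-Σ< : ∀ n F f → (∀ k → k ℕ.< n → value (F k) ≡ ι (f k)) → value (Σ< n F) ≡ ι (sumBelow n f)
  value-Σ< zero    F f eq = refl
  value-Σ< (suc n) F f eq = trans (value-⊕ (Σ< n F) (F n)) (cong₂ _+ω_ (value-Σ< n F f (λ k k<n → eq k (ℕ.m<n⇒m<1+n k<n))) (eq n (ℕ.n<1+n n)))

  -- At j = m the number j + 1 is p itself; from there on 0 is a default value.
  inv : ℕ → ℤₚ[√-3]
  inv j with j ℕ.<? m
  ... | yes j<m = rational (+ 1 / suc j) (integral-1/ j (∤-< j (s≤s j<m)))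
  ... | no  _   = 0#

  value-inv : ∀ j → j ℕ.< m → value (inv j) ≡ ι (+ 1 / suc j)
  value-inv j j<m with j ℕ.<? m
  ... | yes _   = refl
  ... | no  j≮m = ⊥-elim (j≮m j<m)

  ι-unit : ∀ k → ι (fromℕ (suc k)) *ω ι (+ 1 / suc k) ≡ ι 1ℚ
  ι-unit k = trans (sym (ι-* (fromℕ (suc k)) (+ 1 / suc k))) (cong ι (trans (ℚ.*-comm (fromℕ (suc k)) (+ 1 / suc k)) (/-*-cancel (+ 1) k)))

  inv-spec : ∀ j → j ℕ.< m → nat (suc j) * inv j ≈ 1#
  inv-spec j j<m = trans (value-⊛ (nat (suc j)) (inv j)) (trans (cong₂ _*ω_ (value-nat (suc j)) (value-inv j j<m)) (ι-unit j))

  unit : ∀ k (k∤ : ¬ p ∣ suc k) → nat (suc k) * rational (+ 1 / suc k) (integral-1/ k k∤) ≈ 1#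
  unit k k∤ = trans (value-⊛ (nat (suc k)) (rational (+ 1 / suc k) (integral-1/ k k∤))) (trans (cong (_*ω ι (+ 1 / suc k)) (value-nat (suc k))) (ι-unit k))

  1/p : ℚω
  1/p = ι (+ 1 / p)

  1/p-cancel : ∀ x → 1/p *ω (value (nat p) *ω x) ≡ x
  1/p-cancel x = trans (sym (K.*-assoc 1/p (value (nat p)) x)) (trans (cong (_*ω x) (trans (K.*-comm 1/p (value (nat p))) (trans (cong (_*ω 1/p) (value-nat p)) (ι-unit m)))) (K.*-identityˡ x))

  -- 1/p exists in the field, though not in the ring.
  p-cancel : ∀ {a b} → nat p * a ≈ nat p * b → a ≈ b
  p-cancel {a} {b} eq = trans (sym (1/p-cancel (value a))) (trans (cong (1/p *ω_) (trans (sym (value-⊛ (nat p) a)) (trans eq (value-⊛ (nat p) b)))) (1/p-cancel (value b)))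

  -- The stored quotient has value (x - y)/p. Its coordinates in the basis 1, ω₆ are re - im and 2
  -- im, integral since re and im are.
  ≋⇒≡[mod] : ∀ {x y X Y} → value x ≡ X → value y ≡ Y → x ≋ y → X ≡ Y [mod p ]
  ≋⇒≡[mod] {x} {y} refl refl (modulo z eq) = subst (pIntegral p) (sym quotient)
    ( Integral⇒ℚ-pIntegral (integral-+ (integral-re z) (integral-neg (integral-im z)))
    , Integral⇒ℚ-pIntegral (integral-* (integral-/1 (+ 2)) (integral-im z)))
    where
    quotient : 1/p *ω (value x -ω value y) ≡ value z
    quotient = trans (cong (1/p *ω_) (trans (cong (_-ω value y) (trans eq (trans (value-⊕ y (nat p * z)) (cong (value y +ω_) (value-⊛ (nat p) z)))))
      (K.solve 2 (λ a b → (a K.:+ b) K.:- a K.:= b) refl (value y) (value (nat p) *ω value z)))) (1/p-cancel (value z))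

  odd : (- 1#) ^ p ≈ - 1#
  odd = -1^odd (p ℕ./ 2) (prime-%2 p-prime 3<p)

  -- The cut is at p - 1, where the Bernoulli number ceases to be p-integral; from there on 0 is a
  -- default value.
  b : ℕ → ℤₚ[√-3]
  b k with k ℕ.<? m
  ... | yes k<m = rational (bernoulli k) (integral-bernoulli k (s≤s k<m))
  ... | no  _   = 0#

  value-b : ∀ k → k ℕ.< m → value (b k) ≡ ι (bernoulli k)
  value-b k k<m with k ℕ.<? m
  ... | yes _   = refl
  ... | no  k≮m = ⊥-elim (k≮m k<m)

  value-bernoulliTerm : ∀ n k → k ℕ.< m → value (nat (n C k) * b k) ≡ ι (bernoulliTerm n k)
  value-bernoulliTerm n k k<m = trans (value-⊛ (nat (n C k)) (b k)) (trans (cong₂ _*ω_ (value-nat (n C k)) (value-b k k<m)) (sym (ι-* (fromℕ (n C k)) (bernoulli k))))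

  b-rec : ∀ n → 2 ℕ.≤ n → n ℕ.≤ m → Σ< n (λ k → nat (n C k) * b k) ≈ 0#
  b-rec (suc zero) (s≤s ()) _
  b-rec n@(suc (suc i)) _ n≤m = trans (value-Σ< n _ (bernoulliTerm n) (λ k k<n → value-bernoulliTerm n k (ℕ.<-≤-trans k<n n≤m))) (cong ι (bernoulli-recursion i))

  fermat-3 : nat 3 ^ m ≋ 1#
  fermat-3 = A.fermat-3 inv inv-spec

  q₃ : ℤₚ[√-3]
  q₃ = _≋_.quotient fermat-3

  fromℕ-^ : ∀ a n → fromℕ a ^ℚ n ≡ fromℕ (a ℕ.^ n)
  fromℕ-^ a zero    = refl
  fromℕ-^ a (suc n) = trans (cong (fromℕ a ℚ.*_) (fromℕ-^ a n)) (trans (sym (/1-* (+ a) (+ (a ℕ.^ n)))) (cong (_/ 1) (sym (ℤ.pos-* a (a ℕ.^ n)))))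

  -- Multiplied by p, both sides become 3^(p-1) - 1, and p cancels in the field.
  value-q₃ : value q₃ ≡ ι (fermatQuotient p 3)
  value-q₃ = trans (sym (1/p-cancel (value q₃))) (trans (cong (1/p *ω_) scaled) (1/p-cancel (ι (fermatQuotient p 3))))
    where
    T : ℚω
    T = value (nat p) *ω value q₃
    power : ι (fromℕ (3 ℕ.^ m)) ≡ ι 1ℚ +ω T
    power = trans (cong ι (sym (fromℕ-^ 3 m))) (trans (ι-^ (fromℕ 3) m) (trans (cong (_^ω m) (sym (value-nat 3))) (trans (sym (value-^ (nat 3) m)) (trans (_≋_.difference fermat-3) (trans (value-⊕ 1# (nat p * q₃)) (cong (ι 1ℚ +ω_) (value-⊛ (nat p) q₃)))))))
    scaled : T ≡ value (nat p) *ω ι (fermatQuotient p 3)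
    scaled = ≡.trans (K.solve 2 (λ a b → b K.:= (a K.:+ b) K.:- a) refl (ι 1ℚ) T) (≡.trans (cong (_-ω ι 1ℚ) (sym power))
      (≡.trans (cong ι (trans (cong (fromℕ (3 ℕ.^ m) ℚ.+_) (sym (/1-neg (+ 1)))) (sym (/1-+ (+ (3 ℕ.^ m)) (ℤ.- + 1)))))
      (≡.trans (cong ι (sym (/-*-cancel (+ (3 ℕ.^ m) ℤ.- + 1) m)))
      (≡.trans (ι-* (fermatQuotient p 3) (fromℕ p)) (≡.trans (K.*-comm (ι (fermatQuotient p 3)) (ι (fromℕ p))) (cong (_*ω ι (fermatQuotient p 3)) (sym (value-nat p))))))))

  residue : ∃ λ Λ → ((∃ λ a → p ≡ suc (a ℕ.* 3) × Λ ≡ 1#) ⊎ (∃ λ a → p ≡ suc (suc (a ℕ.* 3)) × Λ ≡ - 1#)) × value Λ ≡ ι (legendre p 3)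
  residue = case (prime-%3 p-prime 3<p)
    where
    case : (p ℕ.% 3 ≡ 1 × p ≡ suc (p ℕ./ 3 ℕ.* 3)) ⊎ (p ℕ.% 3 ≡ 2 × p ≡ suc (suc (p ℕ./ 3 ℕ.* 3))) →
      ∃ λ Λ → ((∃ λ a → p ≡ suc (a ℕ.* 3) × Λ ≡ 1#) ⊎ (∃ λ a → p ≡ suc (suc (a ℕ.* 3)) × Λ ≡ - 1#)) × value Λ ≡ ι (legendre p 3)
    case (inj₁ (r , eq)) = 1# , inj₁ (p ℕ./ 3 , eq , refl) , cong ι (sym (legendre-3 p 0 r))
    case (inj₂ (r , eq)) = - 1# , inj₂ (p ℕ./ 3 , eq , refl) , trans (value-⊝ 1#) (cong ι (sym (legendre-3 p 1 r)))

  Λ : ℤₚ[√-3]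
  Λ = proj₁ residue

  value-Λ : value Λ ≡ ι (legendre p 3)
  value-Λ = proj₂ (proj₂ residue)

  value-polylog₂ : ∀ x → value (A.polylog₂ inv inv-spec x) ≡ £ p 2 (value x)
  value-polylog₂ x = trans (go m ℕ.≤-refl) (sym (£≡partial£ p 2 (value x)))
    where
    go : ∀ n → n ℕ.≤ m → value (Σ< n (λ j → (inv j * inv j) * x ^ suc j)) ≡ partial£ 2 (value x) n
    go zero    _   = refl
    go (suc n) n<m = trans (value-⊕ (Σ< n (λ j → (inv j * inv j) * x ^ suc j)) ((inv n * inv n) * x ^ suc n)) (cong₂ _+ω_ (go n (ℕ.<⇒≤ n<m))
      (trans (value-⊛ (inv n * inv n) (x ^ suc n)) (cong₂ _*ω_
        (trans (value-⊛ (inv n) (inv n)) (trans (cong₂ _*ω_ (value-inv n n<m) (value-inv n n<m)) (trans (sym (ι-* (+ 1 / suc n) (+ 1 / suc n)))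
          (cong (λ z → ι ((+ 1 / suc n) ℚ.* z)) (sym (ℚ.*-identityʳ (+ 1 / suc n)))))))
        (value-^ x (suc n)))))

  value-bernoulliSum : ∀ t r → value t ≡ ι r → value (Σ< m (λ k → nat (suc (suc d) C k) * b k * t ^ (suc (suc d) ℕ.∸ k))) ≡ ι (bernoulliPoly (suc (suc d)) r)
  value-bernoulliSum t r t≡r = value-Σ< m (λ k → nat (suc (suc d) C k) * b k * t ^ (suc (suc d) ℕ.∸ k)) (λ k → fromℕ (suc (suc d) C k) ℚ.* bernoulli k ℚ.* (r ^ℚ (suc (suc d) ℕ.∸ k))) (λ k k<m →
    trans (value-⊛ (nat (suc (suc d) C k) * b k) (t ^ (suc (suc d) ℕ.∸ k)))
    (trans (cong₂ _*ω_ (value-bernoulliTerm (suc (suc d)) k k<m)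
      (trans (value-^ t (suc (suc d) ℕ.∸ k)) (trans (cong (_^ω (suc (suc d) ℕ.∸ k)) t≡r) (sym (ι-^ r (suc (suc d) ℕ.∸ k))))))
    (sym (ι-* (bernoulliTerm (suc (suc d)) k) (r ^ℚ (suc (suc d) ℕ.∸ k))))))

  half : Integral p (+ 1 / 2)
  half = integral-1/ 1 p∤2

  ω : Sign → ℤₚ[√-3]
  ω Sign.+ = element (ω₆^ Sign.+) half half
  ω Sign.- = element (ω₆^ Sign.-) half (integral-neg half)

  value-ω : ∀ s → value (ω s) ≡ ω₆^ s
  value-ω Sign.+ = refl
  value-ω Sign.- = refl

  ω² : ∀ s → ω s * ω s ≈ ω s - 1#
  ω² s = trans (value-⊛ (ω s) (ω s)) (trans (ground s) (sym (trans (value-⊕ (ω s) (- 1#)) (cong (value (ω s) +ω_) (value-⊝ 1#)))))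
    where
    -- Once the sign is known this is closed rational arithmetic, settled by evaluation.
    ground : ∀ s → value (ω s) *ω value (ω s) ≡ value (ω s) +ω (-ω ι 1ℚ)
    ground Sign.+ = refl
    ground Sign.- = refl

  I : Sign → ℤₚ[√-3]
  I Sign.+ = element (ι (sgn Sign.+) *ω i√3) (integral-/1 (+ 0)) (integral-/1 (+ 1))
  I Sign.- = element (ι (sgn Sign.-) *ω i√3) (integral-/1 (+ 0)) (integral-/1 -[1+ 0 ])

  value-I : ∀ s → value (I s) ≡ ι (sgn s) *ω i√3
  value-I Sign.+ = refl
  value-I Sign.- = refl

  value-2ω-1 : ∀ s → value (nat 2 * ω s - 1#) ≡ ι (fromℕ 2) *ω value (ω s) +ω (-ω ι 1ℚ)
  value-2ω-1 s = trans (value-⊕ (nat 2 * ω s) (- 1#)) (cong₂ _+ω_ (trans (value-⊛ (nat 2) (ω s)) (cong (_*ω value (ω s)) (value-nat 2))) (value-⊝ 1#))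

  I≈ : ∀ s → I s ≈ nat 2 * ω s - 1#
  I≈ s = trans (ground s) (sym (value-2ω-1 s))
    where
    ground : ∀ s → value (I s) ≡ ι (fromℕ 2) *ω value (ω s) +ω (-ω ι 1ℚ)
    ground Sign.+ = refl
    ground Sign.- = refl

  -- Conjugation: the second congruence is derived from the root of opposite sign, whose square root
  -- of -3 is - I s.
  -I≈ : ∀ s → - I s ≈ nat 2 * ω (Sign.opposite s) - 1#
  -I≈ s = trans (value-⊝ (I s)) (trans (ground s) (sym (value-2ω-1 (Sign.opposite s))))
    where
    ground : ∀ s → -ω value (I s) ≡ ι (fromℕ 2) *ω value (ω (Sign.opposite s)) +ω (-ω ι 1ℚ)
    ground Sign.+ = refl
    ground Sign.- = refl

  p∤8 : ¬ p ∣ 8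
  p∤8 = ∤-* (∤-* p∤2 p∤2) p∤2

  p∤16 : ¬ p ∣ 16
  p∤16 = ∤-* p∤8 p∤2

  p∤36 : ¬ p ∣ 36
  p∤36 = ∤-* (∤-* p∤2 p∤2) (∤-* p∤3 p∤3)

  reciprocal : ∀ k → ¬ p ∣ suc k → ℤₚ[√-3]
  reciprocal k p∤k = rational (+ 1 / suc k) (integral-1/ k p∤k)

  s₃ s₈ s₁₆ s₃₆ : ℤₚ[√-3]
  s₃  = reciprocal 2 p∤3
  s₈  = reciprocal 7 p∤8
  s₁₆ = reciprocal 15 p∤16
  s₃₆ = reciprocal 35 p∤36

  value-1+ω : ∀ s → value (1# + ω s) ≡ ι (+ 1 / 1) +ω ω₆^ s
  value-1+ω s = trans (value-⊕ 1# (ω s)) (cong (ι 1ℚ +ω_) (value-ω s))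

  z : Sign → ℤₚ[√-3]
  z s = s₃ * (1# + ω s)

  value-z : ∀ s → value (z s) ≡ ι (+ 1 / 3) *ω (ι (+ 1 / 1) +ω ω₆^ s)
  value-z s = trans (value-⊛ s₃ (1# + ω s)) (cong (ι (+ 1 / 3) *ω_) (value-1+ω s))

  -- (1 + ω)(1 + 1/ω) = 2 + (ω + 1/ω) = 3.
  z-inverse : ∀ s → z s * (1# + ω (Sign.opposite s)) ≈ 1#
  z-inverse s = trans (value-⊛ (z s) (1# + ω (Sign.opposite s))) (trans (cong₂ _*ω_ (value-z s) (value-1+ω (Sign.opposite s))) (ground s))
    where
    ground : ∀ s → (ι (+ 1 / 3) *ω (ι (+ 1 / 1) +ω ω₆^ s)) *ω (ι (+ 1 / 1) +ω ω₆^ (Sign.opposite s)) ≡ ι 1ℚ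
    ground Sign.+ = refl
    ground Sign.- = refl

  B₁/₃ : ℤₚ[√-3]
  B₁/₃ = Σ< m (λ k → nat (suc (suc d) C k) * b k * s₃ ^ (suc (suc d) ℕ.∸ k))

  value-q₃² : ∀ k (p∤k : ¬ p ∣ suc k) → value (q₃ * q₃ * reciprocal k p∤k) ≡ ι ((fermatQuotient p 3 ^ℚ 2) ℚ.* (+ 1 / suc k))
  value-q₃² k p∤k = trans (value-⊛ (q₃ * q₃) (reciprocal k p∤k)) (trans (cong (_*ω ι (+ 1 / suc k))
    (trans (value-⊛ q₃ q₃) (trans (cong₂ _*ω_ value-q₃ value-q₃) (trans (sym (ι-* (fermatQuotient p 3) (fermatQuotient p 3)))
      (cong (λ x → ι (fermatQuotient p 3 ℚ.* x)) (sym (ℚ.*-identityʳ (fermatQuotient p 3))))))))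
    (sym (ι-* (fermatQuotient p 3 ^ℚ 2) (+ 1 / suc k))))

  value-B₁/₃ : value B₁/₃ ≡ ι (bernoulliPoly (p ℕ.∸ 2) (+ 1 / 3))
  value-B₁/₃ = value-bernoulliSum s₃ (+ 1 / 3) refl

  polylog₂ : ℤₚ[√-3] → ℤₚ[√-3]
  polylog₂ = A.polylog₂ inv inv-spec

  congruence₁ : ∀ s → polylog₂ (1# + ω s) ≋ - (q₃ * q₃ * s₁₆ * (nat 3 + I s * Λ)) + s₃₆ * (nat 3 * Λ - I s) * B₁/₃
  congruence₁ s = A.polylog₂-1+ω inv inv-spec p-cancel odd Λ (proj₁ (proj₂ residue)) q₃ (_≋_.difference fermat-3) b (value-b 0 (s≤s z≤n)) b-rec
    (ω s) (ω² s) s₃ (unit 2 p∤3) s₈ s₁₆ s₃₆ (unit 7 p∤8) (unit 15 p∤16) (unit 35 p∤36) (I s) (I≈ s)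

  -- As `z s` is inverse to 1 + ω for the opposite sign, the inverse case is applied to that root
  -- with - I s in place of I; this is how Λ - I becomes Λ + I s.
  congruence₂ : ∀ s → polylog₂ (z s) ≋ - (q₃ * q₃ * s₈) + s₃₆ * (Λ - - I s) * B₁/₃
  congruence₂ s = A.polylog₂-inverse inv inv-spec p-cancel odd Λ (proj₁ (proj₂ residue)) q₃ (_≋_.difference fermat-3) b (value-b 0 (s≤s z≤n)) b-rec
    (ω (Sign.opposite s)) (ω² (Sign.opposite s)) s₃ (unit 2 p∤3) s₈ s₁₆ s₃₆ (unit 7 p∤8) (unit 15 p∤16) (unit 35 p∤36) (- I s) (-I≈ s) (z s) (z-inverse s)

  value-rhs₁ : ∀ s → value (- (q₃ * q₃ * s₁₆ * (nat 3 + I s * Λ)) + s₃₆ * (nat 3 * Λ - I s) * B₁/₃) ≡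
    (-ω (ι ((fermatQuotient p 3 ^ℚ 2) ℚ.* (+ 1 / 16)) *ω (ι (+ 3 / 1) +ω ι (sgn s) *ω i√3 *ω ι (legendre p 3))))
      +ω ι (+ 1 / 36) *ω (ι (+ 3 / 1) *ω ι (legendre p 3) -ω ι (sgn s) *ω i√3) *ω ι (bernoulliPoly (p ℕ.∸ 2) (+ 1 / 3))
  value-rhs₁ s = trans (value-⊕ (- (q₃ * q₃ * s₁₆ * (nat 3 + I s * Λ))) (s₃₆ * (nat 3 * Λ - I s) * B₁/₃)) (cong₂ _+ω_
    (trans (value-⊝ (q₃ * q₃ * s₁₆ * (nat 3 + I s * Λ))) (cong (λ x → -ω x) (trans (value-⊛ (q₃ * q₃ * s₁₆) (nat 3 + I s * Λ)) (cong₂ _*ω_ (value-q₃² 15 p∤16)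
      (trans (value-⊕ (nat 3) (I s * Λ)) (cong₂ _+ω_ (value-nat 3) (trans (value-⊛ (I s) Λ) (cong₂ _*ω_ (value-I s) value-Λ))))))))
    (trans (value-⊛ (s₃₆ * (nat 3 * Λ - I s)) B₁/₃) (cong₂ _*ω_ (trans (value-⊛ s₃₆ (nat 3 * Λ - I s)) (cong (ι (+ 1 / 36) *ω_)
      (trans (value-⊕ (nat 3 * Λ) (- I s)) (cong₂ _+ω_ (trans (value-⊛ (nat 3) Λ) (cong₂ _*ω_ (value-nat 3) value-Λ)) (trans (value-⊝ (I s)) (cong (λ x → -ω x) (value-I s))))))) value-B₁/₃)))

  value-rhs₂ : ∀ s → value (- (q₃ * q₃ * s₈) + s₃₆ * (Λ - - I s) * B₁/₃) ≡
    (-ω ι ((fermatQuotient p 3 ^ℚ 2) ℚ.* (+ 1 / 8)))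
      +ω ι (+ 1 / 36) *ω (ι (legendre p 3) +ω ι (sgn s) *ω i√3) *ω ι (bernoulliPoly (p ℕ.∸ 2) (+ 1 / 3))
  value-rhs₂ s = trans (value-⊕ (- (q₃ * q₃ * s₈)) (s₃₆ * (Λ - - I s) * B₁/₃)) (cong₂ _+ω_
    (trans (value-⊝ (q₃ * q₃ * s₈)) (cong (λ x → -ω x) (value-q₃² 7 p∤8)))
    (trans (value-⊛ (s₃₆ * (Λ - - I s)) B₁/₃) (cong₂ _*ω_ (trans (value-⊛ s₃₆ (Λ - - I s)) (cong (ι (+ 1 / 36) *ω_)
      (trans (value-⊕ Λ (- - I s)) (cong₂ _+ω_ value-Λ (trans (value-⊝ (- I s)) (trans (cong (λ x → -ω x) (trans (value-⊝ (I s)) (cong (λ x → -ω x) (value-I s)))) (K.solve 1 (λ x → K.:- (K.:- x) K.:= x) refl (ι (sgn s) *ω i√3)))))))) value-B₁/₃)))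

  theorem : (s : Sign) →
    (£ p 2 (ι (+ 1 / 1) +ω ω₆^ s)
      ≡ (-ω (ι ((fermatQuotient p 3 ^ℚ 2) ℚ.* (+ 1 / 16)) *ω (ι (+ 3 / 1) +ω ι (sgn s) *ω i√3 *ω ι (legendre p 3))))
        +ω ι (+ 1 / 36) *ω (ι (+ 3 / 1) *ω ι (legendre p 3) -ω ι (sgn s) *ω i√3) *ω ι (bernoulliPoly (p ℕ.∸ 2) (+ 1 / 3))
      [mod p ])
    × (£ p 2 (ι (+ 1 / 3) *ω (ι (+ 1 / 1) +ω ω₆^ s))
      ≡ (-ω ι ((fermatQuotient p 3 ^ℚ 2) ℚ.* (+ 1 / 8)))
        +ω ι (+ 1 / 36) *ω (ι (legendre p 3) +ω ι (sgn s) *ω i√3) *ω ι (bernoulliPoly (p ℕ.∸ 2) (+ 1 / 3))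
      [mod p ])
  theorem s =
      ≋⇒≡[mod] (trans (value-polylog₂ (1# + ω s)) (cong (£ p 2) (value-1+ω s))) (value-rhs₁ s) (congruence₁ s)
    , ≋⇒≡[mod] (trans (value-polylog₂ (z s)) (cong (£ p 2) (value-z s))) (value-rhs₂ s) (congruence₂ s)

theorem4p3 : (p : ℕ) → Prime p → 3 < p → (s : Sign) →
    (£ p 2 (ι (+ 1 / 1) +ω ω₆^ s)
    ≡ (-ω (ι ((fermatQuotient p 3 ^ℚ 2) *ℚ (+ 1 / 16)) *ω (ι (+ 3 / 1) +ω ι (sgn s) *ω i√3 *ω ι (legendre p 3))))
    +ω ι (+ 1 / 36) *ω (ι (+ 3 / 1) *ω ι (legendre p 3) -ω ι (sgn s) *ω i√3) *ω ι (bernoulliPoly (p ∸ 2) (+ 1 / 3))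
    [mod p ])
    × (£ p 2 (ι (+ 1 / 3) *ω (ι (+ 1 / 1) +ω ω₆^ s))
    ≡ (-ω ι ((fermatQuotient p 3 ^ℚ 2) *ℚ (+ 1 / 8)))
    +ω ι (+ 1 / 36) *ω (ι (legendre p 3) +ω ι (sgn s) *ω i√3) *ω ι (bernoulliPoly (p ∸ 2) (+ 1 / 3))
    [mod p ])
theorem4p3 (suc (suc (suc (suc d)))) p-prime (s≤s (s≤s (s≤s (s≤s z≤n)))) s = Main.theorem d p-prime s
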